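{- Let $\theta\in[1/2,1)$, $c\in[2\theta-1,\theta]$ and $\varepsilon>0$. There is $N_0(\varepsilon)$ (depending only on $\varepsilon$) such that for every integer $N>N_0(\varepsilon)$ and every real $y$ with $$(16\log N)^{1/(2\varepsilon)}\le y\le N,$$ the following holds. For each prime $p\in[y,2y]$ let $R_p\subseteq\mathbb Z_p$ be an arbitrary prescribed arithmetic progression with $|R_p|\le p^{\theta}$. Let $A$ be the set of all integers $n\in\{0,1,\dots,N\}$ such that $n\bmod p\in R_p$ for every prime $p\in[y,2y]$. If there exists an arithmetic progression $Q\subseteq\mathbb Z$ with $|Q|\ge y^{c}$ such that $$|A\cap Q|\ge 8\,y^{\frac{2\theta-1-c}{2}+\varepsilon}\,|Q|,$$ then $A$ is an arithmetic progression.
   Context: $\mathbb Z_p=\mathbb Z/p\mathbb Z$. An arithmetic progression in an abelian group $G$ is a finite set $\{a+jd:0\le j\le k\}$ with $a,d\in G$, $k\ge0$ an integer. -}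

module Defs where

open import Level using (0ℓ)
open import Axiom.ExcludedMiddle using (ExcludedMiddle)
open import Algebra.Bundles using (AbelianGroup)
open import Data.Integer as ℤ using (ℤ; +_; -[1+_])
import Data.Integer.Divisibility.Signed as ℤ∣
import Data.Integer.Properties as ℤₚ
import Data.Integer.Tactic.RingSolver as ℤ-Ring
open import Data.List using (length)
import Data.List.Membership.Setoid as Membership
import Data.List.Relation.Unary.Unique.Setoid as UniqueSetoid
open import Data.Nat as ℕ using (ℕ; zero; suc)
import Data.Nat.Coprimality as Coprime
import Data.Nat.Properties as ℕₚ
open import Data.Nat.Primality using (Prime)
open import Data.Product using (∃; _×_; _,_; proj₁; proj₂)
open import Data.Rational as ℚ using (ℚ; mkℚ; 0ℚ; 1ℚ; ½)
import Data.Rational.Properties as ℚₚ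
import Data.Rational.Unnormalised as ℚᵘ
import Data.Rational.Unnormalised.Properties as ℚᵘₚ
open import Data.Sum using (inj₁; inj₂)
open import Function using (_⇔_)
open import Relation.Binary using (Setoid)
open import Relation.Binary.PropositionalEquality
  using (_≡_; refl; sym; trans; cong; cong₂; subst)
open import Relation.Nullary using (yes; no)
open import Relation.Nullary.Decidable using (dec⇒maybe)
open import Relation.Unary using (Pred)
open import Tactic.RingSolver using (solve-∀)
open import Tactic.RingSolver.Core.AlmostCommutativeRing
  using (AlmostCommutativeRing; fromCommutativeRing)

infix 9 _/1

_/1 : ℕ → ℚ
n /1 = + n ℚ./ 1

module RationalIdentities where
  open import Data.Rational using (_+_; _*_; _-_; -_)

  ring : AlmostCommutativeRing _ _
  ring = fromCommutativeRing ℚₚ.+-*-commutativeRing (λ x → dec⇒maybe (0ℚ ℚₚ.≟ x))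

  neg-sub : ∀ a b → - (a - b) ≡ b - a
  neg-sub = solve-∀ ring

  neg-sub-neg : ∀ a b → (- a) - (- b) ≡ - (a - b)
  neg-sub-neg = solve-∀ ring

  telescope : ∀ a b c → (a - b) + (b - c) ≡ a - c
  telescope = solve-∀ ring

  sub-add : ∀ a c → a ≡ (a - c) + c
  sub-add = solve-∀ ring

  +-sub-+ : ∀ a b c d → (a + b) - (c + d) ≡ (a - c) + (b - d)
  +-sub-+ = solve-∀ ring

  +-sub-+ˡ : ∀ o x y → (o + x) - (o + y) ≡ x - y
  +-sub-+ˡ = solve-∀ ring

  +-subʳ : ∀ s t u → (s + t) - u ≡ (s - u) + t
  +-subʳ = solve-∀ ring

  +-subˡ : ∀ s t → (s + t) - s ≡ t
  +-subˡ = solve-∀ ring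

  +-swap : ∀ m b o → (m + b) + o ≡ (m + o) + b
  +-swap = solve-∀ ring

  *-sub-* : ∀ a b c d → a * b - c * d ≡ a * (b - d) + d * (a - c)
  *-sub-* = solve-∀ ring

  *-swap : ∀ s e r → s * (e * r) ≡ e * (s * r)
  *-swap = solve-∀ ring

  *-swap′ : ∀ s e r → s * e * r ≡ e * (s * r)
  *-swap′ = solve-∀ ring

  *-double : ∀ t b r → t * b * r + t * b * r ≡ t * ((b + b) * r)
  *-double = solve-∀ ring

  term-split : ∀ t a u b r →
    t * a * r - u * b * r ≡ ((t - u) * a + u * (a - b)) * r
  term-split = solve-∀ ring

  term-merge : ∀ D t c K s r →
    (D * t * c * (K * s) + t * c * s * D) * r ≡ D * (t * c * s) * ((K + 1ℚ) * r)
  term-merge = solve-∀ ring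

open RationalIdentities

module RationalLemmas where
  open import Data.Rational using (_+_; _*_; _-_; -_; _≤_; _<_; ∣_∣)
  open ℚₚ

  ∣-∣-sym : ∀ p q → ∣ p - q ∣ ≡ ∣ q - p ∣
  ∣-∣-sym p q = trans (sym (∣-p∣≡∣p∣ (p - q)))
    (cong ∣_∣ (neg-sub p q))

  triangle : ∀ p q r → ∣ p - r ∣ ≤ ∣ p - q ∣ + ∣ q - r ∣
  triangle p q r = subst (λ z → ∣ z ∣ ≤ ∣ p - q ∣ + ∣ q - r ∣)
    (telescope p q r)
    (∣p+q∣≤∣p∣+∣q∣ (p - q) (q - r))

  *-monoˡ : ∀ {a b c} → 0ℚ ≤ c → a ≤ b → c * a ≤ c * b
  *-monoˡ {c = c} 0≤c a≤b = *-monoˡ-≤-nonNeg c {{ℚ.nonNegative 0≤c}} a≤b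

  *-monoʳ : ∀ {a b c} → 0ℚ ≤ c → a ≤ b → a * c ≤ b * c
  *-monoʳ {c = c} 0≤c a≤b = *-monoʳ-≤-nonNeg c {{ℚ.nonNegative 0≤c}} a≤b

  *-mono : ∀ {a b c d} → 0ℚ ≤ b → 0ℚ ≤ c → a ≤ b → c ≤ d → a * c ≤ b * d
  *-mono 0≤b 0≤c a≤b c≤d = ≤-trans (*-monoʳ 0≤c a≤b) (*-monoˡ 0≤b c≤d)

  *-nonneg : ∀ {a b} → 0ℚ ≤ a → 0ℚ ≤ b → 0ℚ ≤ a * b
  *-nonneg {a} {b} 0≤a 0≤b =
    subst (_≤ a * b) (*-zeroʳ a) (*-monoˡ {0ℚ} {b} {a} 0≤a 0≤b)

  +-nonneg : ∀ {a b} → 0ℚ ≤ a → 0ℚ ≤ b → 0ℚ ≤ a + b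
  +-nonneg {a} {b} 0≤a 0≤b = +-mono-≤ {0ℚ} {a} {0ℚ} {b} 0≤a 0≤b

  ½+½ : ∀ e → e * ½ + e * ½ ≡ e
  ½+½ e = trans (sym (*-distribˡ-+ e ½ ½)) (*-identityʳ e)

  ½-pos : ∀ {e} → 0ℚ < e → 0ℚ < e * ½
  ½-pos {e} 0<e = subst (_< e * ½) (*-zeroˡ ½) (*-monoˡ-<-pos ½ 0<e)

  norm : ∀ n → n /1 ≡ mkℚ (+ n) 0 (Coprime.sym (Coprime.1-coprimeTo n))
  norm n = ↥p/↧p≡p (mkℚ (+ n) 0 (Coprime.sym (Coprime.1-coprimeTo n)))

  /1-mono : ∀ {m n} → m ℕ.≤ n → m /1 ≤ n /1
  /1-mono {m} {n} m≤n rewrite norm m | norm n =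
    ℚ.*≤* (ℤₚ.*-monoʳ-≤-nonNeg (+ 1) (ℤ.+≤+ m≤n))

  /1-nonneg : ∀ n → 0ℚ ≤ n /1
  /1-nonneg n = /1-mono {0} {n} ℕ.z≤n

  /1-suc : ∀ n → (suc n) /1 ≡ n /1 + 1ℚ
  /1-suc n rewrite norm n | norm (suc n) = toℚᵘ-injective
    (ℚᵘₚ.≃-trans (ℚᵘ.*≡* (eq (+ n)))
      (ℚᵘₚ.≃-sym (toℚᵘ-homo-+ (mkℚ (+ n) 0 (Coprime.sym (Coprime.1-coprimeTo n))) 1ℚ)))
    where
    eq : ∀ z → (ℤ.1ℤ ℤ.+ z) ℤ.* ℤ.1ℤ ≡ (z ℤ.* ℤ.1ℤ ℤ.+ ℤ.1ℤ ℤ.* ℤ.1ℤ) ℤ.* ℤ.1ℤ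
    eq = ℤ-Ring.solve-∀

  recip : ∀ n → (suc n) /1 * (+ 1 ℚ./ suc n) ≡ 1ℚ
  recip n = toℚᵘ-injective
    (ℚᵘₚ.≃-trans (toℚᵘ-homo-* ((suc n) /1) (+ 1 ℚ./ suc n))
    (ℚᵘₚ.≃-trans (ℚᵘₚ.*-cong (toℚᵘ-fromℚᵘ (ℚᵘ.mkℚᵘ (+ suc n) 0))
                              (toℚᵘ-fromℚᵘ (ℚᵘ.mkℚᵘ (+ 1) n)))
      (ℚᵘ.*≡* (eq (+ suc n)))))
    where
    eq : ∀ z → (z ℤ.* ℤ.1ℤ) ℤ.* ℤ.1ℤ ≡ ℤ.1ℤ ℤ.* (ℤ.1ℤ ℤ.* z)
    eq = ℤ-Ring.solve-∀

  recip-nonneg : ∀ n → 0ℚ ≤ + 1 ℚ./ suc n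
  recip-nonneg n = <⇒≤ (positive⁻¹ _ {{normalize-pos 1 (suc n)}})

  ceiling : ∀ p → ∃ λ n → p ≤ n /1
  ceiling p@(mkℚ z d _) = ℤ.∣ z ∣ , p≤
    where
    z≤∣z∣ : ∀ z → z ℤ.≤ + ℤ.∣ z ∣
    z≤∣z∣ (+ n)    = ℤₚ.≤-refl
    z≤∣z∣ -[1+ n ] = ℤ.-≤+
    p≤ : p ≤ ℤ.∣ z ∣ /1
    p≤ rewrite norm ℤ.∣ z ∣ = ℚ.*≤* (ℤₚ.≤-trans
      (ℤₚ.≤-reflexive (ℤₚ.*-identityʳ z))
      (ℤₚ.≤-trans (z≤∣z∣ z)
        (subst (ℤ._≤ + ℤ.∣ z ∣ ℤ.* + suc d) (ℤₚ.*-identityʳ (+ ℤ.∣ z ∣))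
          (ℤₚ.*-monoˡ-≤-nonNeg (+ ℤ.∣ z ∣) (ℤ.+≤+ (ℕ.s≤s ℕ.z≤n))))))

  archimedean : ∀ c e → 0ℚ < e → ∃ λ n → c ≤ n /1 * e
  archimedean c e 0<e = n , (begin
    c                    ≡⟨ *-identityʳ c ⟨
    c * 1ℚ               ≡⟨ cong (c *_) (*-inverseˡ e {{e≢0}}) ⟨
    c * (1/e * e)        ≡⟨ *-assoc c 1/e e ⟨
    c * 1/e * e          ≤⟨ *-monoʳ (<⇒≤ 0<e) (proj₂ (ceiling (c * 1/e))) ⟩
    n /1 * e           ∎)
    where
    open ≤-Reasoning
    e≢0 : ℚ.NonZero e
    e≢0 = pos⇒nonZero e {{ℚ.positive 0<e}}
    1/e : ℚ
    1/e = (ℚ.1/ e) {{e≢0}}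
    n : ℕ
    n = proj₁ (ceiling (c * 1/e))

open RationalLemmas

Cauchy : (ℕ → ℚ) → Set
Cauchy x = ∀ e → 0ℚ ℚ.< e →
  ∃ λ N → ∀ m n → N ℕ.≤ m → N ℕ.≤ n → ℚ.∣ x m ℚ.- x n ∣ ℚ.≤ e

-- Real numbers as Cauchy sequences of rationals, with equality _≈_ below.
record ℝ : Set where
  constructor mkℝ
  field
    seq    : ℕ → ℚ
    cauchy : Cauchy seq

open ℝ

module CauchyLemmas where
  open import Data.Rational using (_+_; _*_; _-_; -_; _≤_; _<_; ∣_∣)
  open ℚₚ

  const-cauchy : ∀ q → Cauchy (λ _ → q)
  const-cauchy q e 0<e = 0 , λ _ _ _ _ →
    ≤-trans (≤-reflexive (cong ∣_∣ (+-inverseʳ q))) (<⇒≤ 0<e)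

  neg-cauchy : ∀ {x} → Cauchy x → Cauchy (λ n → - x n)
  neg-cauchy {x} cx e 0<e with N , h ← cx e 0<e = N , λ m n N≤m N≤n →
    ≤-trans (≤-reflexive (trans
      (cong ∣_∣ (neg-sub-neg (x m) (x n)))
      (∣-p∣≡∣p∣ (x m - x n)))) (h m n N≤m N≤n)

  +-cauchy : ∀ {x y} → Cauchy x → Cauchy y → Cauchy (λ n → x n + y n)
  +-cauchy {x} {y} cx cy e 0<e
    with M , f ← cx (e * ½) (½-pos 0<e) | N , g ← cy (e * ½) (½-pos 0<e) =
    M ℕ.⊔ N , λ m n ≤m ≤n → begin
      ∣ (x m + y m) - (x n + y n) ∣
        ≡⟨ cong ∣_∣ (+-sub-+ (x m) (y m) (x n) (y n)) ⟩
      ∣ (x m - x n) + (y m - y n) ∣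
        ≤⟨ ∣p+q∣≤∣p∣+∣q∣ (x m - x n) (y m - y n) ⟩
      ∣ x m - x n ∣ + ∣ y m - y n ∣
        ≤⟨ +-mono-≤ (f m n (ℕₚ.m⊔n≤o⇒m≤o M N ≤m) (ℕₚ.m⊔n≤o⇒m≤o M N ≤n))
                    (g m n (ℕₚ.m⊔n≤o⇒n≤o M N ≤m) (ℕₚ.m⊔n≤o⇒n≤o M N ≤n)) ⟩
      e * ½ + e * ½ ≡⟨ ½+½ e ⟩
      e ∎
    where
    open ≤-Reasoning

  bounded : ∀ {x} → Cauchy x → ∃ λ b → ∃ λ N → ∀ n → N ℕ.≤ n → ∣ x n ∣ ≤ b /1
  bounded {x} cx with N , h ← cx 1ℚ (positive⁻¹ 1ℚ)
    with b , le ← ceiling (1ℚ + ∣ x N ∣) = b , N , λ n N≤n → begin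
      ∣ x n ∣                ≡⟨ cong ∣_∣ (sub-add (x n) (x N)) ⟩
      ∣ (x n - x N) + x N ∣  ≤⟨ ∣p+q∣≤∣p∣+∣q∣ (x n - x N) (x N) ⟩
      ∣ x n - x N ∣ + ∣ x N ∣ ≤⟨ +-monoˡ-≤ ∣ x N ∣ (h n N N≤n ℕₚ.≤-refl) ⟩
      1ℚ + ∣ x N ∣           ≤⟨ le ⟩
      b /1                 ∎
    where
    open ≤-Reasoning

  -- A positive d with b d ≤ e.
  shrink : ∀ b e → 0ℚ < e → ∃ λ d → 0ℚ < d × b /1 * d ≤ e
  shrink b e 0<e = e * r , 0<d , (begin
    b /1 * (e * r)       ≤⟨ *-monoʳ (<⇒≤ 0<d) (/1-mono (ℕₚ.n≤1+n b)) ⟩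
    (suc b) /1 * (e * r)
      ≡⟨ *-swap ((suc b) /1) e r ⟩
    e * ((suc b) /1 * r)   ≡⟨ cong (e *_) (recip b) ⟩
    e * 1ℚ                 ≡⟨ *-identityʳ e ⟩
    e                      ∎)
    where
    open ≤-Reasoning
    r : ℚ
    r = + 1 ℚ./ suc b
    0<d : 0ℚ < e * r
    0<d = subst (_< e * r) (*-zeroˡ r)
            (*-monoˡ-<-pos r {{normalize-pos 1 (suc b)}} 0<e)

  *-modulus : ∀ {x y : ℕ → ℚ} e b B c C d d′ M N →
    (∀ n → B ℕ.≤ n → ∣ x n ∣ ≤ b /1) → (∀ n → C ℕ.≤ n → ∣ y n ∣ ≤ c /1) →
    b /1 * d ≤ e * ½ → c /1 * d′ ≤ e * ½ →
    (∀ m n → M ℕ.≤ m → M ℕ.≤ n → ∣ x m - x n ∣ ≤ d′) →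
    (∀ m n → N ℕ.≤ m → N ℕ.≤ n → ∣ y m - y n ∣ ≤ d) →
    ∃ λ K → ∀ m n → K ℕ.≤ m → K ℕ.≤ n → ∣ x m * y m - x n * y n ∣ ≤ e
  *-modulus {x} {y} e b B c C d d′ M N hb hc bd cd f g =
    B ℕ.⊔ C ℕ.⊔ (M ℕ.⊔ N) , λ m n ≤m ≤n → begin
      ∣ x m * y m - x n * y n ∣
        ≡⟨ cong ∣_∣ (*-sub-* (x m) (y m) (x n) (y n)) ⟩
      ∣ x m * (y m - y n) + y n * (x m - x n) ∣
        ≤⟨ ∣p+q∣≤∣p∣+∣q∣ (x m * (y m - y n)) (y n * (x m - x n)) ⟩
      ∣ x m * (y m - y n) ∣ + ∣ y n * (x m - x n) ∣
        ≡⟨ cong₂ _+_ (∣p*q∣≡∣p∣*∣q∣ (x m) (y m - y n)) (∣p*q∣≡∣p∣*∣q∣ (y n) (x m - x n)) ⟩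
      ∣ x m ∣ * ∣ y m - y n ∣ + ∣ y n ∣ * ∣ x m - x n ∣
        ≤⟨ +-mono-≤
             (*-mono (/1-nonneg b) (0≤∣p∣ (y m - y n)) (hb m (toB ≤m)) (g m n (toN ≤m) (toN ≤n)))
             (*-mono (/1-nonneg c) (0≤∣p∣ (x m - x n)) (hc n (toC ≤n)) (f m n (toM ≤m) (toM ≤n))) ⟩
      b /1 * d + c /1 * d′ ≤⟨ +-mono-≤ bd cd ⟩
      e * ½ + e * ½ ≡⟨ ½+½ e ⟩
      e ∎
    where
    open ≤-Reasoning
    toB : ∀ {k} → B ℕ.⊔ C ℕ.⊔ (M ℕ.⊔ N) ℕ.≤ k → B ℕ.≤ k
    toB h = ℕₚ.m⊔n≤o⇒m≤o B C (ℕₚ.m⊔n≤o⇒m≤o (B ℕ.⊔ C) (M ℕ.⊔ N) h)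
    toC : ∀ {k} → B ℕ.⊔ C ℕ.⊔ (M ℕ.⊔ N) ℕ.≤ k → C ℕ.≤ k
    toC h = ℕₚ.m⊔n≤o⇒n≤o B C (ℕₚ.m⊔n≤o⇒m≤o (B ℕ.⊔ C) (M ℕ.⊔ N) h)
    toM : ∀ {k} → B ℕ.⊔ C ℕ.⊔ (M ℕ.⊔ N) ℕ.≤ k → M ℕ.≤ k
    toM h = ℕₚ.m⊔n≤o⇒m≤o M N (ℕₚ.m⊔n≤o⇒n≤o (B ℕ.⊔ C) (M ℕ.⊔ N) h)
    toN : ∀ {k} → B ℕ.⊔ C ℕ.⊔ (M ℕ.⊔ N) ℕ.≤ k → N ℕ.≤ k
    toN h = ℕₚ.m⊔n≤o⇒n≤o M N (ℕₚ.m⊔n≤o⇒n≤o (B ℕ.⊔ C) (M ℕ.⊔ N) h)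

  *-cauchy : ∀ {x y} → Cauchy x → Cauchy y → Cauchy (λ n → x n * y n)
  *-cauchy {x} {y} cx cy e 0<e =
    let b , B , hb = bounded cx
        c , C , hc = bounded cy
        d , 0<d , bd = shrink b (e * ½) (½-pos 0<e)
        d′ , 0<d′ , cd = shrink c (e * ½) (½-pos 0<e)
        M , f = cx d′ 0<d′
        N , g = cy d 0<d
    in *-modulus {x} {y} e b B c C d d′ M N hb hc bd cd f g

-- expTerm a k = aᵏ / k!
expTerm : ℚ → ℕ → ℚ
expTerm a zero    = 1ℚ
expTerm a (suc k) = expTerm a k ℚ.* a ℚ.* (+ 1 ℚ./ suc k)

expSum : ℚ → ℕ → ℚ
expSum a zero    = 1ℚ
expSum a (suc n) = expSum a n ℚ.+ expTerm a (suc n)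

module ExpLemmas where
  open import Data.Rational using (_+_; _*_; _-_; -_; _≤_; _<_; ∣_∣)
  open ℚₚ
  open CauchyLemmas

  term-nonneg : ∀ {b} → 0ℚ ≤ b → ∀ k → 0ℚ ≤ expTerm b k
  term-nonneg 0≤b zero    = <⇒≤ (positive⁻¹ 1ℚ)
  term-nonneg 0≤b (suc k) =
    *-nonneg (*-nonneg (term-nonneg 0≤b k) 0≤b) (recip-nonneg k)

  sum-nonneg : ∀ {b} → 0ℚ ≤ b → ∀ n → 0ℚ ≤ expSum b n
  sum-nonneg 0≤b zero    = <⇒≤ (positive⁻¹ 1ℚ)
  sum-nonneg 0≤b (suc n) = +-nonneg (sum-nonneg 0≤b n) (term-nonneg 0≤b (suc n))

  term-bound : ∀ {a b} → ∣ a ∣ ≤ b → ∀ k → ∣ expTerm a k ∣ ≤ expTerm b k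
  term-bound {a} {b} a≤b zero    = ≤-refl
  term-bound {a} {b} a≤b (suc k) = begin
    ∣ expTerm a k * a * r ∣         ≡⟨ ∣p*q∣≡∣p∣*∣q∣ (expTerm a k * a) r ⟩
    ∣ expTerm a k * a ∣ * ∣ r ∣     ≡⟨ cong₂ _*_ (∣p*q∣≡∣p∣*∣q∣ (expTerm a k) a)
                                                  (0≤p⇒∣p∣≡p (recip-nonneg k)) ⟩
    ∣ expTerm a k ∣ * ∣ a ∣ * r     ≤⟨ *-monoʳ (recip-nonneg k)
                                         (*-mono (term-nonneg 0≤b k) (0≤∣p∣ a)
                                           (term-bound a≤b k) a≤b) ⟩
    expTerm b k * b * r             ∎
    where
    open ≤-Reasoning
    r : ℚ
    r = + 1 ℚ./ suc k
    0≤b : 0ℚ ≤ b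
    0≤b = ≤-trans (0≤∣p∣ a) a≤b

  term-lipschitz : ∀ {a b c} → ∣ a ∣ ≤ c → ∣ b ∣ ≤ c → ∀ k →
    ∣ expTerm a (suc k) - expTerm b (suc k) ∣ ≤ ∣ a - b ∣ * expTerm c k
  term-lipschitz {a} {b} a≤c b≤c zero = ≤-reflexive
    (trans (cong ∣_∣ (cong₂ _-_ (one a) (one b))) (sym (*-identityʳ ∣ a - b ∣)))
    where
    one : ∀ x → 1ℚ * x * 1ℚ ≡ x
    one x = trans (*-identityʳ (1ℚ * x)) (*-identityˡ x)
  term-lipschitz {a} {b} {c} a≤c b≤c (suc k) = begin
    ∣ ta * a * r - tb * b * r ∣
      ≡⟨ cong ∣_∣ (term-split ta a tb b r) ⟩
    ∣ ((ta - tb) * a + tb * (a - b)) * r ∣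
      ≡⟨ ∣p*q∣≡∣p∣*∣q∣ ((ta - tb) * a + tb * (a - b)) r ⟩
    ∣ (ta - tb) * a + tb * (a - b) ∣ * ∣ r ∣
      ≡⟨ cong (∣ (ta - tb) * a + tb * (a - b) ∣ *_) (0≤p⇒∣p∣≡p 0≤r) ⟩
    ∣ (ta - tb) * a + tb * (a - b) ∣ * r
      ≤⟨ *-monoʳ 0≤r (∣p+q∣≤∣p∣+∣q∣ ((ta - tb) * a) (tb * (a - b))) ⟩
    (∣ (ta - tb) * a ∣ + ∣ tb * (a - b) ∣) * r
      ≡⟨ cong (_* r) (cong₂ _+_ (∣p*q∣≡∣p∣*∣q∣ (ta - tb) a) (∣p*q∣≡∣p∣*∣q∣ tb (a - b))) ⟩
    (∣ ta - tb ∣ * ∣ a ∣ + ∣ tb ∣ * D) * r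
      ≤⟨ *-monoʳ 0≤r (+-mono-≤
           (*-mono (*-nonneg (0≤∣p∣ (a - b)) (term-nonneg 0≤c k)) (0≤∣p∣ a)
             (term-lipschitz a≤c b≤c k) a≤c)
           (*-monoʳ (0≤∣p∣ (a - b)) (term-bound b≤c (suc k)))) ⟩
    (D * tc * c + tc * c * s * D) * r
      ≡⟨ cong (λ z → (z + tc * c * s * D) * r) (begin-equality
           D * tc * c             ≡⟨ *-identityʳ (D * tc * c) ⟨
           D * tc * c * 1ℚ        ≡⟨ cong (D * tc * c *_) (recip k) ⟨
           D * tc * c * (K * s)   ∎) ⟩
    (D * tc * c * (K * s) + tc * c * s * D) * r
      ≡⟨ term-merge D tc c K s r ⟩
    D * (tc * c * s) * ((K + 1ℚ) * r)
      ≡⟨ cong (D * (tc * c * s) *_)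
           (trans (cong (_* r) (sym (/1-suc (suc k)))) (recip (suc k))) ⟩
    D * (tc * c * s) * 1ℚ
      ≡⟨ *-identityʳ (D * (tc * c * s)) ⟩
    D * (tc * c * s) ∎
    where
    open ≤-Reasoning
    ta tb tc r s K D : ℚ
    ta = expTerm a (suc k)
    tb = expTerm b (suc k)
    tc = expTerm c k
    r = + 1 ℚ./ suc (suc k)
    s = + 1 ℚ./ suc k
    K = (suc k) /1
    D = ∣ a - b ∣
    0≤r : 0ℚ ≤ r
    0≤r = recip-nonneg (suc k)
    0≤c : 0ℚ ≤ c
    0≤c = ≤-trans (0≤∣p∣ a) a≤c

  sum-lipschitz : ∀ {a b c} → ∣ a ∣ ≤ c → ∣ b ∣ ≤ c → ∀ n →
    ∣ expSum a (suc n) - expSum b (suc n) ∣ ≤ ∣ a - b ∣ * expSum c n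
  sum-lipschitz {a} {b} {c} a≤c b≤c zero = ≤-trans
    (≤-reflexive (cong ∣_∣ (+-sub-+ˡ 1ℚ (expTerm a 1) (expTerm b 1))))
    (term-lipschitz a≤c b≤c 0)
  sum-lipschitz {a} {b} {c} a≤c b≤c (suc n) = begin
    ∣ (sa + ta) - (sb + tb) ∣
      ≡⟨ cong ∣_∣ (+-sub-+ sa ta sb tb) ⟩
    ∣ (sa - sb) + (ta - tb) ∣   ≤⟨ ∣p+q∣≤∣p∣+∣q∣ (sa - sb) (ta - tb) ⟩
    ∣ sa - sb ∣ + ∣ ta - tb ∣   ≤⟨ +-mono-≤ (sum-lipschitz a≤c b≤c n)
                                             (term-lipschitz a≤c b≤c (suc n)) ⟩
    ∣ a - b ∣ * expSum c n + ∣ a - b ∣ * expTerm c (suc n)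
      ≡⟨ *-distribˡ-+ ∣ a - b ∣ (expSum c n) (expTerm c (suc n)) ⟨
    ∣ a - b ∣ * expSum c (suc n) ∎
    where
    open ≤-Reasoning
    sa sb ta tb : ℚ
    sa = expSum a (suc n)
    sb = expSum b (suc n)
    ta = expTerm a (suc (suc n))
    tb = expTerm b (suc (suc n))

  term≤½term : ∀ b n → b ℕ.+ b ℕ.≤ n →
    expTerm (b /1) (suc n) + expTerm (b /1) (suc n) ≤ expTerm (b /1) n
  term≤½term b n 2b≤n = begin
    t * B * r + t * B * r
      ≡⟨ *-double t B r ⟩
    t * ((B + B) * r)
      ≤⟨ *-monoˡ (term-nonneg (/1-nonneg b) n) (*-monoʳ (recip-nonneg n) B+B≤) ⟩
    t * ((suc n) /1 * r)  ≡⟨ cong (t *_) (recip n) ⟩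
    t * 1ℚ                ≡⟨ *-identityʳ t ⟩
    t                     ∎
    where
    open ≤-Reasoning
    B t r : ℚ
    B = b /1
    t = expTerm B n
    r = + 1 ℚ./ suc n
    add : ∀ m → (m ℕ.+ b) /1 ≡ m /1 + B
    add zero    = sym (+-identityˡ B)
    add (suc m) = trans (/1-suc (m ℕ.+ b)) (trans (cong (_+ 1ℚ) (add m))
      (trans (+-swap (m /1) B 1ℚ)
        (cong (_+ B) (sym (/1-suc m)))))
    B+B≤ : B + B ≤ (suc n) /1
    B+B≤ = subst (_≤ (suc n) /1) (add b) (/1-mono (ℕₚ.m≤n⇒m≤1+n 2b≤n))

  sum+term-antitone : ∀ b n d → b ℕ.+ b ℕ.≤ n →
    expSum (b /1) (d ℕ.+ n) + expTerm (b /1) (d ℕ.+ n)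
      ≤ expSum (b /1) n + expTerm (b /1) n
  sum+term-antitone b n zero    2b≤n = ≤-refl
  sum+term-antitone b n (suc d) 2b≤n = begin
    (S + T) + T   ≡⟨ +-assoc S T T ⟩
    S + (T + T)   ≤⟨ +-monoʳ-≤ S (term≤½term b (d ℕ.+ n)
                       (ℕₚ.≤-trans 2b≤n (ℕₚ.m≤n+m n d))) ⟩
    S + expTerm (b /1) (d ℕ.+ n)  ≤⟨ sum+term-antitone b n d 2b≤n ⟩
    expSum (b /1) n + expTerm (b /1) n ∎
    where
    open ≤-Reasoning
    S T : ℚ
    S = expSum (b /1) (d ℕ.+ n)
    T = expTerm (b /1) (suc (d ℕ.+ n))

  tail-bound : ∀ {a c} → ∣ a ∣ ≤ c → ∀ n d →
    ∣ expSum a (d ℕ.+ n) - expSum a n ∣ ≤ expSum c (d ℕ.+ n) - expSum c n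
  tail-bound {a} {c} a≤c n zero = ≤-reflexive
    (trans (cong ∣_∣ (+-inverseʳ (expSum a n))) (sym (+-inverseʳ (expSum c n))))
  tail-bound {a} {c} a≤c n (suc d) = begin
    ∣ (sa + ta) - expSum a n ∣
      ≡⟨ cong ∣_∣ (+-subʳ sa ta (expSum a n)) ⟩
    ∣ (sa - expSum a n) + ta ∣      ≤⟨ ∣p+q∣≤∣p∣+∣q∣ (sa - expSum a n) ta ⟩
    ∣ sa - expSum a n ∣ + ∣ ta ∣    ≤⟨ +-mono-≤ (tail-bound a≤c n d)
                                                 (term-bound a≤c (suc (d ℕ.+ n))) ⟩
    (sc - expSum c n) + tc
      ≡⟨ +-subʳ sc tc (expSum c n) ⟨
    (sc + tc) - expSum c n ∎
    where
    open ≤-Reasoning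
    sa ta sc tc : ℚ
    sa = expSum a (d ℕ.+ n)
    ta = expTerm a (suc (d ℕ.+ n))
    sc = expSum c (d ℕ.+ n)
    tc = expTerm c (suc (d ℕ.+ n))

  tail≤term : ∀ b n d → b ℕ.+ b ℕ.≤ n →
    expSum (b /1) (d ℕ.+ n) - expSum (b /1) n ≤ expTerm (b /1) n
  tail≤term b n d 2b≤n = begin
    S′ - S               ≤⟨ +-monoˡ-≤ (- S) S′≤ ⟩
    (S + T) - S          ≡⟨ +-subˡ S T ⟩
    T                    ∎
    where
    open ≤-Reasoning
    S S′ T T′ : ℚ
    S = expSum (b /1) n
    S′ = expSum (b /1) (d ℕ.+ n)
    T = expTerm (b /1) n
    T′ = expTerm (b /1) (d ℕ.+ n)
    S′≤ : S′ ≤ S + T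
    S′≤ = begin
      S′       ≡⟨ +-identityʳ S′ ⟨
      S′ + 0ℚ  ≤⟨ +-monoʳ-≤ S′ (term-nonneg (/1-nonneg b) (d ℕ.+ n)) ⟩
      S′ + T′  ≤⟨ sum+term-antitone b n d 2b≤n ⟩
      S + T    ∎

  sum-bound : ∀ b → ∃ λ c → ∀ n → b ℕ.+ b ℕ.≤ n →
    expSum (b /1) n + expTerm (b /1) n ≤ c /1
  sum-bound b with c , le ← ceiling (expSum (b /1) (b ℕ.+ b) + expTerm (b /1) (b ℕ.+ b)) =
    c , λ n 2b≤n → ≤-trans
      (subst (λ k → expSum (b /1) k + expTerm (b /1) k
                      ≤ expSum (b /1) (b ℕ.+ b) + expTerm (b /1) (b ℕ.+ b))
        (ℕₚ.m∸n+n≡m 2b≤n)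
        (sum+term-antitone b (b ℕ.+ b) (n ℕ.∸ (b ℕ.+ b)) ℕₚ.≤-refl)) le

  term-modulus : ∀ b e c M → 0ℚ < e →
    (∀ n → b ℕ.+ b ℕ.≤ n → expSum (b /1) n + expTerm (b /1) n ≤ c /1) →
    c /1 * b /1 ≤ M /1 * e →
    ∃ λ N → ∀ n → N ℕ.≤ n → expTerm (b /1) (suc n) ≤ e
  term-modulus b e c M 0<e hc hM =
    (b ℕ.+ b) ℕ.⊔ M , λ n N≤n → begin
      expTerm B n * B * r n
        ≤⟨ *-monoʳ (recip-nonneg n) (*-monoʳ (/1-nonneg b)
             (t≤c n (ℕₚ.m⊔n≤o⇒m≤o (b ℕ.+ b) M N≤n))) ⟩
      c /1 * B * r n              ≤⟨ *-monoʳ (recip-nonneg n) hM ⟩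
      M /1 * e * r n
        ≤⟨ *-monoʳ (recip-nonneg n) (*-monoʳ (<⇒≤ 0<e)
             (/1-mono (ℕₚ.m≤n⇒m≤1+n (ℕₚ.m⊔n≤o⇒n≤o (b ℕ.+ b) M N≤n)))) ⟩
      (suc n) /1 * e * r n
        ≡⟨ *-swap′ ((suc n) /1) e (r n) ⟩
      e * ((suc n) /1 * r n)        ≡⟨ cong (e *_) (recip n) ⟩
      e * 1ℚ                        ≡⟨ *-identityʳ e ⟩
      e                             ∎
    where
    open ≤-Reasoning
    B : ℚ
    B = b /1
    r : ℕ → ℚ
    r n = + 1 ℚ./ suc n
    t≤c : ∀ n → b ℕ.+ b ℕ.≤ n → expTerm B n ≤ c /1
    t≤c n h = ≤-trans
      (subst (_≤ expSum B n + expTerm B n) (+-identityˡ (expTerm B n))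
        (+-monoˡ-≤ (expTerm B n) (sum-nonneg (/1-nonneg b) n)))
      (hc n h)

  term-small : ∀ b e → 0ℚ < e → ∃ λ N → ∀ n → N ℕ.≤ n → expTerm (b /1) (suc n) ≤ e
  term-small b e 0<e =
    let c , hc = sum-bound b
        M , hM = archimedean (c /1 * b /1) e 0<e
    in term-modulus b e c M 0<e hc hM

  exp-modulus : ∀ {x : ℕ → ℚ} e b X c d M T →
    (∀ n → X ℕ.≤ n → ∣ x n ∣ ≤ b /1) →
    (∀ n → b ℕ.+ b ℕ.≤ n → expSum (b /1) n + expTerm (b /1) n ≤ c /1) →
    0ℚ < d → c /1 * d ≤ e * ½ →
    (∀ m n → M ℕ.≤ m → M ℕ.≤ n → ∣ x m - x n ∣ ≤ d) →
    (∀ n → T ℕ.≤ n → expTerm (b /1) (suc n) ≤ e * ½) →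
    ∃ λ K → ∀ m n → K ℕ.≤ m → K ℕ.≤ n → ∣ expSum (x m) m - expSum (x n) n ∣ ≤ e
  exp-modulus {x} e b X c d M T hb hc 0<d cd hM hT =
    suc N , main
    where
    open ≤-Reasoning
    B : ℚ
    B = b /1
    N : ℕ
    N = X ℕ.⊔ (b ℕ.+ b) ℕ.⊔ (M ℕ.⊔ T)
    toX : ∀ {k} → N ℕ.≤ k → X ℕ.≤ k
    toX h = ℕₚ.m⊔n≤o⇒m≤o X (b ℕ.+ b) (ℕₚ.m⊔n≤o⇒m≤o (X ℕ.⊔ (b ℕ.+ b)) (M ℕ.⊔ T) h)
    to2b : ∀ {k} → N ℕ.≤ k → b ℕ.+ b ℕ.≤ k
    to2b h = ℕₚ.m⊔n≤o⇒n≤o X (b ℕ.+ b) (ℕₚ.m⊔n≤o⇒m≤o (X ℕ.⊔ (b ℕ.+ b)) (M ℕ.⊔ T) h)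
    toM : ∀ {k} → N ℕ.≤ k → M ℕ.≤ k
    toM h = ℕₚ.m⊔n≤o⇒m≤o M T (ℕₚ.m⊔n≤o⇒n≤o (X ℕ.⊔ (b ℕ.+ b)) (M ℕ.⊔ T) h)
    toT : ∀ {k} → N ℕ.≤ k → T ℕ.≤ k
    toT h = ℕₚ.m⊔n≤o⇒n≤o M T (ℕₚ.m⊔n≤o⇒n≤o (X ℕ.⊔ (b ℕ.+ b)) (M ℕ.⊔ T) h)

    S≤c : ∀ n → N ℕ.≤ n → expSum B n ≤ c /1
    S≤c n h = ≤-trans
      (subst (_≤ expSum B n + expTerm B n) (+-identityʳ (expSum B n))
        (+-monoʳ-≤ (expSum B n) (term-nonneg (/1-nonneg b) n)))
      (hc n (to2b h))

    ordered : ∀ n k → N ℕ.≤ n →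
      ∣ expSum (x (k ℕ.+ suc n)) (k ℕ.+ suc n) - expSum (x (suc n)) (suc n) ∣ ≤ e
    ordered n k N≤n = begin
      ∣ expSum a m - expSum a′ (suc n) ∣
        ≤⟨ triangle (expSum a m) (expSum a (suc n)) (expSum a′ (suc n)) ⟩
      ∣ expSum a m - expSum a (suc n) ∣ + ∣ expSum a (suc n) - expSum a′ (suc n) ∣
        ≤⟨ +-mono-≤ tail lip ⟩
      e * ½ + e * ½ ≡⟨ ½+½ e ⟩
      e ∎
      where
      m : ℕ
      m = k ℕ.+ suc n
      a a′ : ℚ
      a = x m
      a′ = x (suc n)
      N≤1+n : N ℕ.≤ suc n
      N≤1+n = ℕₚ.m≤n⇒m≤1+n N≤n
      N≤m : N ℕ.≤ m
      N≤m = ℕₚ.≤-trans N≤1+n (ℕₚ.m≤n+m (suc n) k)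
      a≤B : ∣ a ∣ ≤ B
      a≤B = hb m (toX N≤m)
      a′≤B : ∣ a′ ∣ ≤ B
      a′≤B = hb (suc n) (toX N≤1+n)
      tail : ∣ expSum a m - expSum a (suc n) ∣ ≤ e * ½
      tail = begin
        ∣ expSum a m - expSum a (suc n) ∣   ≤⟨ tail-bound a≤B (suc n) k ⟩
        expSum B m - expSum B (suc n)       ≤⟨ tail≤term b (suc n) k (to2b N≤1+n) ⟩
        expTerm B (suc n)                   ≤⟨ hT n (toT N≤n) ⟩
        e * ½                               ∎
      lip : ∣ expSum a (suc n) - expSum a′ (suc n) ∣ ≤ e * ½
      lip = begin
        ∣ expSum a (suc n) - expSum a′ (suc n) ∣  ≤⟨ sum-lipschitz a≤B a′≤B n ⟩
        ∣ a - a′ ∣ * expSum B n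
          ≤⟨ *-mono (<⇒≤ 0<d) (sum-nonneg (/1-nonneg b) n)
               (hM m (suc n) (toM N≤m) (toM N≤1+n)) (S≤c n N≤n) ⟩
        d * c /1   ≡⟨ *-comm d (c /1) ⟩
        c /1 * d   ≤⟨ cd ⟩
        e * ½        ∎

    ordered′ : ∀ m n → suc N ℕ.≤ n → n ℕ.≤ m →
      ∣ expSum (x m) m - expSum (x n) n ∣ ≤ e
    ordered′ m (suc n) (ℕ.s≤s N≤n) n≤m =
      subst (λ k → ∣ expSum (x k) k - expSum (x (suc n)) (suc n) ∣ ≤ e)
        (ℕₚ.m∸n+n≡m n≤m) (ordered n (m ℕ.∸ suc n) N≤n)

    main : ∀ m n → suc N ℕ.≤ m → suc N ℕ.≤ n → ∣ expSum (x m) m - expSum (x n) n ∣ ≤ e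
    main m n N<m N<n with ℕₚ.≤-total n m
    ... | inj₁ n≤m = ordered′ m n N<n n≤m
    ... | inj₂ m≤n = subst (_≤ e) (∣-∣-sym (expSum (x n) n) (expSum (x m) m))
                       (ordered′ n m N<m m≤n)

  exp-cauchy : ∀ {x} → Cauchy x → Cauchy (λ n → expSum (x n) n)
  exp-cauchy {x} cx e 0<e =
    let b , X , hb = bounded cx
        c , hc = sum-bound b
        d , 0<d , cd = shrink c (e * ½) (½-pos 0<e)
        M , hM = cx d 0<d
        T , hT = term-small b (e * ½) (½-pos 0<e)
    in exp-modulus {x} e b X c d M T hb hc 0<d cd hM hT

open CauchyLemmas
open ExpLemmas

infix  8 -_
infixl 7 _*_
infixl 6 _+_ _-_
infix  4 _≤_ _<_ _≈_

fromℚ : ℚ → ℝ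
fromℚ q = mkℝ (λ _ → q) (const-cauchy q)

fromℕ : ℕ → ℝ
fromℕ n = fromℚ (n /1)

_+_ _*_ : ℝ → ℝ → ℝ
x + y = mkℝ (λ n → seq x n ℚ.+ seq y n) (+-cauchy {seq x} {seq y} (cauchy x) (cauchy y))
x * y = mkℝ (λ n → seq x n ℚ.* seq y n) (*-cauchy {seq x} {seq y} (cauchy x) (cauchy y))

-_ : ℝ → ℝ
- x = mkℝ (λ n → ℚ.- seq x n) (neg-cauchy {seq x} (cauchy x))

_-_ : ℝ → ℝ → ℝ
x - y = x + (- y)

_≤_ _<_ _≈_ : ℝ → ℝ → Set
x ≤ y = ∀ e → 0ℚ ℚ.< e → ∃ λ N → ∀ n → N ℕ.≤ n → seq x n ℚ.≤ seq y n ℚ.+ e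
x < y = ∃ λ e → 0ℚ ℚ.< e × ∃ λ N → ∀ n → N ℕ.≤ n → seq x n ℚ.+ e ℚ.≤ seq y n
x ≈ y = x ≤ y × y ≤ x

-- The sum of xᵏ / k! over all k, as the diagonal limit of
-- (sum over k ≤ n of xₙᵏ / k!).
exp : ℝ → ℝ
exp x = mkℝ (λ n → expSum (seq x n) n) (exp-cauchy (cauchy x))

HasSize : (S : Setoid 0ℓ 0ℓ) → Pred (Setoid.Carrier S) 0ℓ → ℕ → Set
HasSize S P n = ∃ λ xs → Unique xs × length xs ≡ n × (∀ x → P x ⇔ x ∈ xs)
  where
  open Membership S using (_∈_)
  open UniqueSetoid S using (Unique)

IsArithmeticProgression : (G : AbelianGroup 0ℓ 0ℓ) → Pred (AbelianGroup.Carrier G) 0ℓ → Set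
IsArithmeticProgression G P =
  ∃ λ a → ∃ λ d → ∃ λ k → ∀ x → P x ⇔ (∃ λ j → j ℕ.≤ k × x ≈ᴳ a ∙ (j · d))
  where
  open AbelianGroup G using (_∙_; rawMonoid) renaming (_≈_ to _≈ᴳ_)
  open import Algebra.Definitions.RawMonoid rawMonoid using () renaming (_×_ to _·_)

-- ℤ with addition; the carrier equality is _≡_.
ℤ-group : AbelianGroup 0ℓ 0ℓ
ℤ-group = ℤₚ.+-0-abelianGroup

-- The quotient group ℤ/mℤ: integers with equality being congruence mod m.
-- The class of an integer n is therefore represented by n itself.
ℤ/_ : ℕ → AbelianGroup 0ℓ 0ℓ
ℤ/ m = record
  { Carrier = ℤ
  ; _≈_     = _≈ₘ_
  ; _∙_     = ℤ._+_
  ; ε       = ℤ.0ℤ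
  ; _⁻¹     = ℤ.-_
  ; isAbelianGroup = record
    { isGroup = record
      { isMonoid = record
        { isSemigroup = record
          { isMagma = record
            { isEquivalence = record
              { refl  = λ {x} → ≡⇒≈ (refl {x = x})
              ; sym   = λ {x} {y} h → subst (+ m ∣_) (ℤ-neg-sub x y) (∣m⇒∣-m h)
              ; trans = λ {x} {y} {z} g h →
                  subst (+ m ∣_) (ℤ-sub-trans x y z) (∣m∣n⇒∣m+n g h)
              }
            ; ∙-cong = λ {x} {y} {u} {v} g h →
                subst (+ m ∣_) (ℤ-sub-add x y u v) (∣m∣n⇒∣m+n g h)
            }
          ; assoc = λ x y z → ≡⇒≈ (ℤₚ.+-assoc x y z)
          }
        ; identity = (λ x → ≡⇒≈ (ℤₚ.+-identityˡ x)) , (λ x → ≡⇒≈ (ℤₚ.+-identityʳ x))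
        }
      ; inverse = (λ x → ≡⇒≈ (ℤₚ.+-inverseˡ x)) , (λ x → ≡⇒≈ (ℤₚ.+-inverseʳ x))
      ; ⁻¹-cong = λ {x} {y} h → subst (+ m ∣_) (ℤ-sub-neg x y) (∣m⇒∣-m h)
      }
    ; comm = λ x y → ≡⇒≈ (ℤₚ.+-comm x y)
    }
  }
  where
  open ℤ∣ using (_∣_; ∣m∣n⇒∣m+n; ∣m⇒∣-m)
  _≈ₘ_ : ℤ → ℤ → Set
  x ≈ₘ y = + m ∣ x ℤ.- y
  ≡⇒≈ : ∀ {x y} → x ≡ y → x ≈ₘ y
  ≡⇒≈ {x} refl = subst (+ m ∣_) (sym (ℤₚ.+-inverseʳ x)) (ℤ∣.divides ℤ.0ℤ refl)
  ℤ-neg-sub : ∀ x y → ℤ.- (x ℤ.- y) ≡ y ℤ.- x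
  ℤ-neg-sub = ℤ-Ring.solve-∀
  ℤ-sub-trans : ∀ x y z → (x ℤ.- y) ℤ.+ (y ℤ.- z) ≡ x ℤ.- z
  ℤ-sub-trans = ℤ-Ring.solve-∀
  ℤ-sub-add : ∀ x y u v → (x ℤ.- y) ℤ.+ (u ℤ.- v) ≡ (x ℤ.+ u) ℤ.- (y ℤ.+ v)
  ℤ-sub-add = ℤ-Ring.solve-∀
  ℤ-sub-neg : ∀ x y → ℤ.- (x ℤ.- y) ≡ ℤ.- x ℤ.- ℤ.- y
  ℤ-sub-neg = ℤ-Ring.solve-∀

-- {0 ≤ n ≤ N : n mod p ∈ R p for every prime p ∈ [y, 2y]}
Sifted : ℕ → ℝ → (ℕ → Pred ℤ 0ℓ) → Pred ℤ 0ℓ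
Sifted N y R n = + 0 ℤ.≤ n × n ℤ.≤ + N ×
  (∀ p → Prime p → y ≤ fromℕ p → fromℕ p ≤ fromℕ 2 * y → R p n)

-- pick P default is used for properties P that determine an object uniquely
-- (up to _≈_): it is that object, or default when there is none.
module Classical (lem : ExcludedMiddle 0ℓ) where

  pick : {X : Set} → (X → Set) → X → X
  pick P default with lem {∃ P}
  ... | yes (x , _) = x
  ... | no  _       = default

  infix 8 _⁻¹
  infixr 9 _^_

  -- Junk value 0 at 0.
  _⁻¹ : ℝ → ℝ
  x ⁻¹ = pick (λ y → x * y ≈ fromℕ 1) (fromℕ 0)

  -- The inverse function of exp; junk value 0 for x ≤ 0.
  log : ℝ → ℝ
  log x = pick (λ l → exp l ≈ x) (fromℕ 0)

  -- Real powers of a base x > 0.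
  _^_ : ℝ → ℝ → ℝ
  x ^ s = exp (s * log x)

  -- The number of elements of a finite subset; junk value 0 for infinite ones.
  card : (G : AbelianGroup 0ℓ 0ℓ) → Pred (AbelianGroup.Carrier G) 0ℓ → ℕ
  card G P = pick (HasSize (AbelianGroup.setoid G) P) 0

-- Write Q = {a + i d} and R p = {r + j δ}, and pass to a window of about y^c terms of Q on which A is
-- still dense, with M points. For p not dividing d these points give pairs (i, j) in a box of area less
-- than about M p, and differences of pairs lie in a lattice of index p; so they are collinear. Hence,
-- if v is the smallest gap between points of A in the window, v = l δ mod p with l small. For a in A and
-- u the distance to one end of this gap, also u = k δ mod p with |k| ≤ p^θ, so p divides l²u² - k²v².
-- If no l²u² - k²v² vanished, their product over all admissible (k, l), of which there are about
-- y^(1-2ε) ≤ y / (16 log N), would be divisible by the primes in (y, 2y] but smaller than the product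
-- of these primes, which Erdős's analysis of the central binomial coefficient bounds below by 2^(y/2).
-- So u / v is a ratio of small integers, and then, for every p, the position of a point of A along R p
-- is an affine function of the point. By convexity the gcd of two differences in A is again such a
-- difference, and the smallest one is the step of A.
module Submission where

open import Algebra.Bundles using (AbelianGroup; CommutativeRing)
import Algebra.Definitions.RawMonoid as RawMonoidDefinitions
import Algebra.Solver.Ring as RingSolver
open import Algebra.Solver.Ring.AlmostCommutativeRing using (_-Raw-AlmostCommutative⟶_; fromCommutativeRing)
open import Axiom.ExcludedMiddle using (ExcludedMiddle)
open import Data.Empty using (⊥; ⊥-elim)
open import Data.Fin as Fin using (Fin)
import Data.Fin.Properties as Finₚ
open import Data.Integer using (ℤ)
import Data.Integer.Divisibility.Signed as ℤ∣
import Data.Integer.Properties as ℤₚ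
import Data.Integer.Tactic.RingSolver as ℤ-Ring
import Data.Maybe as Maybe
open import Data.Nat as ℕ using (ℕ)
open import Data.Nat using (zero; suc)
import Data.Nat.Divisibility as ℕ∣
import Data.Nat.DivMod as DM
open import Data.Nat.GCD using (gcd; gcd[m,n]∣m; gcd[m,n]∣n; module Bézout; gcd-GCD)
open import Data.Nat.Primality using (Prime; euclidsLemma)
import Data.Nat.Properties as ℕₚ
import Data.Nat.Tactic.RingSolver as ℕ-Ring
open import Data.Product using (∃; ∃₂; _×_; _,_; proj₁; proj₂)
open import Data.Rational as ℚ using (ℚ; 0ℚ; 1ℚ; ½)
import Data.Rational.Properties as ℚₚ
open import Data.Sum using (_⊎_; inj₁; inj₂; [_,_]′)
open import Data.Unit using (tt)
open import Defs using (_/1; expTerm; expSum; HasSize; IsArithmeticProgression; ℤ-group; ℤ/_; module Classical;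
  module RationalIdentities; module RationalLemmas; module CauchyLemmas; module ExpLemmas)
open import Function using (_∘_; _⇔_; mk⇔; Equivalence)
open import Level using (0ℓ)
open import Relation.Binary using (Setoid; Preorder; tri<; tri≈; tri>)
open import Relation.Binary.PropositionalEquality
  using (_≡_; _≢_; refl; sym; trans; cong; cong₂; subst; subst₂; module ≡-Reasoning)
import Relation.Binary.Reasoning.Preorder as PreorderReasoning
open import Relation.Nullary using (¬_; Dec; yes; no)
open import Relation.Nullary.Decidable using (decidable-stable; dec⇒maybe; ¬?)
open import Relation.Unary using (Pred; _∩_)
open import Tactic.RingSolver using (solve-∀)

-- Collinearity controls, for each `p`, only the window. A point of `A` outside it satisfies l u = k
-- v mod `p` with coefficients that change with `p`, while u and v may be as large as `N`, far
-- beyond `p`. Multiplying over all pairs (k, l) replaces the search for one pair that serves many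
-- primes. Squares are used so that only |k| and |l| matter, and the primes dividing `d`, about
-- which collinearity says nothing, are paid for by one extra factor |d|. Once u / v is known to be
-- a fraction of small integers, comparing it with the pair of a single `p` involves only numbers
-- below `p`, and the congruence becomes an equation.
--
-- The real hypotheses are condensed into N ^ (192 X²) ≤ 4 ^ (4 m (n + 1)), with n = ⌊y⌋, X = ⌊2
-- y^θ⌋ and m + 1 points in the window; the core is integer arithmetic. For the density exponent δ =
-- (2θ - 1 - c) / 2 + ε this inequality rests on 2δ + c + 1 = 2θ + 2ε and on y^(2ε) ≥ 16 log N. It
-- serves twice: for collinearity, and for the contradiction with the product of primes.

module ClassicalChoice where
  module _ (lem : ExcludedMiddle 0ℓ) where
    ¬∀⇒∃¬ : ∀ {A : Set} {P : A → Set} → ¬ (∀ x → P x) → ∃ λ x → ¬ P x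
    ¬∀⇒∃¬ {A} {P} h with lem {∃ λ x → ¬ P x}
    ... | yes w = w
    ... | no ¬w = ⊥-elim (h λ x → decidable-stable lem λ ¬p → ¬w (x , ¬p))

    least : (P : ℕ → Set) → ∃ P → ∃ λ n → P n × ∀ m → m ℕ.< n → ¬ P m
    least P (n , p) with lem {∃ λ m → m ℕ.< n × P m}
    ... | no none = n , p , λ m m<n q → none (m , m<n , q)
    ... | yes (m , m<n , q) = search n m m<n q
      where
      search : ∀ k m → m ℕ.< k → P m → ∃ λ n → P n × ∀ m → m ℕ.< n → ¬ P m
      search (suc k) m (ℕ.s≤s m≤k) q with lem {∃ λ l → l ℕ.< m × P l}
      ... | no none = m , q , λ l l<m r → none (l , l<m , r)
      ... | yes (l , l<m , r) = search k l (ℕₚ.<-≤-trans l<m m≤k) r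

open ClassicalChoice

-- Lower bound for the product of the primes in (n, 2n], after Erdős

module Chebyshev where
  open import Data.Nat
  open import Data.Nat.Properties
  open import Data.Nat.Divisibility
  open import Data.Nat.Primality
  open import Data.Nat.Induction using (<-rec)
  open import Data.Nat.DivMod using (m≡m%n+[m/n]*n; m%n<n; m/n*n≤m)
  open import Data.Nat.Primality.Factorisation using (factorise; PrimeFactorisation)
  open import Data.List using ([]; _∷_)
  open import Data.List.Relation.Unary.All using (_∷_)

  prime>1 : ∀ {p} → Prime p → 1 < p
  prime>1 {p} pp = nonTrivial⇒n>1 p {{prime⇒nonTrivial pp}}

  prime>0 : ∀ {p} → Prime p → 0 < p
  prime>0 pp = <-trans z<s (prime>1 pp)

  prime-factor : ∀ n → 1 < n → ∃ λ p → Prime p × p ∣ n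
  prime-factor n@(suc _) 1<n with factorise n
  ... | record { factors = [] ; isFactorisation = e } = ⊥-elim (<⇒≢ 1<n (sym e))
  ... | record { factors = p ∷ ps ; isFactorisation = e ; factorsPrime = pp ∷ _ } =
    p , pp , subst (p ∣_) (sym e) (m∣m*n _)

  prime∣prime : ∀ {p q} → Prime p → Prime q → p ∣ q → p ≡ q
  prime∣prime pp pq p∣q with prime⇒irreducible pq p∣q
  ... | inj₁ refl = ⊥-elim (<-irrefl refl (prime>1 pp))
  ... | inj₂ e = e

  prime-power∣*ˡ : ∀ {p} → Prime p → ∀ j a b → ¬ (p ∣ a) → p ^ j ∣ a * b → p ^ j ∣ b
  prime-power∣*ˡ pp zero a b p∤a _ = 1∣ b
  prime-power∣*ˡ {p} pp (suc j) a b p∤a d with euclidsLemma a b pp (∣-trans (m∣m*n (p ^ j)) d)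
  ... | inj₁ p∣a = ⊥-elim (p∤a p∣a)
  ... | inj₂ (divides b′ refl) = subst (p ^ suc j ∣_) (*-comm p b′)
    (*-monoʳ-∣ p (prime-power∣*ˡ pp j a b′ p∤a
      (*-cancelˡ-∣ p {{prime⇒nonZero pp}} (subst (p ^ suc j ∣_) (lem a b′ p) d))))
    where
    lem : ∀ a b p → a * (b * p) ≡ p * (a * b)
    lem = ℕ-Ring.solve-∀

  -- Strong induction on `a`: a prime factor `q` is cancelled from both numbers. The hypothesis
  -- survives, since a power of another prime passes through the factor `q`, and for `q` itself it
  -- is used with the exponent raised by one.
  ∣-by-prime-powers : ∀ a b → 0 < a → 0 < b →
    (∀ q j → Prime q → q ^ suc j ∣ a → q ^ suc j ∣ b) → a ∣ b
  ∣-by-prime-powers = <-rec _ step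
    where
    step : ∀ a → (∀ {a′} → a′ < a → ∀ b → 0 < a′ → 0 < b →
             (∀ q j → Prime q → q ^ suc j ∣ a′ → q ^ suc j ∣ b) → a′ ∣ b) →
           ∀ b → 0 < a → 0 < b →
           (∀ q j → Prime q → q ^ suc j ∣ a → q ^ suc j ∣ b) → a ∣ b
    step zero _ b () _ _
    step (suc zero) _ b _ _ _ = 1∣ b
    step a@(suc (suc _)) rec b 0<a 0<b h
      with q , pq , q∣a ← prime-factor a (s≤s (s≤s z≤n))
      with divides a′ a≡ ← q∣a
      with divides b′ refl ← subst (_∣ b) (*-identityʳ q) (h q 0 pq (subst (_∣ a) (sym (*-identityʳ q)) q∣a)) =
      subst₂ _∣_ (sym a≡) refl (*-monoˡ-∣ q (rec a′<a b′ 0<a′ 0<b′ h′))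
      where
      instance _ = prime⇒nonZero pq
      0<a′ : 0 < a′
      0<a′ = n≢0⇒n>0 λ { refl → <⇒≢ 0<a (sym a≡) }
      0<b′ : 0 < b′
      0<b′ = n≢0⇒n>0 λ { refl → <⇒≢ 0<b refl }
      a′<a : a′ < a
      a′<a = subst (a′ <_) (sym a≡) (m<m*n a′ q {{>-nonZero 0<a′}} (prime>1 pq))
      h′ : ∀ r j → Prime r → r ^ suc j ∣ a′ → r ^ suc j ∣ b′
      h′ r j pr d with r ≟ q
      ... | yes refl = *-cancelˡ-∣ q (subst (q ^ suc (suc j) ∣_) (*-comm b′ q)
              (h q (suc j) pr (subst (q ^ suc (suc j) ∣_) (trans (*-comm q a′) (sym a≡)) (*-monoʳ-∣ q d))))
      ... | no r≢q = prime-power∣*ˡ pr (suc j) q b′ (λ r∣q → r≢q (prime∣prime pr pq r∣q))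
              (subst (r ^ suc j ∣_) (*-comm b′ q)
                (h r j pr (∣-trans d (subst (a′ ∣_) (sym a≡) (m∣m*n q)))))

  -- choose a b is the number of lattice paths from (0,0) to (a,b), the binomial coefficient C(a+b, a).
  choose : ℕ → ℕ → ℕ
  choose zero    b       = 1
  choose (suc a) zero    = 1
  choose (suc a) (suc b) = choose a (suc b) + choose (suc a) b

  fact : ℕ → ℕ
  fact zero = 1
  fact (suc n) = suc n * fact n

  choose-zeroʳ : ∀ a → choose a 0 ≡ 1
  choose-zeroʳ zero = refl
  choose-zeroʳ (suc a) = refl

  choose-fact : ∀ a b → choose a b * (fact a * fact b) ≡ fact (a + b)
  choose-fact zero b = trans (+-identityʳ _) (+-identityʳ _)
  choose-fact (suc a) zero = trans (+-identityʳ _) (trans (*-identityʳ _) (cong fact (sym (+-identityʳ (suc a)))))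
  choose-fact (suc a) (suc b) = begin
    (choose a (suc b) + choose (suc a) b) * (suc a * fact a * (suc b * fact b))
      ≡⟨ lem a b (choose a (suc b)) (choose (suc a) b) (fact a) (fact b) ⟩
    suc a * (choose a (suc b) * (fact a * (suc b * fact b))) +
      suc b * (choose (suc a) b * (suc a * fact a * fact b))
      ≡⟨ cong₂ (λ x y → suc a * x + suc b * y) (choose-fact a (suc b)) (choose-fact (suc a) b) ⟩
    suc a * fact (a + suc b) + suc b * fact (suc a + b)
      ≡⟨ cong (λ x → suc a * fact x + suc b * fact (suc a + b)) (+-suc a b) ⟩
    suc a * fact (suc a + b) + suc b * fact (suc a + b)
      ≡⟨ *-distribʳ-+ (fact (suc a + b)) (suc a) (suc b) ⟨
    (suc a + suc b) * fact (suc a + b)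
      ≡⟨ cong ((suc a + suc b) *_) (cong fact (sym (+-suc a b))) ⟩
    fact (suc a + suc b) ∎
    where
    open ≡-Reasoning
    lem : ∀ a b x y u v → (x + y) * (suc a * u * (suc b * v)) ≡
          suc a * (x * (u * (suc b * v))) + suc b * (y * (suc a * u * v))
    lem = ℕ-Ring.solve-∀

  fact>0 : ∀ n → 0 < fact n
  fact>0 zero = z<s
  fact>0 (suc n) = *-mono-≤ (s≤s (z≤n {n})) (fact>0 n)

  choose>0 : ∀ a b → 0 < choose a b
  choose>0 zero b = z<s
  choose>0 (suc a) zero = z<s
  choose>0 (suc a) (suc b) = ≤-trans (choose>0 a (suc b)) (m≤m+n _ _)

  choose-sym : ∀ a b → choose a b ≡ choose b a
  choose-sym zero b = sym (choose-zeroʳ b)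
  choose-sym (suc a) zero = refl
  choose-sym (suc a) (suc b) = trans (+-comm (choose a (suc b)) _)
    (cong₂ _+_ (choose-sym (suc a) b) (choose-sym a (suc b)))

  choose-absorb : ∀ a b → suc a * choose (suc a) b ≡ (suc a + b) * choose a b
  choose-absorb a b = *-cancelʳ-≡ _ _ (fact a * fact b)
    {{>-nonZero (*-mono-≤ (fact>0 a) (fact>0 b))}} (begin
    suc a * choose (suc a) b * (fact a * fact b)   ≡⟨ lem (suc a) (choose (suc a) b) (fact a) (fact b) ⟩
    choose (suc a) b * (suc a * fact a * fact b)   ≡⟨ choose-fact (suc a) b ⟩
    (suc a + b) * fact (a + b)                     ≡⟨ cong ((suc a + b) *_) (choose-fact a b) ⟨
    (suc a + b) * (choose a b * (fact a * fact b)) ≡⟨ *-assoc (suc a + b) (choose a b) (fact a * fact b) ⟨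
    (suc a + b) * choose a b * (fact a * fact b)   ∎)
    where
    open ≡-Reasoning
    lem : ∀ a c x y → a * c * (x * y) ≡ c * (a * x * y)
    lem = ℕ-Ring.solve-∀

  central : ℕ → ℕ
  central n = choose n n

  central-suc : ∀ n → suc n * central (suc n) ≡ 2 * ((n + suc n) * central n)
  central-suc n = begin
    suc n * (choose n (suc n) + choose (suc n) n)
      ≡⟨ cong (λ x → suc n * (x + choose (suc n) n)) (choose-sym n (suc n)) ⟩
    suc n * (choose (suc n) n + choose (suc n) n)  ≡⟨ lem (suc n) (choose (suc n) n) ⟩
    2 * (suc n * choose (suc n) n)                 ≡⟨ cong (2 *_) (choose-absorb n n) ⟩
    2 * ((suc n + n) * choose n n)                 ≡⟨ cong (λ x → 2 * (x * choose n n)) (+-comm (suc n) n) ⟩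
    2 * ((n + suc n) * choose n n)                 ∎
    where
    open ≡-Reasoning
    lem : ∀ a c → a * (c + c) ≡ 2 * (a * c)
    lem = ℕ-Ring.solve-∀

  -- Induction on the ratio `central-suc`, whose only loss per step is 2n + 2 ≤ 2n + 3.
  central-lower : ∀ n → 4 ^ n ≤ suc (2 * n) * central n
  central-lower zero = ≤-refl
  central-lower (suc n) = begin
    4 * 4 ^ n                              ≤⟨ *-monoʳ-≤ 4 (central-lower n) ⟩
    4 * (suc (2 * n) * central n)          ≡⟨ lem n (central n) ⟩
    2 * (2 * ((n + suc n) * central n))    ≡⟨ cong (2 *_) (central-suc n) ⟨
    2 * (suc n * central (suc n))          ≡⟨ *-assoc 2 (suc n) (central (suc n)) ⟨
    2 * suc n * central (suc n)            ≤⟨ *-monoˡ-≤ (central (suc n)) (n≤1+n (2 * suc n)) ⟩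
    suc (2 * suc n) * central (suc n)      ∎
    where
    open ≤-Reasoning
    lem : ∀ n c → 4 * (suc (2 * n) * c) ≡ 2 * (2 * ((n + suc n) * c))
    lem = ℕ-Ring.solve-∀

  -- The shift by one makes the base case an equality and yields 2 · 4 ^ n in place of 4 · 4 ^ n,
  -- which `choose-odd-upper` halves.
  central-upper : ∀ n → central (suc n) ≤ 2 * 4 ^ n
  central-upper zero = ≤-refl
  central-upper (suc n) = *-cancelˡ-≤ (suc (suc n)) (begin
    suc (suc n) * central (suc (suc n))             ≡⟨ central-suc (suc n) ⟩
    2 * ((suc n + suc (suc n)) * central (suc n))
      ≤⟨ *-monoʳ-≤ 2 (*-mono-≤ (+-monoˡ-≤ (suc (suc n)) (n≤1+n (suc n))) (central-upper n)) ⟩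
    2 * ((suc (suc n) + suc (suc n)) * (2 * 4 ^ n)) ≡⟨ lem (suc (suc n)) (4 ^ n) ⟩
    suc (suc n) * (2 * (4 * 4 ^ n))                 ∎)
    where
    open ≤-Reasoning
    lem : ∀ a x → 2 * ((a + a) * (2 * x)) ≡ a * (2 * (4 * x))
    lem = ℕ-Ring.solve-∀

  choose-odd-upper : ∀ k → choose (suc k) k ≤ 4 ^ k
  choose-odd-upper k = *-cancelˡ-≤ 2 (begin
    2 * choose (suc k) k               ≡⟨ cong (choose (suc k) k +_) (+-identityʳ _) ⟩
    choose (suc k) k + choose (suc k) k ≡⟨ cong (_+ choose (suc k) k) (choose-sym (suc k) k) ⟩
    central (suc k)                    ≤⟨ central-upper k ⟩
    2 * 4 ^ k                          ∎)
    where open ≤-Reasoning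

  prime∤fact : ∀ {p} → Prime p → ∀ a → a < p → ¬ (p ∣ fact a)
  prime∤fact pp zero a<p p∣ = <⇒≢ (prime>1 pp) (sym (∣1⇒≡1 p∣))
  prime∤fact pp (suc a) a<p p∣ with euclidsLemma (suc a) (fact a) pp p∣
  ... | inj₁ d = <⇒≱ a<p (∣⇒≤ d)
  ... | inj₂ d = prime∤fact pp a (<-trans (n<1+n a) a<p) d

  ∣fact : ∀ {p} a → 0 < p → p ≤ a → p ∣ fact a
  ∣fact zero 0<p z≤n = ⊥-elim (<-irrefl refl 0<p)
  ∣fact {p} (suc a) 0<p p≤ with m≤n⇒m<n∨m≡n p≤
  ... | inj₁ p<1+a = ∣n⇒∣m*n (suc a) (∣fact a 0<p (≤-pred p<1+a))
  ... | inj₂ refl = m∣m*n (fact a)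

  prime∣choose : ∀ {p} → Prime p → ∀ a b → a < p → b < p → p ≤ a + b → p ∣ choose a b
  prime∣choose {p} pp a b a<p b<p p≤ with euclidsLemma (choose a b) (fact a * fact b) pp
      (subst (p ∣_) (sym (choose-fact a b)) (∣fact (a + b) (prime>0 pp) p≤))
  ... | inj₁ d = d
  ... | inj₂ d with euclidsLemma (fact a) (fact b) pp d
  ...   | inj₁ e = ⊥-elim (prime∤fact pp a a<p e)
  ...   | inj₂ e = ⊥-elim (prime∤fact pp b b<p e)

  primeOrOne : ℕ → ℕ
  primeOrOne n with prime? n
  ... | yes _ = n
  ... | no  _ = 1

  -- The primes of (k, k + d], multiplied together. The interval is given by its length so that the
  -- recursion removes its right end.
  primeProduct : ℕ → ℕ → ℕ
  primeProduct k zero = 1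
  primeProduct k (suc d) = primeOrOne (k + suc d) * primeProduct k d

  primeOrOne>0 : ∀ n → 0 < primeOrOne n
  primeOrOne>0 n with prime? n
  ... | yes pp = prime>0 pp
  ... | no  _ = z<s

  primeProduct>0 : ∀ k d → 0 < primeProduct k d
  primeProduct>0 k zero = z<s
  primeProduct>0 k (suc d) = *-mono-≤ (primeOrOne>0 (k + suc d)) (primeProduct>0 k d)

  prime∤primeProduct : ∀ {p} → Prime p → ∀ k d → k + d < p → ¬ (p ∣ primeProduct k d)
  prime∤primeProduct pp k zero _ p∣ = <⇒≢ (prime>1 pp) (sym (∣1⇒≡1 p∣))
  prime∤primeProduct {p} pp k (suc d) lt p∣
    with euclidsLemma (primeOrOne (k + suc d)) (primeProduct k d) pp p∣
  ... | inj₂ e = prime∤primeProduct pp k d (<-trans (+-monoʳ-< k (n<1+n d)) lt) e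
  ... | inj₁ e with prime? (k + suc d)
  ...   | yes _ = <⇒≱ lt (∣⇒≤ {{>-nonZero (≤-trans z<s (m≤n+m (suc d) k))}} e)
  ...   | no _ = <⇒≢ (prime>1 pp) (sym (∣1⇒≡1 e))

  prime∣primeProduct : ∀ {p} → Prime p → ∀ k d → k < p → p ≤ k + d → p ∣ primeProduct k d
  prime∣primeProduct {p} pp k zero k<p p≤ = ⊥-elim (<⇒≱ k<p (≤-trans p≤ (≤-reflexive (+-identityʳ k))))
  prime∣primeProduct {p} pp k (suc d) k<p p≤ with p ≟ k + suc d
  ... | no p≢ = ∣n⇒∣m*n (primeOrOne (k + suc d))
         (prime∣primeProduct pp k d k<p (≤-pred (subst (p <_) (+-suc k d) (≤∧≢⇒< p≤ p≢))))
  ... | yes refl with prime? (k + suc d)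
  ...   | yes _ = m∣m*n _
  ...   | no ¬p = ⊥-elim (¬p pp)

  primeProduct-∣ : ∀ k d W → (∀ p → Prime p → k < p → p ≤ k + d → p ∣ W) → primeProduct k d ∣ W
  primeProduct-∣ k zero W h = 1∣ W
  primeProduct-∣ k (suc d) W h
    with divides w refl ← primeProduct-∣ k d W
           (λ p pp k<p p≤ → h p pp k<p (≤-trans p≤ (+-monoʳ-≤ k (n≤1+n d))))
    with prime? (k + suc d)
  ... | no _ = subst (_∣ w * primeProduct k d) (sym (+-identityʳ _)) (n∣m*n w)
  ... | yes pp with euclidsLemma w (primeProduct k d) pp
                     (h (k + suc d) pp (m<m+n k z<s) ≤-refl)
  ...   | inj₁ e = *-monoˡ-∣ (primeProduct k d) e
  ...   | inj₂ e = ⊥-elim (prime∤primeProduct pp k d (+-monoʳ-< k (n<1+n d)) e)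

  primeProduct-+ : ∀ a d → primeProduct 0 (a + d) ≡ primeProduct a d * primeProduct 0 a
  primeProduct-+ a zero = trans (cong (primeProduct 0) (+-identityʳ a)) (sym (+-identityʳ _))
  primeProduct-+ a (suc d) = begin
    primeProduct 0 (a + suc d)                            ≡⟨ cong (primeProduct 0) (+-suc a d) ⟩
    primeOrOne (suc (a + d)) * primeProduct 0 (a + d)
      ≡⟨ cong₂ (λ x y → primeOrOne x * y) (sym (+-suc a d)) (primeProduct-+ a d) ⟩
    primeOrOne (a + suc d) * (primeProduct a d * primeProduct 0 a)
      ≡⟨ *-assoc (primeOrOne (a + suc d)) (primeProduct a d) (primeProduct 0 a) ⟨
    primeOrOne (a + suc d) * primeProduct a d * primeProduct 0 a ∎
    where open ≡-Reasoning

  primorial : ℕ → ℕ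
  primorial = primeProduct 0

  -- Every prime in (a, a + b] exceeds both `a` and `b`, so it divides the binomial coefficient.
  primorial-+≤ : ∀ a b → b ≤ a → primorial (a + b) ≤ choose a b * primorial a
  primorial-+≤ a b b≤a = begin
    primorial (a + b)                 ≡⟨ primeProduct-+ a b ⟩
    primeProduct a b * primorial a
      ≤⟨ *-monoˡ-≤ (primorial a) (∣⇒≤ {{>-nonZero (choose>0 a b)}}
           (primeProduct-∣ a b (choose a b)
             (λ p pp a<p p≤ → prime∣choose pp a b a<p (≤-<-trans b≤a a<p) p≤))) ⟩
    choose a b * primorial a ∎
    where open ≤-Reasoning

  halve : ∀ n → ∃ λ k → n ≡ k + k ⊎ n ≡ suc k + k
  halve zero = 0 , inj₁ refl
  halve (suc n) with halve n
  ... | k , inj₁ refl = k , inj₂ refl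
  ... | k , inj₂ refl = suc k , inj₁ (cong suc (sym (+-suc k k)))

  -- Halving: the primes in the upper half divide a binomial coefficient that is at most 4 to the
  -- length of that half.
  primorial≤4^ : ∀ n → primorial n ≤ 4 ^ n
  primorial≤4^ = <-rec _ step
    where
    open ≤-Reasoning
    step : ∀ n → (∀ {m} → m < n → primorial m ≤ 4 ^ m) → primorial n ≤ 4 ^ n
    step n rec with halve n
    ... | zero , inj₁ refl = ≤-refl
    ... | zero , inj₂ refl = s≤s z≤n
    ... | suc k , inj₁ refl = begin
      primorial (suc k + suc k)          ≤⟨ primorial-+≤ (suc k) (suc k) ≤-refl ⟩
      central (suc k) * primorial (suc k)
        ≤⟨ *-mono-≤ (central-upper k) (rec (m<m+n (suc k) z<s)) ⟩
      2 * 4 ^ k * 4 ^ suc k              ≤⟨ *-monoˡ-≤ (4 ^ suc k) (*-monoˡ-≤ (4 ^ k) {2} {4} (s≤s (s≤s z≤n))) ⟩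
      4 ^ suc k * 4 ^ suc k              ≡⟨ ^-distribˡ-+-* 4 (suc k) (suc k) ⟨
      4 ^ (suc k + suc k)                ∎
    ... | suc k , inj₂ refl = begin
      primorial (suc (suc k) + suc k)    ≤⟨ primorial-+≤ (suc (suc k)) (suc k) (n≤1+n _) ⟩
      choose (suc (suc k)) (suc k) * primorial (suc (suc k))
        ≤⟨ *-mono-≤ (choose-odd-upper (suc k)) (rec (m<m+n (suc (suc k)) z<s)) ⟩
      4 ^ suc k * 4 ^ suc (suc k)        ≡⟨ *-comm (4 ^ suc k) _ ⟩
      4 ^ suc (suc k) * 4 ^ suc k        ≡⟨ ^-distribˡ-+-* 4 (suc (suc k)) (suc k) ⟨
      4 ^ (suc (suc k) + suc k)          ∎

  prime-free-part : ∀ {q} → Prime q → ∀ i → 0 < i → ∃ λ e → ∃ λ m → i ≡ q ^ e * m × ¬ (q ∣ m)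
  prime-free-part {q} pq = <-rec _ step
    where
    step : ∀ i → (∀ {i′} → i′ < i → 0 < i′ → ∃ λ e → ∃ λ m → i′ ≡ q ^ e * m × ¬ (q ∣ m)) →
           0 < i → ∃ λ e → ∃ λ m → i ≡ q ^ e * m × ¬ (q ∣ m)
    step i rec 0<i with q ∣? i
    ... | no q∤i = 0 , i , sym (+-identityʳ i) , q∤i
    ... | yes (divides i′ refl) =
      let e , m , eq , q∤m = rec (m<m*n i′ q {{>-nonZero 0<i′}} (prime>1 pq)) 0<i′
      in suc e , m , trans (cong (_* q) eq) (lem (q ^ e) m q) , q∤m
      where
      0<i′ : 0 < i′
      0<i′ = n≢0⇒n>0 λ { refl → <-irrefl refl 0<i }
      lem : ∀ a m q → a * m * q ≡ q * a * m
      lem = ℕ-Ring.solve-∀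

  -- The exponent of `q` in any i ≤ n is at most `j`, so one factor q ^ j serves for all of them,
  -- and `M` collects the parts prime to `q`.
  common-multiple : ∀ {q} → Prime q → ∀ j n → n < q ^ suc j →
    ∃ λ M → ¬ (q ∣ M) × ∀ i → 0 < i → i ≤ n → i ∣ q ^ j * M
  common-multiple {q} pq j zero _ = 1 , (λ d → <⇒≢ (prime>1 pq) (sym (∣1⇒≡1 d))) ,
    λ i 0<i i≤0 → ⊥-elim (<⇒≱ 0<i i≤0)
  common-multiple {q} pq j (suc n) lt
    with M , q∤M , h ← common-multiple pq j n (<-trans (n<1+n n) lt)
    with e , m , n≡ , q∤m ← prime-free-part pq (suc n) z<s =
    m * M , (λ d → [ q∤m , q∤M ]′ (euclidsLemma m M pq d)) , h′
    where
    instance _ = prime⇒nonZero pq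
    0<m : 0 < m
    0<m = n≢0⇒n>0 λ { refl → q∤m (q ∣0) }
    e≤j : e ≤ j
    e≤j = ≮⇒≥ λ j<e → <⇒≱ lt (begin
      q ^ suc j   ≤⟨ ^-monoʳ-≤ q j<e ⟩
      q ^ e       ≤⟨ m≤m*n (q ^ e) m {{>-nonZero 0<m}} ⟩
      q ^ e * m   ≡⟨ n≡ ⟨
      suc n       ∎)
      where open ≤-Reasoning
    lem : ∀ a m M → m * (a * M) ≡ a * (m * M)
    lem = ℕ-Ring.solve-∀
    pow∣ : q ^ e ∣ q ^ j
    pow∣ = subst (q ^ e ∣_) (trans (sym (^-distribˡ-+-* q e (j ∸ e))) (cong (q ^_) (m+[n∸m]≡n e≤j)))
             (m∣m*n (q ^ (j ∸ e)))
    h′ : ∀ i → 0 < i → i ≤ suc n → i ∣ q ^ j * (m * M)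
    h′ i 0<i i≤ with m≤n⇒m<n∨m≡n i≤
    ... | inj₁ i<1+n = subst (i ∣_) (lem (q ^ j) m M) (∣n⇒∣m*n m (h i 0<i (≤-pred i<1+n)))
    ... | inj₂ refl = subst₂ _∣_ (sym n≡) (*-assoc (q ^ j) m M)
          (∣m⇒∣m*n M (*-monoˡ-∣ m pow∣))

  -- The Leibniz triangle: 1/((n+1)C(n,k+1)) = 1/(nC(n-1,k)) - 1/((n+1)C(n,k)), times D.
  leibniz : ∀ D a b → (∀ i → 0 < i → i ≤ suc (a + b) → i ∣ D) → suc (a + b) * choose a b ∣ D
  leibniz D zero b h = subst (_∣ D) (sym (*-identityʳ (suc b))) (h (suc b) z<s ≤-refl)
  leibniz D (suc a) b h
    with divides x D≡x ← leibniz D a b (λ i 0<i i≤ → h i 0<i (m≤n⇒m≤1+n i≤))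
    with divides y D≡y ← leibniz D a (suc b)
           (λ i 0<i i≤ → h i 0<i (subst (λ z → i ≤ suc z) (+-suc a b) i≤)) =
    divides (x ∸ y) (begin
      D                                   ≡⟨ D≡x ⟩
      x * (suc (a + b) * choose a b)      ≡⟨ cong (x *_) (choose-absorb a b) ⟨
      x * (suc a * choose (suc a) b)      ≡⟨ *-assoc x (suc a) (choose (suc a) b) ⟨
      x * suc a * choose (suc a) b        ≡⟨ cong (λ z → x * z * choose (suc a) b) (m+n∸n≡m (suc a) (suc b)) ⟨
      x * (suc a + suc b ∸ suc b) * choose (suc a) b
        ≡⟨ cong (_* choose (suc a) b) (*-distribˡ-∸ x (suc a + suc b) (suc b)) ⟩
      (x * (suc a + suc b) ∸ x * suc b) * choose (suc a) b
        ≡⟨ cong (λ z → (x * (suc a + suc b) ∸ z) * choose (suc a) b) xb≡ ⟩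
      (x * (suc a + suc b) ∸ y * (suc a + suc b)) * choose (suc a) b
        ≡⟨ cong (_* choose (suc a) b) (*-distribʳ-∸ (suc a + suc b) x y) ⟨
      (x ∸ y) * (suc a + suc b) * choose (suc a) b
        ≡⟨ *-assoc (x ∸ y) (suc a + suc b) (choose (suc a) b) ⟩
      (x ∸ y) * ((suc a + suc b) * choose (suc a) b)
        ≡⟨ cong (λ z → (x ∸ y) * (z * choose (suc a) b)) (+-suc (suc a) b) ⟩
      (x ∸ y) * (suc (suc a + b) * choose (suc a) b) ∎)
    where
    open ≡-Reasoning
    absorb′ : suc b * choose a (suc b) ≡ suc (a + b) * choose a b
    absorb′ = begin
      suc b * choose a (suc b)   ≡⟨ cong (suc b *_) (choose-sym a (suc b)) ⟩
      suc b * choose (suc b) a   ≡⟨ choose-absorb b a ⟩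
      suc (b + a) * choose b a   ≡⟨ cong₂ (λ u v → suc u * v) (+-comm b a) (choose-sym b a) ⟩
      suc (a + b) * choose a b   ∎
    lem : ∀ x b u → x * b * u ≡ b * (x * u)
    lem = ℕ-Ring.solve-∀
    lem₂ : ∀ b y n c → b * (y * (n * c)) ≡ y * n * (b * c)
    lem₂ = ℕ-Ring.solve-∀
    xb≡ : x * suc b ≡ y * (suc a + suc b)
    xb≡ = *-cancelʳ-≡ _ _ (suc (a + b) * choose a b)
      {{>-nonZero (*-mono-≤ (s≤s (z≤n {a + b})) (choose>0 a b))}} (begin
      x * suc b * (suc (a + b) * choose a b)    ≡⟨ lem x (suc b) (suc (a + b) * choose a b) ⟩
      suc b * (x * (suc (a + b) * choose a b))  ≡⟨ cong (suc b *_) (trans (sym D≡x) D≡y) ⟩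
      suc b * (y * (suc (a + suc b) * choose a (suc b)))
        ≡⟨ lem₂ (suc b) y (suc (a + suc b)) (choose a (suc b)) ⟩
      y * suc (a + suc b) * (suc b * choose a (suc b)) ≡⟨ cong (y * suc (a + suc b) *_) absorb′ ⟩
      y * suc (a + suc b) * (suc (a + b) * choose a b) ∎)

  -- Takes the place of Legendre's formula. By `leibniz` the binomial coefficient divides every
  -- common multiple of 1, ..., a + b + 1; were q ^ (j + 1) larger than a + b + 1, `common-multiple`
  -- would give one in which `q` has exponent only `j`.
  prime-power∣choose : ∀ {q} → Prime q → ∀ j a b → q ^ suc j ∣ choose a b → q ^ suc j ≤ suc (a + b)
  prime-power∣choose {q} pq j a b d = ≮⇒≥ λ lt →
    let M , q∤M , h = common-multiple pq j (suc (a + b)) lt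
        d′ = ∣-trans d (∣-trans (n∣m*n (suc (a + b))) (leibniz (q ^ j * M) a b h))
    in q∤M (*-cancelˡ-∣ (q ^ j) {{m^n≢0 q j {{prime⇒nonZero pq}}}}
         (subst (_∣ q ^ j * M) (*-comm q (q ^ j)) d′))

  -- The multiples of `q` among the factors are q, ..., j q, and j < q keeps each of them from
  -- contributing a second `q`.
  fact-prime-part : ∀ {q} → Prime q → ∀ j → j < q → ∀ r → r < q →
    ∃ λ t → ¬ (q ∣ t) × fact (j * q + r) ≡ q ^ j * t
  fact-prime-part {q@(suc q′)} pq (suc j) j<q zero _
    with t , q∤t , eq ← fact-prime-part pq j (<-trans (n<1+n j) j<q) q′ (n<1+n q′) =
    suc j * t
    , (λ d → [ (λ e → <⇒≱ j<q (∣⇒≤ e)) , q∤t ]′ (euclidsLemma (suc j) t pq d))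
    , (begin
      fact (suc j * q + 0)                  ≡⟨ cong fact (shift q′ j) ⟩
      suc (j * q + q′) * fact (j * q + q′)  ≡⟨ cong (suc (j * q + q′) *_) eq ⟩
      suc (j * q + q′) * (q ^ j * t)        ≡⟨ lem q′ j (q ^ j) t ⟩
      q ^ suc j * (suc j * t)               ∎)
    where
    open ≡-Reasoning
    shift : ∀ p j → suc j * suc p + 0 ≡ suc (j * suc p + p)
    shift = ℕ-Ring.solve-∀
    lem : ∀ p j a t → suc (j * suc p + p) * (a * t) ≡ suc p * a * (suc j * t)
    lem = ℕ-Ring.solve-∀
  fact-prime-part pq zero _ zero _ = 1 , (λ d → <⇒≢ (prime>1 pq) (sym (∣1⇒≡1 d))) , refl
  fact-prime-part {q} pq j j<q (suc r) r<q
    with t , q∤t , eq ← fact-prime-part pq j j<q r (<-trans (n<1+n r) r<q) =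
    (j * q + suc r) * t
    , (λ d → [ (λ e → <⇒≱ r<q (∣⇒≤ (∣m+n∣m⇒∣n e (n∣m*n j)))) , q∤t ]′
               (euclidsLemma (j * q + suc r) t pq d))
    , (begin
      fact (j * q + suc r)                     ≡⟨ cong fact (+-suc (j * q) r) ⟩
      suc (j * q + r) * fact (j * q + r)       ≡⟨ cong₂ _*_ (sym (+-suc (j * q) r)) eq ⟩
      (j * q + suc r) * (q ^ j * t)            ≡⟨ lem (j * q + suc r) (q ^ j) t ⟩
      q ^ j * ((j * q + suc r) * t)            ∎)
    where
    open ≡-Reasoning
    lem : ∀ x a t → x * (a * t) ≡ a * (x * t)
    lem = ℕ-Ring.solve-∀

  -- The multiples of `q` up to 2n are q and 2q, so (2n)! contains exactly q ^ 2, which cancels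
  -- against one `q` from each n!. With n = q + r the hypothesis reads 2r < q; and q > 2 keeps 2q
  -- from being divisible by q ^ 2.
  prime∤central : ∀ {q} → Prime q → ∀ n → 2 < q → q ≤ n → 2 * n < 3 * q → ¬ (q ∣ central n)
  prime∤central {q} pq n 2<q q≤n 2n<3q (divides c central≡)
    with r , refl ← m≤n⇒∃[o]m+o≡n q≤n
    with t , q∤t , eq ← fact-prime-part pq 2 2<q (2 * r) (+-cancelˡ-< (2 * q) (2 * r) q
           (subst₂ _<_ (*-distribˡ-+ 2 q r) (+-comm q (2 * q)) 2n<3q))
    with u , q∤u , eq₁ ← fact-prime-part pq 1 (<-trans (n<1+n 1) 2<q) r
           (*-cancelˡ-< 2 r q (≤-<-trans (≤-reflexive refl)
             (<-≤-trans (+-cancelˡ-< (2 * q) (2 * r) q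
           (subst₂ _<_ (*-distribˡ-+ 2 q r) (+-comm q (2 * q)) 2n<3q)) (m≤m+n q (q + 0))))) =
    q∤t (subst (q ∣_) t≡ (m∣m*n _))
    where
    open ≡-Reasoning
    instance _ = prime⇒nonZero pq
    lem : ∀ q c u → q * (q * 1) * (q * (c * (u * u))) ≡ c * q * (q * 1 * u * (q * 1 * u))
    lem = ℕ-Ring.solve-∀
    double : ∀ q r → q + r + (q + r) ≡ 2 * q + 2 * r
    double = ℕ-Ring.solve-∀
    fact≡ : fact (q + r) ≡ q ^ 1 * u
    fact≡ = trans (cong (λ z → fact (z + r)) (sym (+-identityʳ q))) eq₁
    t≡ : q * (c * (u * u)) ≡ t
    t≡ = *-cancelˡ-≡ _ _ (q ^ 2) {{m^n≢0 q 2}} (begin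
      q ^ 2 * (q * (c * (u * u)))            ≡⟨ lem q c u ⟩
      c * q * (q ^ 1 * u * (q ^ 1 * u))      ≡⟨ cong₂ (λ x y → x * (y * y)) central≡ fact≡ ⟨
      central (q + r) * (fact (q + r) * fact (q + r)) ≡⟨ choose-fact (q + r) (q + r) ⟩
      fact (q + r + (q + r))                 ≡⟨ cong fact (double q r) ⟩
      fact (2 * q + 2 * r)                   ≡⟨ eq ⟩
      q ^ 2 * t                              ∎)

  largest-power : ∀ b → 1 < b → ∀ m → 0 < m → ∃ λ e → b ^ e ≤ m × m < b ^ suc e
  largest-power b 1<b (suc zero) _ = 0 , ≤-refl , subst (1 <_) (sym (*-identityʳ b)) 1<b
  largest-power b 1<b (suc m@(suc _)) _ with largest-power b 1<b m z<s
  ... | e , lo , hi with suc m <? b ^ suc e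
  ...   | yes lt = e , m≤n⇒m≤1+n lo , lt
  ...   | no ≮ = suc e , ≮⇒≥ ≮ , ≤-<-trans hi (^-monoʳ-< b 1<b (n<1+n (suc e)))

  -- The product over 2 ≤ q ≤ s of the largest power of `q` not exceeding `m`. Composite `q` are
  -- included; the bound m ^ s allows for one factor per `q`.
  smooth-multiple : ∀ m → 0 < m → ∀ s → ∃ λ S → 0 < S × S ≤ m ^ s ×
    ∀ q j → 1 < q → q ≤ s → q ^ j ≤ m → q ^ j ∣ S
  smooth-multiple m 0<m zero = 1 , z<s , ≤-refl , λ q j 1<q q≤0 → ⊥-elim (<⇒≱ (<-trans z<s 1<q) q≤0)
  smooth-multiple m 0<m (suc zero) = 1 , z<s , subst (0 <_) (sym (*-identityʳ m)) 0<m
    , λ q j 1<q q≤1 → ⊥-elim (<⇒≱ 1<q q≤1)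
  smooth-multiple m 0<m (suc s@(suc s′))
    with S , 0<S , S≤ , h ← smooth-multiple m 0<m s
    with e , lo , hi ← largest-power (suc s) (s≤s z<s) m 0<m =
    suc s ^ e * S , *-mono-≤ (m^n>0 (suc s) e) 0<S , *-mono-≤ lo S≤ , h′
    where
    h′ : ∀ q j → 1 < q → q ≤ suc s → q ^ j ≤ m → q ^ j ∣ suc s ^ e * S
    h′ q j 1<q q≤ q^j≤ with m≤n⇒m<n∨m≡n q≤
    ... | inj₁ lt = ∣n⇒∣m*n (suc s ^ e) (h q j 1<q (≤-pred lt) q^j≤)
    ... | inj₂ refl = ∣m⇒∣m*n S (subst (suc s ^ j ∣_)
            (trans (sym (^-distribˡ-+-* (suc s) j (e ∸ j))) (cong (suc s ^_) (m+[n∸m]≡n j≤e)))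
            (m∣m*n (suc s ^ (e ∸ j))))
      where
      j≤e : j ≤ e
      j≤e = ≮⇒≥ λ e<j → <⇒≱ hi (≤-trans (^-monoʳ-≤ (suc s) e<j) q^j≤)

  sqrt-bracket : ∀ m → ∃ λ s → s * s ≤ m × m < suc s * suc s
  sqrt-bracket zero = 0 , z≤n , z<s
  sqrt-bracket (suc m) with sqrt-bracket m
  ... | s , lo , hi with suc m <? suc s * suc s
  ...   | yes lt = s , m≤n⇒m≤1+n lo , lt
  ...   | no ≮ = suc s , ≮⇒≥ ≮ , ≤-<-trans hi (*-mono-< (n<1+n (suc s)) (n<1+n (suc s)))

  -- Erdős's factorisation. A prime up to `s` enters with a power at most 2n + 1 and is covered by
  -- `S`; a larger one has its square above 2n + 1 and enters once. Of the latter, those up to `m`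
  -- are in the primorial, those in (m, n] are excluded by `prime∤central`, those in (n, 2n] divide
  -- `W`, and beyond 2n none divides (2n)!.
  central-∣ : ∀ n m s S W → 2 ≤ s → suc (n + n) < suc s * suc s → 2 * n < 3 * suc m →
    0 < S → 0 < W →
    (∀ q j → 1 < q → q ≤ s → q ^ j ≤ suc (n + n) → q ^ j ∣ S) →
    (∀ p → Prime p → n < p → p ≤ n + n → p ∣ W) →
    central n ∣ W * (primorial m * S)
  central-∣ n m s S W 2≤s n<s² n<m 0<S 0<W hS hW =
    ∣-by-prime-powers (central n) _ (choose>0 n n)
      (*-mono-≤ 0<W (*-mono-≤ (primeProduct>0 0 m) 0<S)) divides-product
    where
    divides-product : ∀ q j → Prime q → q ^ suc j ∣ central n → q ^ suc j ∣ W * (primorial m * S)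
    divides-product q j pq d with q ≤? s
    ... | yes q≤s = ∣n⇒∣m*n W (∣n⇒∣m*n (primorial m)
            (hS q (suc j) (prime>1 pq) q≤s (prime-power∣choose pq j n n d)))
    divides-product q (suc j) pq d | no q≰s = ⊥-elim (<⇒≱ n<s² (begin
      suc s * suc s           ≤⟨ *-mono-≤ (≰⇒> q≰s) (≰⇒> q≰s) ⟩
      q * q                   ≤⟨ *-monoʳ-≤ q (m≤m*n q (q ^ j) {{m^n≢0 q j}}) ⟩
      q * (q * q ^ j)         ≤⟨ prime-power∣choose pq (suc j) n n d ⟩
      suc (n + n)             ∎))
      where
      open ≤-Reasoning
      instance _ = prime⇒nonZero pq
    divides-product q zero pq d | no q≰s =
      subst (_∣ W * (primorial m * S)) (sym (*-identityʳ q)) (single (subst (_∣ central n) (*-identityʳ q) d))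
      where
      single : q ∣ central n → q ∣ W * (primorial m * S)
      single q∣C with q ≤? m | q ≤? n
      ... | yes q≤m | _ = ∣n⇒∣m*n W (∣m⇒∣m*n S (prime∣primeProduct pq 0 m (prime>0 pq) q≤m))
      ... | no q≰m | yes q≤n = ⊥-elim (prime∤central pq n (≤-<-trans 2≤s (≰⇒> q≰s)) q≤n
              (<-≤-trans n<m (*-monoʳ-≤ 3 (≰⇒> q≰m))) q∣C)
      ... | no _ | no q≰n = ∣m⇒∣m*n (primorial m * S) (hW q pq (≰⇒> q≰n)
              (≮⇒≥ λ n+n<q → prime∤fact pq (n + n) n+n<q
                (subst (q ∣_) (choose-fact n n) (∣m⇒∣m*n _ q∣C))))

  n<2^n : ∀ n → n < 2 ^ n
  n<2^n zero = z<s
  n<2^n (suc n) = begin-strict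
    suc n          ≤⟨ n<2^n n ⟩
    2 ^ n          <⟨ m<m*n (2 ^ n) 2 {{m^n≢0 2 n}} (n<1+n 1) ⟩
    2 ^ n * 2      ≡⟨ *-comm (2 ^ n) 2 ⟩
    2 ^ suc n      ∎
    where open ≤-Reasoning

  -- 504 = 7 · 72. If j ≥ 7 is the quotient of `r` by 72, then r < 72 (j + 1) ≤ 2 ^ 7 · 2 ^ j ≤ 2 ^
  -- (2j), and 36 · 2j = 72 j ≤ r.
  n^36≤2^n : ∀ r → 504 ≤ r → r ^ 36 ≤ 2 ^ r
  n^36≤2^n r 504≤r = begin
    r ^ 36              ≤⟨ ^-monoˡ-≤ 36 r≤ ⟩
    (2 ^ (j + j)) ^ 36  ≡⟨ ^-*-assoc 2 (j + j) 36 ⟩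
    2 ^ ((j + j) * 36)  ≤⟨ ^-monoʳ-≤ 2 (≤-trans (≤-reflexive (lem j)) (m/n*n≤m r 72)) ⟩
    2 ^ r               ∎
    where
    open ≤-Reasoning
    j = r / 72
    lem : ∀ j → (j + j) * 36 ≡ j * 72
    lem = ℕ-Ring.solve-∀
    r<72[1+j] : r < suc j * 72
    r<72[1+j] = begin-strict
      r                   ≡⟨ m≡m%n+[m/n]*n r 72 ⟩
      r % 72 + j * 72     <⟨ +-monoˡ-< (j * 72) (m%n<n r 72) ⟩
      72 + j * 72         ∎
    7≤j : 7 ≤ j
    7≤j = ≤-pred (*-cancelʳ-< 72 7 (suc j) (≤-<-trans 504≤r r<72[1+j]))
    r≤ : r ≤ 2 ^ (j + j)
    r≤ = begin
      r                ≤⟨ <⇒≤ r<72[1+j] ⟩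
      suc j * 72       ≤⟨ *-mono-≤ (n<2^n j) (≤ᵇ⇒≤ 72 (2 ^ 7) tt) ⟩
      2 ^ j * 2 ^ 7    ≤⟨ *-monoʳ-≤ (2 ^ j) (^-monoʳ-≤ 2 7≤j) ⟩
      2 ^ j * 2 ^ j    ≡⟨ ^-distribˡ-+-* 2 j j ⟨
      2 ^ (j + j)      ∎

  ^-distribʳ-* : ∀ n a b → (a * b) ^ n ≡ a ^ n * b ^ n
  ^-distribʳ-* zero a b = refl
  ^-distribʳ-* (suc n) a b = trans (cong (a * b *_) (^-distribʳ-* n a b)) (lem a b (a ^ n) (b ^ n))
    where
    lem : ∀ a b x y → a * b * (x * y) ≡ a * x * (b * y)
    lem = ℕ-Ring.solve-∀

  ^-cancelʳ-≤ : ∀ k .{{_ : NonZero k}} {a b} → a ^ k ≤ b ^ k → a ≤ b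
  ^-cancelʳ-≤ k le = ≮⇒≥ λ b<a → <⇒≱ (^-monoˡ-< k b<a) le

  ^-cancelˡ-≤ : ∀ a → 1 < a → ∀ {m n} → a ^ m ≤ a ^ n → m ≤ n
  ^-cancelˡ-≤ a 1<a le = ≮⇒≥ λ n<m → <⇒≱ (^-monoʳ-< a 1<a n<m) le

  square-bound : ∀ n s → 504 ≤ suc s → s * s ≤ suc (n + n) → suc s * suc s ≤ n * 3
  square-bound n s 504≤r lo = *-cancelˡ-≤ 2 (+-cancelʳ-≤ 3 _ _ (begin
      2 * (suc s * suc s) + 3        ≡⟨ lem₁ s ⟩
      2 * (s * s) + (4 * s + 5)      ≤⟨ +-monoʳ-≤ (2 * (s * s)) 4s+5≤s² ⟩
      2 * (s * s) + s * s            ≡⟨ lem₅ (s * s) ⟩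
      3 * (s * s)                    ≤⟨ *-monoʳ-≤ 3 lo ⟩
      3 * suc (n + n)                ≡⟨ lem₄ n ⟩
      2 * (n * 3) + 3                ∎))
    where
    open ≤-Reasoning
    5≤s : 5 ≤ s
    5≤s = ≤-trans (≤ᵇ⇒≤ 5 503 tt) (≤-pred 504≤r)
    lem₁ : ∀ s → 2 * (suc s * suc s) + 3 ≡ 2 * (s * s) + (4 * s + 5)
    lem₁ = ℕ-Ring.solve-∀
    lem₄ : ∀ n → 3 * suc (n + n) ≡ 2 * (n * 3) + 3
    lem₄ = ℕ-Ring.solve-∀
    lem₅ : ∀ x → 2 * x + x ≡ 3 * x
    lem₅ = ℕ-Ring.solve-∀
    4s+5≤s² : 4 * s + 5 ≤ s * s
    4s+5≤s² = begin
      4 * s + 5  ≤⟨ +-monoʳ-≤ (4 * s) 5≤s ⟩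
      4 * s + s  ≡⟨ +-comm (4 * s) s ⟩
      5 * s      ≤⟨ *-monoˡ-≤ s 5≤s ⟩
      s * s      ∎

  -- Bounds the contribution of the small primes. Its cube is at most (r²) ^ (18 r) = (r ^ 36) ^ r ≤
  -- 2 ^ (r²), which is the origin of the exponent 36.
  error-small : ∀ n r V → r ^ 36 ≤ 2 ^ r → r * r ≤ n * 3 → V ≤ r * r → V ^ (6 * r) ≤ 2 ^ n
  error-small n r V h r²≤3n V≤ = ^-cancelʳ-≤ 3 (begin
    (V ^ (6 * r)) ^ 3           ≤⟨ ^-monoˡ-≤ 3 (^-monoˡ-≤ (6 * r) V≤) ⟩
    ((r * r) ^ (6 * r)) ^ 3     ≡⟨ ^-*-assoc (r * r) (6 * r) 3 ⟩
    (r * r) ^ (6 * r * 3)       ≡⟨ ^-distribʳ-* (6 * r * 3) r r ⟩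
    r ^ (6 * r * 3) * r ^ (6 * r * 3) ≡⟨ ^-distribˡ-+-* r (6 * r * 3) (6 * r * 3) ⟨
    r ^ (6 * r * 3 + 6 * r * 3) ≡⟨ cong (r ^_) (exponent r) ⟩
    r ^ (36 * r)                ≡⟨ ^-*-assoc r 36 r ⟨
    (r ^ 36) ^ r                ≤⟨ ^-monoˡ-≤ r h ⟩
    (2 ^ r) ^ r                 ≡⟨ ^-*-assoc 2 r r ⟩
    2 ^ (r * r)                 ≤⟨ ^-monoʳ-≤ 2 r²≤3n ⟩
    2 ^ (n * 3)                 ≡⟨ ^-*-assoc 2 n 3 ⟨
    (2 ^ n) ^ 3                 ∎)
    where
    open ≤-Reasoning
    exponent : ∀ r → 6 * r * 3 + 6 * r * 3 ≡ 36 * r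
    exponent = ℕ-Ring.solve-∀

  -- Sixth powers clear the thirds and halves: 4 ^ n ≤ V ^ r · W · 4 ^ m with m = ⌊2n / 3⌋ becomes 2
  -- ^ (12 n) ≤ 2 ^ n · W ^ 6 · 2 ^ (8 n). `W` is an arbitrary common multiple of the primes,
  -- because later it arises as a product of integers of another kind.
  primes-in-dyadic-interval : ∀ n → 504 * 504 ≤ n → ∀ W → 0 < W →
    (∀ p → Prime p → n < p → p ≤ n + n → p ∣ W) → 2 ^ n ≤ W ^ 2
  primes-in-dyadic-interval n n₀≤n W 0<W hW
    with s , lo , hi ← sqrt-bracket (suc (n + n))
    with S , 0<S , S≤ , hS ← smooth-multiple (suc (n + n)) z<s s =
    ^-cancelʳ-≤ 3 (begin
      (2 ^ n) ^ 3          ≡⟨ ^-*-assoc 2 n 3 ⟩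
      2 ^ (n * 3)          ≤⟨ *-cancelˡ-≤ (2 ^ (9 * n)) {{m^n≢0 2 (9 * n)}} (begin
        2 ^ (9 * n) * 2 ^ (n * 3)        ≡⟨ ^-distribˡ-+-* 2 (9 * n) (n * 3) ⟨
        2 ^ (9 * n + n * 3)              ≡⟨ cong (2 ^_) (exponent₁ n) ⟩
        2 ^ (2 * (n * 6))                ≡⟨ ^-*-assoc 2 2 (n * 6) ⟨
        4 ^ (n * 6)                      ≡⟨ ^-*-assoc 4 n 6 ⟨
        (4 ^ n) ^ 6                      ≤⟨ ^-monoˡ-≤ 6 4^n≤ ⟩
        (V ^ r * (W * 4 ^ m)) ^ 6        ≡⟨ ^-distribʳ-* 6 (V ^ r) (W * 4 ^ m) ⟩
        (V ^ r) ^ 6 * (W * 4 ^ m) ^ 6    ≡⟨ cong₂ _*_ (trans (^-*-assoc V r 6) (cong (V ^_) (*-comm r 6)))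
                                                     (^-distribʳ-* 6 W (4 ^ m)) ⟩
        V ^ (6 * r) * (W ^ 6 * (4 ^ m) ^ 6) ≤⟨ *-mono-≤ (error-small n r V (n^36≤2^n r 504≤r) (square-bound n s 504≤r lo) (<⇒≤ hi))
                                                  (*-monoʳ-≤ (W ^ 6) 4^m^6≤) ⟩
        2 ^ n * (W ^ 6 * 2 ^ (8 * n))    ≡⟨ rearrange (2 ^ n) (W ^ 6) (2 ^ (8 * n)) ⟩
        2 ^ n * 2 ^ (8 * n) * W ^ 6      ≡⟨ cong (_* W ^ 6) (^-distribˡ-+-* 2 n (8 * n)) ⟨
        2 ^ (9 * n) * W ^ 6              ∎) ⟩
      W ^ 6                ≡⟨ ^-*-assoc W 2 3 ⟨
      (W ^ 2) ^ 3          ∎)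
    where
    open ≤-Reasoning
    r = suc s
    V = suc (n + n)
    m = (2 * n) / 3
    exponent₁ : ∀ n → 9 * n + n * 3 ≡ 2 * (n * 6)
    exponent₁ = ℕ-Ring.solve-∀
    rearrange : ∀ a b c → a * (b * c) ≡ a * c * b
    rearrange = ℕ-Ring.solve-∀
    504≤r : 504 ≤ r
    504≤r = ≮⇒≥ λ r<504 → <⇒≱ hi (begin
      r * r         ≤⟨ *-mono-≤ (<⇒≤ r<504) (<⇒≤ r<504) ⟩
      504 * 504     ≤⟨ n₀≤n ⟩
      n             ≤⟨ m≤m+n n n ⟩
      n + n         ≤⟨ n≤1+n (n + n) ⟩
      V             ∎)
    2n<3[1+m] : 2 * n < 3 * suc m
    2n<3[1+m] = begin-strict
      2 * n                       ≡⟨ m≡m%n+[m/n]*n (2 * n) 3 ⟩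
      (2 * n) % 3 + m * 3         <⟨ +-monoˡ-< (m * 3) (m%n<n (2 * n) 3) ⟩
      suc m * 3                   ≡⟨ *-comm (suc m) 3 ⟩
      3 * suc m                   ∎
    4^m^6≤ : (4 ^ m) ^ 6 ≤ 2 ^ (8 * n)
    4^m^6≤ = begin
      (4 ^ m) ^ 6              ≡⟨ ^-*-assoc 4 m 6 ⟩
      4 ^ (m * 6)              ≡⟨ ^-*-assoc 2 2 (m * 6) ⟩
      2 ^ (2 * (m * 6))        ≡⟨ cong (2 ^_) (exponent₂ m) ⟩
      2 ^ (4 * (m * 3))        ≤⟨ ^-monoʳ-≤ 2 (*-monoʳ-≤ 4 (m/n*n≤m (2 * n) 3)) ⟩
      2 ^ (4 * (2 * n))        ≡⟨ cong (2 ^_) (exponent₃ n) ⟩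
      2 ^ (8 * n)              ∎
      where
      exponent₂ : ∀ m → 2 * (m * 6) ≡ 4 * (m * 3)
      exponent₂ = ℕ-Ring.solve-∀
      exponent₃ : ∀ n → 4 * (2 * n) ≡ 8 * n
      exponent₃ = ℕ-Ring.solve-∀
    2≤s : 2 ≤ s
    2≤s = ≤-trans (≤ᵇ⇒≤ 2 503 tt) (≤-pred 504≤r)
    4^n≤ : 4 ^ n ≤ V ^ r * (W * 4 ^ m)
    4^n≤ = begin
      4 ^ n                                  ≤⟨ central-lower n ⟩
      suc (2 * n) * central n                ≡⟨ cong (λ z → suc (n + z) * central n) (+-identityʳ n) ⟩
      V * central n                          ≤⟨ *-monoʳ-≤ V (∣⇒≤ {{>-nonZero
        (*-mono-≤ 0<W (*-mono-≤ (primeProduct>0 0 m) 0<S))}}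
        (central-∣ n m s S W 2≤s hi 2n<3[1+m] 0<S 0<W hS hW)) ⟩
      V * (W * (primorial m * S))            ≤⟨ *-monoʳ-≤ V (*-monoʳ-≤ W (*-mono-≤ (primorial≤4^ m) S≤)) ⟩
      V * (W * (4 ^ m * V ^ s))              ≡⟨ rearrange′ V W (4 ^ m) (V ^ s) ⟩
      V * V ^ s * (W * 4 ^ m)                ∎
      where
      rearrange′ : ∀ v w a b → v * (w * (a * b)) ≡ v * b * (w * a)
      rearrange′ = ℕ-Ring.solve-∀

open import Data.Integer as ℤ using (+_; -[1+_])

-- Divisibility and absolute values of integers

module IntegerLemmas where
  open import Data.Integer using (_+_; _-_; _*_; -_; ∣_∣; _≤_; +≤+)
  open ℤ∣ using (_∣_; ∣⇒∣ᵤ; ∣ᵤ⇒∣)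

  prime∣*ℤ : ∀ {p} → Prime p → ∀ i j → + p ∣ i * j → (+ p ∣ i) ⊎ (+ p ∣ j)
  prime∣*ℤ {p} pp i j d with euclidsLemma ∣ i ∣ ∣ j ∣ pp (subst (p ℕ∣.∣_) (ℤₚ.abs-* i j) (∣⇒∣ᵤ d))
  ... | inj₁ e = inj₁ (∣ᵤ⇒∣ e)
  ... | inj₂ e = inj₂ (∣ᵤ⇒∣ e)

  ∣∧<⇒≡0 : ∀ {p} i → + p ∣ i → ∣ i ∣ ℕ.< p → i ≡ + 0
  ∣∧<⇒≡0 {p} i d lt with ∣ i ∣ in eq | ∣⇒∣ᵤ d
  ... | zero | _ = ℤₚ.∣i∣≡0⇒i≡0 eq
  ... | suc n | e = ⊥-elim (ℕₚ.<⇒≱ lt (ℕ∣.∣⇒≤ e))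

  ∣+-+∣≤ : ∀ {a b c} → a ℕ.≤ c → b ℕ.≤ c → ∣ + a - + b ∣ ℕ.≤ c
  ∣+-+∣≤ {a} {b} {c} a≤c b≤c = subst (λ z → ∣ z ∣ ℕ.≤ c) (sym (ℤₚ.m-n≡m⊖n a b))
    (ℕₚ.≤-trans (ℤₚ.∣m⊝n∣≤m⊔n a b) (ℕₚ.⊔-lub a≤c b≤c))

  same-quotient : ∀ a b d .{{_ : ℕ.NonZero d}} → a ℕ./ d ≡ b ℕ./ d → ∣ + a - + b ∣ ℕ.< d
  same-quotient a b d eq = begin-strict
    ∣ + a - + b ∣
      ≡⟨ cong₂ (λ x y → ∣ + x - + y ∣) (DM.m≡m%n+[m/n]*n a d)
           (trans (DM.m≡m%n+[m/n]*n b d) (cong (λ q → b ℕ.% d ℕ.+ q ℕ.* d) (sym eq))) ⟩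
    ∣ + (a ℕ.% d ℕ.+ q ℕ.* d) - + (b ℕ.% d ℕ.+ q ℕ.* d) ∣
      ≡⟨ cong ∣_∣ (cancel (+ (a ℕ.% d)) (+ (b ℕ.% d)) (+ (q ℕ.* d))) ⟩
    ∣ + (a ℕ.% d) - + (b ℕ.% d) ∣
      <⟨ bound (DM.m%n<n a d) (DM.m%n<n b d) ⟩
    d ∎
    where
    open ℕₚ.≤-Reasoning
    q = a ℕ./ d
    cancel : ∀ x y z → (x + z) - (y + z) ≡ x - y
    cancel = ℤ-Ring.solve-∀
    bound : ∀ {x y d} → x ℕ.< d → y ℕ.< d → ∣ + x - + y ∣ ℕ.< d
    bound {d = suc d} (ℕ.s≤s x≤) (ℕ.s≤s y≤) = ℕ.s≤s (∣+-+∣≤ x≤ y≤)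

  ∣i*j-k*l∣≤ : ∀ i j k l → ∣ i * j - k * l ∣ ℕ.≤ ∣ i ∣ ℕ.* ∣ j ∣ ℕ.+ ∣ k ∣ ℕ.* ∣ l ∣
  ∣i*j-k*l∣≤ i j k l = subst₂ (λ a b → ∣ i * j - k * l ∣ ℕ.≤ a ℕ.+ b) (ℤₚ.abs-* i j) (ℤₚ.abs-* k l)
    (ℤₚ.∣i-j∣≤∣i∣+∣j∣ (i * j) (k * l))

-- Points of a box whose differences lie in a lattice of index p

module Collinearity (lem : ExcludedMiddle 0ℓ) where
  open import Data.Integer using (_+_; _-_; _*_; -_; ∣_∣; _≤_; +≤+)
  open ℤ∣ using (_∣_)
  open IntegerLemmas

  det : ∀ {M} → (x k : Fin M → ℕ) → ℤ → ℤ → Fin M → Fin M → ℤ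
  det x k γ l u v = γ * (+ k u - + k v) - l * (+ x u - + x v)

  -- The maximum norm of the difference after the L by K box is stretched to a square of side L K.
  size : ∀ {M} → (x k : Fin M → ℕ) → ℕ → ℕ → Fin M → Fin M → ℕ
  size x k L K u v = ∣ + x u - + x v ∣ ℕ.* K ℕ.⊔ ∣ + k u - + k v ∣ ℕ.* L

  -- Here (γ, l) is a shortest difference of two points (x, k), of length ν = |γ| K. The points lie on
  -- parallel lines in direction (γ, l): the determinant, a multiple of p, bounds the number of lines,
  -- and ν bounds the number of points on each of them.
  few-points : ∀ m (x k : Fin (suc m) → ℕ) L K p γ l →
    (∀ u → x u ℕ.≤ L) → (∀ u → k u ℕ.≤ K) → 0 ℕ.< p →
    ∣ l ∣ ℕ.* L ℕ.≤ ∣ γ ∣ ℕ.* K → ∣ γ ∣ ℕ.≤ L → p ℕ.≤ 2 ℕ.* (∣ γ ∣ ℕ.* K) →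
    (∀ u v → u ≢ v → ∣ γ ∣ ℕ.* K ℕ.≤ size x k L K u v) →
    (∀ u v → + p ∣ det x k γ l u v) →
    m ℕ.* p ℕ.≤ 10 ℕ.* (L ℕ.* K)
  few-points m x k L K p@(suc _) γ l x≤ k≤ _ lL≤ν γ≤L p≤2ν minimal congruent =
    arithmetic (ℕₚ.≮⇒≥ λ lt → collision (Finₚ.pigeonhole lt bucket))
    where
    Γ = ∣ γ ∣
    ν = Γ ℕ.* K
    c = ν ℕ.+ ∣ l ∣ ℕ.* L
    0<ν : 0 ℕ.< ν
    0<ν = ℕₚ.n≢0⇒n>0 λ ν≡0 → ℕₚ.<⇒≱ (ℕ.s≤s ℕ.z≤n) (subst (λ z → p ℕ.≤ 2 ℕ.* z) ν≡0 p≤2ν)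
    instance
      Γ≢0 : ℕ.NonZero Γ
      Γ≢0 = ℕₚ.m*n≢0⇒m≢0 Γ {{ℕ.>-nonZero 0<ν}}
      K≢0 : ℕ.NonZero K
      K≢0 = ℕₚ.m*n≢0⇒n≢0 Γ {{ℕ.>-nonZero 0<ν}}
    h : Fin (suc m) → ℤ
    h u = γ * + k u - l * + x u
    ∣h∣≤c : ∀ u → ∣ h u ∣ ℕ.≤ c
    ∣h∣≤c u = ℕₚ.≤-trans (∣i*j-k*l∣≤ γ (+ k u) l (+ x u))
      (ℕₚ.+-mono-≤ (ℕₚ.*-monoʳ-≤ Γ (k≤ u)) (ℕₚ.*-monoʳ-≤ ∣ l ∣ (x≤ u)))
    0≤shifted : ∀ i {n} → ∣ i ∣ ℕ.≤ n → + 0 ≤ i + + n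
    0≤shifted (+ a) _ = +≤+ ℕ.z≤n
    0≤shifted -[1+ a ] {n} le = subst (+ 0 ≤_) (sym (ℤₚ.⊖-≥ le)) (+≤+ ℕ.z≤n)
    H : Fin (suc m) → ℕ
    H u = ∣ h u + + c ∣
    +H≡ : ∀ u → + H u ≡ h u + + c
    +H≡ u = ℤₚ.0≤i⇒+∣i∣≡i (0≤shifted (h u) (∣h∣≤c u))
    H≤2c : ∀ u → H u ℕ.≤ c ℕ.+ c
    H≤2c u = ℕₚ.≤-trans (ℤₚ.∣i+j∣≤∣i∣+∣j∣ (h u) (+ c)) (ℕₚ.+-monoˡ-≤ c (∣h∣≤c u))
    a b : ℕ
    a = (c ℕ.+ c) ℕ./ p
    b = L ℕ./ Γ
    f : Fin (suc m) → Fin (suc a)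
    f u = Fin.fromℕ< {H u ℕ./ p} (ℕ.s≤s (DM./-monoˡ-≤ p (H≤2c u)))
    g : Fin (suc m) → Fin (suc b)
    g u = Fin.fromℕ< {x u ℕ./ Γ} (ℕ.s≤s (DM./-monoˡ-≤ Γ (x≤ u)))
    -- Two points in one bucket have a determinant that is a multiple of `p` below `p`, hence 0, and
    -- abscissas closer than `Γ`. Their difference is then parallel to (γ, l) but shorter.
    bucket : Fin (suc m) → Fin (suc a ℕ.* suc b)
    bucket u = Fin.combine (f u) (g u)
    fromℕ<-≡ : ∀ {i j n} (p : i ℕ.< n) (q : j ℕ.< n) → Fin.fromℕ< p ≡ Fin.fromℕ< q → i ≡ j
    fromℕ<-≡ p q eq = trans (sym (Finₚ.toℕ-fromℕ< p)) (trans (cong Fin.toℕ eq) (Finₚ.toℕ-fromℕ< q))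

    collision : ¬ (∃₂ λ u v → u Fin.< v × bucket u ≡ bucket v)
    collision (u , v , u<v , eq) = ℕₚ.<⇒≱ (ℕₚ.⊔-lub small₁ small₂) (minimal u v u≢v)
      where
      open ℕₚ.≤-Reasoning
      u≢v : u ≢ v
      u≢v refl = ℕₚ.<-irrefl refl u<v
      eqs = Finₚ.combine-injective (f u) (g u) (f v) (g v) eq
      Δx Δk : ℤ
      Δx = + x u - + x v
      Δk = + k u - + k v
      Δx<Γ : ∣ Δx ∣ ℕ.< Γ
      Δx<Γ = same-quotient (x u) (x v) Γ (fromℕ<-≡ {x u ℕ./ Γ} {x v ℕ./ Γ} (ℕ.s≤s (DM./-monoˡ-≤ Γ (x≤ u))) (ℕ.s≤s (DM./-monoˡ-≤ Γ (x≤ v))) (proj₂ eqs))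
      expand : ∀ γ l ku kv xu xv c → (γ * ku - l * xu + c) - (γ * kv - l * xv + c) ≡ γ * (ku - kv) - l * (xu - xv)
      expand = ℤ-Ring.solve-∀
      det≡ : + H u - + H v ≡ det x k γ l u v
      det≡ = trans (cong₂ _-_ (+H≡ u) (+H≡ v)) (expand γ l (+ k u) (+ k v) (+ x u) (+ x v) (+ c))
      det≡0 : det x k γ l u v ≡ + 0
      det≡0 = ∣∧<⇒≡0 _ (congruent u v) (subst (λ z → ∣ z ∣ ℕ.< p) det≡
        (same-quotient (H u) (H v) p (fromℕ<-≡ {H u ℕ./ p} {H v ℕ./ p} (ℕ.s≤s (DM./-monoˡ-≤ p (H≤2c u))) (ℕ.s≤s (DM./-monoˡ-≤ p (H≤2c v))) (proj₁ eqs))))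
      Γ∣Δk∣≡ : Γ ℕ.* ∣ Δk ∣ ≡ ∣ l ∣ ℕ.* ∣ Δx ∣
      Γ∣Δk∣≡ = trans (sym (ℤₚ.abs-* γ Δk)) (trans (cong ∣_∣ (ℤₚ.i-j≡0⇒i≡j (γ * Δk) (l * Δx) det≡0)) (ℤₚ.abs-* l Δx))
      small₁ : ∣ Δx ∣ ℕ.* K ℕ.< ν
      small₁ = ℕₚ.*-monoˡ-< K Δx<Γ
      rearrange₁ : ∀ a b c → a ℕ.* (b ℕ.* c) ≡ a ℕ.* b ℕ.* c
      rearrange₁ = ℕ-Ring.solve-∀
      rearrange₂ : ∀ a b c → a ℕ.* b ℕ.* c ≡ a ℕ.* c ℕ.* b
      rearrange₂ = ℕ-Ring.solve-∀
      small₂ : ∣ Δk ∣ ℕ.* L ℕ.< ν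
      small₂ = ℕₚ.≤-<-trans (ℕₚ.*-cancelˡ-≤ Γ (begin
        Γ ℕ.* (∣ Δk ∣ ℕ.* L)       ≡⟨ rearrange₁ Γ ∣ Δk ∣ L ⟩
        Γ ℕ.* ∣ Δk ∣ ℕ.* L         ≡⟨ cong (ℕ._* L) Γ∣Δk∣≡ ⟩
        ∣ l ∣ ℕ.* ∣ Δx ∣ ℕ.* L     ≡⟨ rearrange₂ ∣ l ∣ ∣ Δx ∣ L ⟩
        ∣ l ∣ ℕ.* L ℕ.* ∣ Δx ∣     ≤⟨ ℕₚ.*-monoˡ-≤ ∣ Δx ∣ lL≤ν ⟩
        Γ ℕ.* K ℕ.* ∣ Δx ∣         ≡⟨ rearrange₂ Γ K ∣ Δx ∣ ⟩
        Γ ℕ.* ∣ Δx ∣ ℕ.* K         ≡⟨ rearrange₁ Γ ∣ Δx ∣ K ⟨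
        Γ ℕ.* (∣ Δx ∣ ℕ.* K)       ∎)) small₁

    -- Origin of the 10: with a p ≤ 2c ≤ 4ν, p ≤ 2ν and b ν ≤ L K, the number (a + 1)(b + 1) of
    -- buckets gives m p ≤ 6 b ν + 4 ν.
    arithmetic : suc m ℕ.≤ suc a ℕ.* suc b → m ℕ.* p ℕ.≤ 10 ℕ.* (L ℕ.* K)
    arithmetic M≤ = begin
      m ℕ.* p                               ≤⟨ ℕₚ.*-monoˡ-≤ p (ℕ.s≤s⁻¹ M≤) ⟩
      (b ℕ.+ a ℕ.* suc b) ℕ.* p             ≡⟨ expand a b p ⟩
      a ℕ.* p ℕ.* b ℕ.+ a ℕ.* p ℕ.+ b ℕ.* p
        ≤⟨ ℕₚ.+-mono-≤ (ℕₚ.+-mono-≤ (ℕₚ.*-monoˡ-≤ b ap≤4ν) ap≤4ν) (ℕₚ.*-monoʳ-≤ b p≤2ν) ⟩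
      4 ℕ.* ν ℕ.* b ℕ.+ 4 ℕ.* ν ℕ.+ b ℕ.* (2 ℕ.* ν)  ≡⟨ collect ν b ⟩
      6 ℕ.* (b ℕ.* ν) ℕ.+ 4 ℕ.* ν           ≤⟨ ℕₚ.+-mono-≤ (ℕₚ.*-monoʳ-≤ 6 bν≤LK) (ℕₚ.*-monoʳ-≤ 4 (ℕₚ.*-monoˡ-≤ K γ≤L)) ⟩
      6 ℕ.* (L ℕ.* K) ℕ.+ 4 ℕ.* (L ℕ.* K)   ≡⟨ ℕₚ.*-distribʳ-+ (L ℕ.* K) 6 4 ⟨
      10 ℕ.* (L ℕ.* K)                      ∎
      where
      open ℕₚ.≤-Reasoning
      expand : ∀ a b p → (b ℕ.+ a ℕ.* suc b) ℕ.* p ≡ a ℕ.* p ℕ.* b ℕ.+ a ℕ.* p ℕ.+ b ℕ.* p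
      expand = ℕ-Ring.solve-∀
      collect : ∀ n b → 4 ℕ.* n ℕ.* b ℕ.+ 4 ℕ.* n ℕ.+ b ℕ.* (2 ℕ.* n) ≡ 6 ℕ.* (b ℕ.* n) ℕ.+ 4 ℕ.* n
      collect = ℕ-Ring.solve-∀
      double : ∀ n → n ℕ.+ n ℕ.+ (n ℕ.+ n) ≡ 4 ℕ.* n
      double = ℕ-Ring.solve-∀
      assoc : ∀ a b c → a ℕ.* (b ℕ.* c) ≡ a ℕ.* b ℕ.* c
      assoc = ℕ-Ring.solve-∀
      ap≤4ν : a ℕ.* p ℕ.≤ 4 ℕ.* ν
      ap≤4ν = begin
        a ℕ.* p                    ≤⟨ DM.m/n*n≤m (c ℕ.+ c) p ⟩
        c ℕ.+ c                    ≤⟨ ℕₚ.+-mono-≤ (ℕₚ.+-monoʳ-≤ ν lL≤ν) (ℕₚ.+-monoʳ-≤ ν lL≤ν) ⟩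
        ν ℕ.+ ν ℕ.+ (ν ℕ.+ ν)      ≡⟨ double ν ⟩
        4 ℕ.* ν                    ∎
      bν≤LK : b ℕ.* ν ℕ.≤ L ℕ.* K
      bν≤LK = begin
        b ℕ.* (Γ ℕ.* K)   ≡⟨ assoc b Γ K ⟩
        b ℕ.* Γ ℕ.* K     ≤⟨ ℕₚ.*-monoˡ-≤ K (DM.m/n*n≤m L Γ) ⟩
        L ℕ.* K           ∎

  -- Let ν be the length of a shortest difference. If p ≤ 2ν, then `few-points` contradicts 10 L K <
  -- m p. If 2ν < p, every determinant with this difference has absolute value at most 2ν, so its
  -- divisibility by `p` forces it to vanish.
  collinear : ∀ m (x k : Fin (suc m) → ℕ) L K p → 0 ℕ.< p → 1 ℕ.≤ m →
    (∀ u v → x u ≡ x v → u ≡ v) → (∀ u → x u ℕ.≤ L) → (∀ u → k u ℕ.≤ K) →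
    10 ℕ.* (L ℕ.* K) ℕ.< m ℕ.* p →
    (∀ s t u v → + p ∣ det x k (+ x s - + x t) (+ k s - + k t) u v) →
    ∃₂ λ γ l → γ ≢ + 0 × ∀ u v → γ * (+ k u - + k v) ≡ l * (+ x u - + x v)
  collinear m@(suc m′) x k L K p 0<p _ x-inj x≤ k≤ large congruent
    with _ , (s , t , s≢t , refl) , minimal ← least lem
           (λ n → ∃₂ λ s t → s ≢ t × size x k L K s t ≡ n) (_ , Fin.zero , Fin.suc Fin.zero , (λ ()) , refl) =
    γ , l , (λ γ≡0 → s≢t (x-inj s t (ℤₚ.+-injective (ℤₚ.i-j≡0⇒i≡j (+ x s) (+ x t) γ≡0)))) ,
    λ u v → ℤₚ.i-j≡0⇒i≡j (γ * (+ k u - + k v)) (l * (+ x u - + x v)) (∣∧<⇒≡0 _ (congruent s t u v) (det< u v))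
    where
    γ l : ℤ
    γ = + x s - + x t
    l = + k s - + k t
    νx νk ν : ℕ
    νx = ∣ γ ∣ ℕ.* K
    νk = ∣ l ∣ ℕ.* L
    ν = νx ℕ.⊔ νk
    shortest : ∀ u v → u ≢ v → ν ℕ.≤ size x k L K u v
    shortest u v u≢v = ℕₚ.≮⇒≥ λ lt → minimal _ lt (u , v , u≢v , refl)
    2ν<p : ℕ.suc (2 ℕ.* ν) ℕ.≤ p
    2ν<p = ℕₚ.≰⇒> λ p≤2ν → ℕₚ.<⇒≱ large (case p≤2ν)
      where
      swap-det : ∀ γ l a b → ℤ.- (γ * a - l * b) ≡ l * b - γ * a
      swap-det = ℤ-Ring.solve-∀
      case : p ℕ.≤ 2 ℕ.* ν → m ℕ.* p ℕ.≤ 10 ℕ.* (L ℕ.* K)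
      -- `few-points` assumes that the first coordinate realises the norm; in the other case the
      -- coordinates are exchanged, and the determinant changes sign.
      case p≤2ν with ℕₚ.≤-total νk νx
      ... | inj₁ νk≤νx = few-points m x k L K p γ l x≤ k≤ 0<p νk≤νx (∣+-+∣≤ (x≤ s) (x≤ t))
              (subst (λ z → p ℕ.≤ 2 ℕ.* z) (ℕₚ.m≥n⇒m⊔n≡m νk≤νx) p≤2ν)
              (λ u v u≢v → subst (ℕ._≤ size x k L K u v) (ℕₚ.m≥n⇒m⊔n≡m νk≤νx) (shortest u v u≢v))
              (congruent s t)
      ... | inj₂ νx≤νk = subst (λ z → m ℕ.* p ℕ.≤ 10 ℕ.* z) (ℕₚ.*-comm K L)
              (few-points m k x K L p l γ k≤ x≤ 0<p νx≤νk (∣+-+∣≤ (k≤ s) (k≤ t))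
              (subst (λ z → p ℕ.≤ 2 ℕ.* z) (ℕₚ.m≤n⇒m⊔n≡n νx≤νk) p≤2ν)
              (λ u v u≢v → subst₂ ℕ._≤_ (ℕₚ.m≤n⇒m⊔n≡n νx≤νk) (ℕₚ.⊔-comm (∣ + x u - + x v ∣ ℕ.* K) (∣ + k u - + k v ∣ ℕ.* L)) (shortest u v u≢v))
              (λ u v → subst (+ p ∣_) (swap-det γ l _ _) (ℤ∣.∣m⇒∣-m (congruent s t u v))))
    det< : ∀ u v → ∣ det x k γ l u v ∣ ℕ.< p
    det< u v = begin-strict
      ∣ det x k γ l u v ∣
        ≤⟨ ∣i*j-k*l∣≤ γ (+ k u - + k v) l (+ x u - + x v) ⟩
      ∣ γ ∣ ℕ.* ∣ + k u - + k v ∣ ℕ.+ ∣ l ∣ ℕ.* ∣ + x u - + x v ∣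
        ≤⟨ ℕₚ.+-mono-≤ (ℕₚ.*-monoʳ-≤ ∣ γ ∣ (∣+-+∣≤ (k≤ u) (k≤ v))) (ℕₚ.*-monoʳ-≤ ∣ l ∣ (∣+-+∣≤ (x≤ u) (x≤ v))) ⟩
      νx ℕ.+ νk                ≤⟨ ℕₚ.+-mono-≤ (ℕₚ.m≤m⊔n νx νk) (ℕₚ.m≤n⊔m νx νk) ⟩
      ν ℕ.+ ν                  ≡⟨ cong (ν ℕ.+_) (ℕₚ.+-identityʳ ν) ⟨
      2 ℕ.* ν                  <⟨ 2ν<p ⟩
      p                        ∎
      where open ℕₚ.≤-Reasoning

  gap-exists : ∀ {M} (x : Fin M → ℕ) → (∀ u v → x u ≡ x v → u ≡ v) → ∀ u v → u ≢ v → ∃ λ n → 0 ℕ.< n × (∃₂ λ s t → x t ≡ x s ℕ.+ n) × n ≡ ∣ + x u - + x v ∣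
  gap-exists x x-inj u v u≢v with ℕₚ.<-cmp (x u) (x v)
  ... | tri< lt _ _ = x v ℕ.∸ x u , ℕₚ.m<n⇒0<n∸m lt , (u , v , sym (ℕₚ.m+[n∸m]≡n (ℕₚ.<⇒≤ lt)))
                      , sym (trans (cong ∣_∣ (ℤₚ.m-n≡m⊖n (x u) (x v))) (ℤₚ.∣⊖∣-≤ (ℕₚ.<⇒≤ lt)))
  ... | tri≈ _ eq _ = ⊥-elim (u≢v (x-inj u v eq))
  ... | tri> _ _ gt = x u ℕ.∸ x v , ℕₚ.m<n⇒0<n∸m gt , (v , u , sym (ℕₚ.m+[n∸m]≡n (ℕₚ.<⇒≤ gt)))
                      , sym (trans (cong ∣_∣ (trans (ℤₚ.m-n≡m⊖n (x u) (x v)) (ℤₚ.⊖-≥ (ℕₚ.<⇒≤ gt)))) refl)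

  -- If I < m γ, the m + 1 points would lie in m intervals of length γ, and two of them would be
  -- closer than the smallest gap γ.
  closest-pair : ∀ m (x : Fin (suc m) → ℕ) L → 1 ℕ.≤ m → (∀ u v → x u ≡ x v → u ≡ v) → (∀ u → x u ℕ.≤ L) →
    ∃₂ λ s₀ s₁ → ∃₂ λ u₀ u₁ → ∃ λ γ → ∃ λ I →
      x s₁ ≡ x s₀ ℕ.+ γ × 0 ℕ.< γ × x u₁ ≡ x u₀ ℕ.+ I × m ℕ.* γ ℕ.≤ I
  closest-pair m@(suc m′) x L _ x-inj x≤
    with u₀min , (u₀ , refl) , min₀ ← least lem (λ n → ∃ λ u → x u ≡ n) (_ , Fin.zero , refl)
    with comax , (u₁ , refl) , max₁ ← least lem (λ n → ∃ λ u → L ℕ.∸ x u ≡ n) (_ , Fin.zero , refl)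
    with γ , (0<γ , s₀ , s₁ , s-eq) , minγ ← least lem
           (λ n → 0 ℕ.< n × ∃₂ λ s t → x t ≡ x s ℕ.+ n)
           (let n , 0<n , w , _ = gap-exists x x-inj Fin.zero (Fin.suc Fin.zero) (λ ()) in n , 0<n , w) =
    s₀ , s₁ , u₀ , u₁ , γ , I , s-eq , 0<γ , sym I-eq , mγ≤I
    where
    minimum : ∀ u → x u₀ ℕ.≤ x u
    minimum u = ℕₚ.≮⇒≥ λ lt → min₀ _ lt (u , refl)
    maximum : ∀ u → x u ℕ.≤ x u₁
    maximum u = ℕₚ.≮⇒≥ λ lt → max₁ _ (ℕₚ.∸-monoʳ-< lt (x≤ u)) (u , refl)
    I = x u₁ ℕ.∸ x u₀
    I-eq : x u₀ ℕ.+ I ≡ x u₁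
    I-eq = ℕₚ.m+[n∸m]≡n (minimum u₁)
    instance γ≢0 = ℕ.>-nonZero 0<γ
    mγ≤I : m ℕ.* γ ℕ.≤ I
    mγ≤I = ℕₚ.≮⇒≥ λ I<mγ → contra I<mγ
      where
      y : Fin (suc m) → ℕ
      y u = x u ℕ.∸ x u₀
      contra : I ℕ.< m ℕ.* γ → ⊥
      contra I<mγ = let u , v , u<v , eq = Finₚ.pigeonhole (ℕₚ.n<1+n m) bucket in absurd u v u<v eq
        where
        y<mγ : ∀ u → y u ℕ./ γ ℕ.< m
        y<mγ u = DM.m<n*o⇒m/o<n (ℕₚ.≤-<-trans (ℕₚ.∸-monoˡ-≤ (x u₀) (maximum u)) I<mγ)
        bucket : Fin (suc m) → Fin m
        bucket u = Fin.fromℕ< (y<mγ u)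
        absurd : ∀ u v → u Fin.< v → bucket u ≡ bucket v → ⊥
        absurd u v u<v eq =
          let n , 0<n , w , n≡ = gap-exists x x-inj u v (λ { refl → ℕₚ.<-irrefl refl u<v }) in
          minγ n (subst (ℕ._< γ) (trans shift (sym n≡)) close) (0<n , w)
          where
          close : ∣ + y u - + y v ∣ ℕ.< γ
          close = same-quotient (y u) (y v) γ (trans (sym (Finₚ.toℕ-fromℕ< (y<mγ u)))
                    (trans (cong Fin.toℕ eq) (Finₚ.toℕ-fromℕ< (y<mγ v))))
          cancel : ∀ a b c → a - b ≡ (a + c) - (b + c)
          cancel = ℤ-Ring.solve-∀
          shift : ∣ + y u - + y v ∣ ≡ ∣ + x u - + x v ∣
          shift = cong ∣_∣ (trans (cancel (+ y u) (+ y v) (+ x u₀))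
            (cong₂ (λ a b → + a - + b) (ℕₚ.m∸n+n≡m (minimum u)) (ℕₚ.m∸n+n≡m (minimum v))))

-- Finite products and numerical estimates

module Products where
  open ℕ∣ using (_∣_; ∣m⇒∣m*n; ∣n⇒∣m*n; ∣-refl)

  Π< : ℕ → (ℕ → ℕ) → ℕ
  Π< zero    f = 1
  Π< (suc n) f = f n ℕ.* Π< n f

  ∣Π< : ∀ n f i → i ℕ.< n → f i ∣ Π< n f
  ∣Π< (suc n) f i (ℕ.s≤s i≤n) with ℕₚ.m≤n⇒m<n∨m≡n i≤n
  ... | inj₁ i<n = ∣n⇒∣m*n (f n) (∣Π< n f i i<n)
  ... | inj₂ refl = ∣m⇒∣m*n (Π< n f) ∣-refl

  Π<-≤ : ∀ n f B → (∀ i → i ℕ.< n → f i ℕ.≤ B) → Π< n f ℕ.≤ B ℕ.^ n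
  Π<-≤ zero    f B h = ℕₚ.≤-refl
  Π<-≤ (suc n) f B h = ℕₚ.*-mono-≤ (h n ℕₚ.≤-refl) (Π<-≤ n f B λ i i<n → h i (ℕₚ.m≤n⇒m≤1+n i<n))

  Π<-pos : ∀ n f → (∀ i → i ℕ.< n → 0 ℕ.< f i) → 0 ℕ.< Π< n f
  Π<-pos zero    f h = ℕ.s≤s ℕ.z≤n
  Π<-pos (suc n) f h = ℕₚ.*-mono-≤ (h n ℕₚ.≤-refl) (Π<-pos n f λ i i<n → h i (ℕₚ.m≤n⇒m≤1+n i<n))

module SizeBounds where
  open import Data.Nat
  open ℕₚ
  open Chebyshev using (^-cancelˡ-≤)

  m*n≤o⇒m≤o/n : ∀ m n o .{{_ : NonZero n}} → m * n ≤ o → m ≤ o / n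
  m*n≤o⇒m≤o/n m n o h = subst (_≤ o / n) (DM.m*n/n≡m m n) (DM./-monoˡ-≤ n h)

  -- Replacing `N` by 4 lets the bases cancel: 192 X² ≤ 4 m (n + 1) ≤ 8 m n.
  size-bound : ∀ N X m n → 4 ≤ N → 1 ≤ X → 1 ≤ n → N ^ (192 * (X * X)) ≤ 4 ^ (4 * m * suc n) → 10 * (X * X) < m * n
  size-bound N X m n 4≤N 1≤X 1≤n h = *-cancelˡ-< 8 _ _ (begin-strict
    8 * (10 * (X * X))     ≡⟨ *-assoc 8 10 (X * X) ⟨
    80 * (X * X)           <⟨ *-monoˡ-< (X * X) {{>-nonZero (*-mono-≤ 1≤X 1≤X)}} (≤ᵇ⇒≤ 81 192 tt) ⟩
    192 * (X * X)          ≤⟨ ^-cancelˡ-≤ 4 (s≤s (s≤s z≤n)) (≤-trans (^-monoˡ-≤ (192 * (X * X)) 4≤N) h) ⟩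
    4 * m * suc n          ≤⟨ *-monoʳ-≤ (4 * m) (+-monoˡ-≤ n 1≤n) ⟩
    4 * m * (n + n)        ≡⟨ lem m n ⟩
    8 * (m * n)            ∎)
    where
    open ≤-Reasoning
    lem : ∀ m n → 4 * m * (n + n) ≡ 8 * (m * n)
    lem = ℕ-Ring.solve-∀

  -- W stands for the product of all |l²u² - k²v²| (0 < l ≤ t, k ≤ X), each at most N⁵, times |d| ≤ N.
  size-contradiction : ∀ N X t m n W → 1 ≤ N → 1 ≤ m → t * m ≤ X → 1 ≤ t → 3 ≤ X → 3 ≤ n →
    N ^ (192 * (X * X)) ≤ 4 ^ (4 * m * suc n) → W ≤ ((N ^ 5) ^ suc X) ^ t * N → 2 ^ n ≤ W ^ 2 → ⊥
  size-contradiction N X t m n W 1≤N 1≤m tm≤X 1≤t 3≤X 3≤n h W≤ cheb =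
    -- The power 12 m is chosen so that the exponent 8 X t · 2 · 12 m is 192 X (t m), at most 192
    -- X². The result 2 ^ (12 m n) ≤ 2 ^ (8 m (n + 1)) fails for n ≥ 3.
    <⇒≱ (*-monoʳ-< (4 * m) {{>-nonZero (*-mono-≤ (s≤s (z≤n {3})) 1≤m)}} 2n+2<3n) (^-cancelˡ-≤ 2 (s≤s (s≤s z≤n)) (begin
      2 ^ (4 * m * (3 * n))            ≡⟨ cong (2 ^_) (e₁ m n) ⟩
      2 ^ (n * (12 * m))               ≡⟨ ^-*-assoc 2 n (12 * m) ⟨
      (2 ^ n) ^ (12 * m)               ≤⟨ ^-monoˡ-≤ (12 * m) (≤-trans cheb (^-monoˡ-≤ 2 W≤′)) ⟩
      ((N ^ (8 * (X * t))) ^ 2) ^ (12 * m) ≡⟨ trans (^-*-assoc (N ^ (8 * (X * t))) 2 (12 * m)) (^-*-assoc N (8 * (X * t)) (2 * (12 * m))) ⟩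
      N ^ (8 * (X * t) * (2 * (12 * m)))   ≡⟨ cong (N ^_) (e₂ X t m) ⟩
      N ^ (192 * (X * (t * m)))        ≤⟨ ^-monoʳ-≤ N (*-monoʳ-≤ 192 (*-monoʳ-≤ X tm≤X)) ⟩
      N ^ (192 * (X * X))              ≤⟨ h ⟩
      4 ^ (4 * m * suc n)              ≡⟨ ^-*-assoc 2 2 (4 * m * suc n) ⟩
      2 ^ (2 * (4 * m * suc n))        ≡⟨ cong (2 ^_) (e₃ m n) ⟩
      2 ^ (4 * m * (2 * suc n))        ∎))
    where
    open ≤-Reasoning
    instance N≢0 = >-nonZero 1≤N
    e₁ : ∀ m n → 4 * m * (3 * n) ≡ n * (12 * m)
    e₁ = ℕ-Ring.solve-∀
    e₂ : ∀ X t m → 8 * (X * t) * (2 * (12 * m)) ≡ 192 * (X * (t * m))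
    e₂ = ℕ-Ring.solve-∀
    e₃ : ∀ m n → 2 * (4 * m * suc n) ≡ 4 * m * (2 * suc n)
    e₃ = ℕ-Ring.solve-∀
    e₄ : ∀ X t → 5 * suc X * t ≡ 5 * (X * t) + 5 * t
    e₄ = ℕ-Ring.solve-∀
    e₅ : ∀ t → 5 * t + t ≡ 2 * (3 * t)
    e₅ = ℕ-Ring.solve-∀
    e₆ : ∀ z → 5 * z + 2 * z ≡ 7 * z
    e₆ = ℕ-Ring.solve-∀
    2n+2<3n : 2 * suc n < 3 * n
    2n+2<3n = begin-strict
      2 * suc n   ≡⟨ *-suc 2 n ⟩
      2 + 2 * n   <⟨ +-monoˡ-< (2 * n) 3≤n ⟩
      n + 2 * n   ∎
    exponent : 5 * suc X * t + 1 ≤ 8 * (X * t)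
    exponent = begin
      5 * suc X * t + 1           ≡⟨ cong (_+ 1) (e₄ X t) ⟩
      5 * (X * t) + 5 * t + 1     ≡⟨ +-assoc (5 * (X * t)) (5 * t) 1 ⟩
      5 * (X * t) + (5 * t + 1)   ≤⟨ +-monoʳ-≤ (5 * (X * t)) (+-monoʳ-≤ (5 * t) 1≤t) ⟩
      5 * (X * t) + (5 * t + t)   ≡⟨ cong (λ z → 5 * (X * t) + z) (e₅ t) ⟩
      5 * (X * t) + 2 * (3 * t)   ≤⟨ +-monoʳ-≤ (5 * (X * t)) (*-monoʳ-≤ 2 (*-monoˡ-≤ t 3≤X)) ⟩
      5 * (X * t) + 2 * (X * t)   ≡⟨ e₆ (X * t) ⟩
      7 * (X * t)                 ≤⟨ *-monoˡ-≤ (X * t) (n≤1+n 7) ⟩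
      8 * (X * t)                 ∎
    W≤′ : W ≤ N ^ (8 * (X * t))
    W≤′ = begin
      W                               ≤⟨ W≤ ⟩
      ((N ^ 5) ^ suc X) ^ t * N       ≡⟨ cong (_* N) (trans (cong (_^ t) (^-*-assoc N 5 (suc X))) (^-*-assoc N (5 * suc X) t)) ⟩
      N ^ (5 * suc X * t) * N         ≡⟨ cong (λ z → N ^ (5 * suc X * t) * z) (*-identityʳ N) ⟨
      N ^ (5 * suc X * t) * N ^ 1     ≡⟨ ^-distribˡ-+-* N (5 * suc X * t) 1 ⟨
      N ^ (5 * suc X * t + 1)         ≤⟨ ^-monoʳ-≤ N exponent ⟩
      N ^ (8 * (X * t))               ∎

  -- Origin of the exponent 5: two terms of at most (2N)² N² make 8 N ^ 4.
  factor-bound : ∀ N X l k U V → 8 ≤ N → X ≤ 2 * N → l ≤ X → k ≤ X → U ≤ N → V ≤ N →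
    l * l * (U * U) + k * k * (V * V) ≤ N ^ 5
  factor-bound N X l k U V 8≤N X≤2N l≤X k≤X U≤N V≤N = begin
    l * l * (U * U) + k * k * (V * V)
      ≤⟨ +-mono-≤ (*-mono-≤ (*-mono-≤ (≤-trans l≤X X≤2N) (≤-trans l≤X X≤2N)) (*-mono-≤ U≤N U≤N))
                  (*-mono-≤ (*-mono-≤ (≤-trans k≤X X≤2N) (≤-trans k≤X X≤2N)) (*-mono-≤ V≤N V≤N)) ⟩
    2 * N * (2 * N) * (N * N) + 2 * N * (2 * N) * (N * N)  ≡⟨ lem N ⟩
    8 * (N * (N * (N * (N * 1))))                          ≤⟨ *-monoˡ-≤ (N ^ 4) 8≤N ⟩
    N * N ^ 4                                              ∎
    where
    open ≤-Reasoning
    lem : ∀ N → 2 * N * (2 * N) * (N * N) + 2 * N * (2 * N) * (N * N) ≡ 8 * (N * (N * (N * (N * 1))))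
    lem = ℕ-Ring.solve-∀

-- The arithmetic core: a sifted set that is dense in a window is a progression

module Progression (lem : ExcludedMiddle 0ℓ)
  (N n X m L : ℕ) (good : ℕ → Set) (R : ℕ → ℤ → Set)
  (good⇒prime : ∀ p → good p → Prime p) (n≤good : ∀ p → good p → n ℕ.≤ p)
  (dyadic⇒good : ∀ p → Prime p → n ℕ.< p → p ℕ.≤ n ℕ.+ n → good p)
  (n₀≤n : 504 ℕ.* 504 ℕ.≤ n) (n≤N : n ℕ.≤ N) (3≤m : 3 ℕ.≤ m) (m≤L : m ℕ.≤ L) (L≤X : L ℕ.≤ X) (X≤2N : X ℕ.≤ 2 ℕ.* N)
  -- The density hypothesis and the lower bound for y, combined; log N survives as the base `N`.
  (ineq : N ℕ.^ (192 ℕ.* (X ℕ.* X)) ℕ.≤ 4 ℕ.^ (4 ℕ.* m ℕ.* suc n))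
  (rep : ∀ p → good p → ∃ λ r → ∃ λ δ → ∃ λ K → K ℕ.≤ X ×
    ∀ z → R p z ⇔ (∃ λ j → j ℕ.≤ K × (+ p) ℤ∣.∣ z ℤ.- (r ℤ.+ + j ℤ.* δ)))
  where
  open import Data.Integer using (_+_; _-_; _*_; -_; ∣_∣; _≤_; +≤+)
  open ℤ∣ using (_∣_; ∣m∣n⇒∣m+n; ∣m∣n⇒∣m-n; ∣m⇒∣m*n; ∣n⇒∣m*n; ∣m⇒∣-m; ∣⇒∣ᵤ; ∣ᵤ⇒∣)
  open IntegerLemmas
  open Collinearity lem
  open Products
  open SizeBounds

  A : ℤ → Set
  A z = + 0 ≤ z × z ≤ + N × (∀ p → good p → R p z)

  3≤n : 3 ℕ.≤ n
  3≤n = ℕₚ.≤-trans (ℕₚ.≤ᵇ⇒≤ 3 (504 ℕ.* 504) tt) n₀≤n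
  8≤N : 8 ℕ.≤ N
  8≤N = ℕₚ.≤-trans (ℕₚ.≤ᵇ⇒≤ 8 (504 ℕ.* 504) tt) (ℕₚ.≤-trans n₀≤n n≤N)
  4≤N : 4 ℕ.≤ N
  4≤N = ℕₚ.≤-trans (ℕₚ.≤ᵇ⇒≤ 4 8 tt) 8≤N
  m≤X : m ℕ.≤ X
  m≤X = ℕₚ.≤-trans m≤L L≤X
  3≤X : 3 ℕ.≤ X
  3≤X = ℕₚ.≤-trans 3≤m m≤X
  1≤m : 1 ℕ.≤ m
  1≤m = ℕₚ.≤-trans (ℕ.s≤s ℕ.z≤n) 3≤m
  1≤X : 1 ℕ.≤ X
  1≤X = ℕₚ.≤-trans (ℕ.s≤s ℕ.z≤n) 3≤X

  10X²<mn : 10 ℕ.* (X ℕ.* X) ℕ.< m ℕ.* n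
  10X²<mn = size-bound N X m n 4≤N 1≤X (ℕₚ.≤-trans (ℕ.s≤s ℕ.z≤n) 3≤n) ineq

  -- m ≤ X turns 10 X² < m n into this. Hence every difference of indices along a progression R p is
  -- smaller than every good prime.
  X<n : X ℕ.< n
  X<n = ℕₚ.*-cancelˡ-< X X n (ℕₚ.<-≤-trans (ℕₚ.≤-<-trans (ℕₚ.m≤n*m (X ℕ.* X) 10) 10X²<mn) (ℕₚ.*-monoˡ-≤ n m≤X))

  prime∤small : ∀ {p} i → good p → ∣ i ∣ ℕ.≤ X → + p ∣ i → i ≡ + 0
  prime∤small {p} i gp ∣i∣≤X d = ∣∧<⇒≡0 i d (ℕₚ.<-≤-trans (ℕₚ.≤-<-trans ∣i∣≤X X<n) (n≤good p gp))

  r δ : ∀ p → good p → ℤ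
  r p gp = proj₁ (rep p gp)
  δ p gp = proj₁ (proj₂ (rep p gp))
  K : ∀ p → good p → ℕ
  K p gp = proj₁ (proj₂ (proj₂ (rep p gp)))
  K≤X : ∀ p gp → K p gp ℕ.≤ X
  K≤X p gp = proj₁ (proj₂ (proj₂ (proj₂ (rep p gp))))
  R⇔ : ∀ p gp z → R p z ⇔ (∃ λ j → j ℕ.≤ K p gp × + p ∣ z - (r p gp + + j * δ p gp))
  R⇔ p gp = proj₂ (proj₂ (proj₂ (proj₂ (rep p gp))))

  index : ∀ p (gp : good p) z → A z → ∃ λ j → j ℕ.≤ K p gp × + p ∣ z - (r p gp + + j * δ p gp)
  index p gp z (_ , _ , h) = Equivalence.to (R⇔ p gp z) (h p gp)

  J : ∀ p → good p → ∀ z → A z → ℕ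
  J p gp z Az = proj₁ (index p gp z Az)
  J≤K : ∀ p gp z Az → J p gp z Az ℕ.≤ K p gp
  J≤K p gp z Az = proj₁ (proj₂ (index p gp z Az))

  difference-congruence : ∀ p gp z (Az : A z) z′ (Az′ : A z′) →
    + p ∣ (z - z′) - (+ J p gp z Az - + J p gp z′ Az′) * δ p gp
  difference-congruence p gp z Az z′ Az′ = subst (+ p ∣_)
    (rearrange z z′ (r p gp) (+ J p gp z Az) (+ J p gp z′ Az′) (δ p gp))
    (∣m∣n⇒∣m-n (proj₂ (proj₂ (index p gp z Az))) (proj₂ (proj₂ (index p gp z′ Az′))))
    where
    rearrange : ∀ z z′ r j j′ δ → (z - (r + j * δ)) - (z′ - (r + j′ * δ)) ≡ (z - z′) - (j - j′) * δ
    rearrange = ℤ-Ring.solve-∀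

  ∣A-A∣≤N : ∀ z z′ → A z → A z′ → ∣ z - z′ ∣ ℕ.≤ N
  ∣A-A∣≤N (+ z) (+ z′) (_ , +≤+ z≤ , _) (_ , +≤+ z′≤ , _) = ∣+-+∣≤ z≤ z′≤

  square-∣∣ : ∀ i → + ∣ i ∣ * + ∣ i ∣ ≡ i * i
  square-∣∣ (+ i) = refl
  square-∣∣ -[1+ i ] = refl

  -- The setting provided by `closest-pair`: (s₀, s₁) is a pair of points at the smallest gap γ and
  -- (u₀, u₁) the extreme pair at distance I, both measured in steps of `d`.
  module Points (a d : ℤ) (d≢0 : d ≢ + 0) (x : Fin (suc m) → ℕ) (x-inj : ∀ u v → x u ≡ x v → u ≡ v)
      (x≤L : ∀ u → x u ℕ.≤ L) (Ax : ∀ u → A (a + + x u * d))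
      (s₀ s₁ u₀ u₁ : Fin (suc m)) (γ I : ℕ) (xs-eq : x s₁ ≡ x s₀ ℕ.+ γ) (0<γ : 0 ℕ.< γ)
      (xu-eq : x u₁ ≡ x u₀ ℕ.+ I) (mγ≤I : m ℕ.* γ ℕ.≤ I) where
    point : Fin (suc m) → ℤ
    point u = a + + x u * d

    +-difference : ∀ {a b c} → a ≡ b ℕ.+ c → + a - + b ≡ + c
    +-difference {b = b} {c} refl = trans (cong (_- + b) (ℤₚ.pos-+ b c)) (cancel (+ b) (+ c))
      where
      cancel : ∀ b c → (b + c) - b ≡ c
      cancel = ℤ-Ring.solve-∀

    xs≡ : + x s₁ - + x s₀ ≡ + γ
    xs≡ = +-difference xs-eq
    xu≡ : + x u₁ - + x u₀ ≡ + I
    xu≡ = +-difference xu-eq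

    a₀ v : ℤ
    a₀ = point s₀
    v = + γ * d

    point-difference : ∀ u w → point u - point w ≡ (+ x u - + x w) * d
    point-difference u w = lemma a (+ x u) (+ x w) d
      where
      lemma : ∀ a x y d → (a + x * d) - (a + y * d) ≡ (x - y) * d
      lemma = ℤ-Ring.solve-∀

    v≡ : point s₁ - a₀ ≡ v
    v≡ = trans (point-difference s₁ s₀) (cong (_* d) xs≡)

    γ≤X : γ ℕ.≤ X
    γ≤X = ℕₚ.≤-trans (ℕₚ.≤-trans (ℕₚ.m≤n+m γ (x s₀)) (ℕₚ.≤-reflexive (sym xs-eq))) (ℕₚ.≤-trans (x≤L s₁) L≤X)

    v≢0 : v ≢ + 0
    v≢0 v≡0 with ℤₚ.i*j≡0⇒i≡0∨j≡0 (+ γ) v≡0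
    ... | inj₁ γ≡0 = ℕₚ.<⇒≢ 0<γ (sym (ℤₚ.+-injective γ≡0))
    ... | inj₂ d≡0 = d≢0 d≡0

    ∣v∣≤N : ∣ v ∣ ℕ.≤ N
    ∣v∣≤N = subst (λ z → ∣ z ∣ ℕ.≤ N) v≡ (∣A-A∣≤N _ _ (Ax s₁) (Ax s₀))

    ∣d∣≤N : ∣ d ∣ ℕ.≤ N
    ∣d∣≤N = ℕₚ.≤-trans (ℕₚ.m≤n*m ∣ d ∣ γ {{ℕ.>-nonZero 0<γ}})
      (subst (ℕ._≤ N) (ℤₚ.abs-* (+ γ) d) ∣v∣≤N)

    l : ∀ p → good p → ℤ
    l p gp = + J p gp (point s₁) (Ax s₁) - + J p gp a₀ (Ax s₀)

    v-congruence : ∀ p gp → + p ∣ v - l p gp * δ p gp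
    v-congruence p gp = subst (λ z → + p ∣ z - l p gp * δ p gp) v≡
      (difference-congruence p gp (point s₁) (Ax s₁) a₀ (Ax s₀))

    -- `v` is l δ mod `p` and equals γ d, where 0 < γ ≤ X < p. In particular `l` is not 0, which
    -- `factor` presupposes.
    l-congruence : ∀ p gp → ¬ (+ p ∣ d) → ¬ (+ p ∣ l p gp)
    l-congruence p gp p∤d p∣l = [ p∤γ , p∤d ]′ (prime∣*ℤ (good⇒prime p gp) (+ γ) d p∣v)
      where
      cancel : ∀ v l δ → (v - l * δ) + l * δ ≡ v
      cancel = ℤ-Ring.solve-∀
      p∣v : + p ∣ v
      p∣v = subst (+ p ∣_) (cancel v (l p gp) (δ p gp)) (∣m∣n⇒∣m+n (v-congruence p gp) (∣m⇒∣m*n (δ p gp) p∣l))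
      p∤γ : ¬ (+ p ∣ + γ)
      p∤γ p∣γ = ℕₚ.<⇒≢ 0<γ (sym (ℤₚ.+-injective (prime∤small (+ γ) gp γ≤X p∣γ)))

    -- By collinearity the index along R p is an affine function of `x` on the window. So `l` is to
    -- the index difference of (u₀, u₁), which is at most `X`, as γ is to I, and m γ ≤ I.
    l-bound : ∀ p gp → ¬ (+ p ∣ d) → m ℕ.* ∣ l p gp ∣ ℕ.≤ X
    l-bound p gp p∤d = bound (collinear m x k L (K p gp) p 0<p 1≤m x-inj x≤L (λ u → J≤K p gp _ (Ax u)) large congruent)
      where
      k : Fin (suc m) → ℕ
      k u = J p gp (point u) (Ax u)
      0<p : 0 ℕ.< p
      0<p = ℕₚ.<-≤-trans (ℕₚ.<-≤-trans (ℕ.s≤s ℕ.z≤n) 3≤n) (n≤good p gp)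
      large : 10 ℕ.* (L ℕ.* K p gp) ℕ.< m ℕ.* p
      large = ℕₚ.≤-<-trans (ℕₚ.*-monoʳ-≤ 10 (ℕₚ.*-mono-≤ L≤X (K≤X p gp)))
        (ℕₚ.<-≤-trans 10X²<mn (ℕₚ.*-monoʳ-≤ m (n≤good p gp)))
      Δ : ∀ s t → + p ∣ (+ x s - + x t) * d - (+ k s - + k t) * δ p gp
      Δ s t = subst (λ z → + p ∣ z - (+ k s - + k t) * δ p gp) (point-difference s t)
        (difference-congruence p gp (point s) (Ax s) (point t) (Ax t))
      eliminate : ∀ X′ K′ X K d δ → (X′ * d - K′ * δ) * K - K′ * (X * d - K * δ) ≡ (X′ * K - K′ * X) * d
      eliminate = ℤ-Ring.solve-∀
      -- Eliminating δ from two difference congruences leaves the determinant times `d`; here `p`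
      -- must not divide `d`.
      congruent : ∀ s t u w → + p ∣ det x k (+ x s - + x t) (+ k s - + k t) u w
      congruent s t u w = [ (λ e → e) , (λ e → ⊥-elim (p∤d e)) ]′
        (prime∣*ℤ (good⇒prime p gp) (det x k (+ x s - + x t) (+ k s - + k t) u w) d
          (subst (+ p ∣_) (eliminate (+ x s - + x t) (+ k s - + k t) (+ x u - + x w) (+ k u - + k w) d (δ p gp))
            (∣m∣n⇒∣m-n (∣m⇒∣m*n (+ k u - + k w) (Δ s t)) (∣n⇒∣m*n (+ k s - + k t) (Δ u w)))))
      module _ (γ′ l′ : ℤ) (γ′≢0 : γ′ ≢ + 0) (line : ∀ u w → γ′ * (+ k u - + k w) ≡ l′ * (+ x u - + x w)) where
        ϰ : ℤ
        ϰ = + k u₁ - + k u₀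
        rot₁ : ∀ a b c → a * (b * c) ≡ a * b * c
        rot₁ = ℤ-Ring.solve-∀
        rot₂ : ∀ l g I → l * g * I ≡ l * I * g
        rot₂ = ℤ-Ring.solve-∀
        proportional : l p gp * + I ≡ ϰ * + γ
        proportional = ℤₚ.*-cancelˡ-≡ γ′ (l p gp * + I) (ϰ * + γ) {{ℤ.≢-nonZero γ′≢0}} (begin
          γ′ * (l p gp * + I)     ≡⟨ rot₁ γ′ (l p gp) (+ I) ⟩
          γ′ * l p gp * + I       ≡⟨ cong (_* + I) (trans (line s₁ s₀) (cong (l′ *_) xs≡)) ⟩
          l′ * + γ * + I          ≡⟨ rot₂ l′ (+ γ) (+ I) ⟩
          l′ * + I * + γ          ≡⟨ cong (_* + γ) (trans (line u₁ u₀) (cong (l′ *_) xu≡)) ⟨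
          γ′ * ϰ * + γ            ≡⟨ rot₁ γ′ ϰ (+ γ) ⟨
          γ′ * (ϰ * + γ)          ∎)
          where open ≡-Reasoning
      bound : (∃₂ λ γ′ l′ → γ′ ≢ + 0 × ∀ u w → γ′ * (+ k u - + k w) ≡ l′ * (+ x u - + x w)) →
        m ℕ.* ∣ l p gp ∣ ℕ.≤ X
      bound (γ′ , l′ , γ′≢0 , line) = ℕₚ.*-cancelʳ-≤ (m ℕ.* ∣ l p gp ∣) X γ {{ℕ.>-nonZero 0<γ}} (begin
        m ℕ.* ∣ l p gp ∣ ℕ.* γ     ≡⟨ rot₀ m (∣ l p gp ∣) γ ⟩
        ∣ l p gp ∣ ℕ.* (m ℕ.* γ)   ≤⟨ ℕₚ.*-monoʳ-≤ ∣ l p gp ∣ mγ≤I ⟩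
        ∣ l p gp ∣ ℕ.* I           ≡⟨ ℤₚ.abs-* (l p gp) (+ I) ⟨
        ∣ l p gp * + I ∣           ≡⟨ cong ∣_∣ (proportional γ′ l′ γ′≢0 line) ⟩
        ∣ (+ k u₁ - + k u₀) * + γ ∣ ≡⟨ ℤₚ.abs-* (+ k u₁ - + k u₀) (+ γ) ⟩
        ∣ + k u₁ - + k u₀ ∣ ℕ.* γ
          ≤⟨ ℕₚ.*-monoˡ-≤ γ (ℕₚ.≤-trans (∣+-+∣≤ (J≤K p gp (point u₁) (Ax u₁)) (J≤K p gp (point u₀) (Ax u₀))) (K≤X p gp)) ⟩
        X ℕ.* γ                    ∎)
        where
        open ℕₚ.≤-Reasoning
        rot₀ : ∀ m l γ → m ℕ.* l ℕ.* γ ≡ l ℕ.* (m ℕ.* γ)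
        rot₀ = ℕ-Ring.solve-∀

    instance m≢0 = ℕ.>-nonZero 1≤m

    t : ℕ
    t = X ℕ./ m

    -- |l² u² - k² v²| with l = i + 1. Squaring hides the signs of the two index differences, so
    -- natural numbers suffice as parameters, and the shift excludes l = 0.
    factor : ℤ → ℕ → ℕ → ℕ
    factor u i k = ∣ + suc i * + suc i * (u * u) - + k * + k * (v * v) ∣

    κ : ∀ p → good p → ∀ z → A z → ℤ
    κ p gp z Az = + J p gp z Az - + J p gp a₀ (Ax s₀)

    ∣κ∣≤X : ∀ p gp z Az → ∣ κ p gp z Az ∣ ℕ.≤ X
    ∣κ∣≤X p gp z Az = ℕₚ.≤-trans (∣+-+∣≤ (J≤K p gp z Az) (J≤K p gp a₀ (Ax s₀))) (K≤X p gp)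

    cross-congruence : ∀ p gp z Az → + p ∣ l p gp * (z - a₀) - κ p gp z Az * v
    cross-congruence p gp z Az = subst (+ p ∣_) (eliminate (l p gp) (κ p gp z Az) (z - a₀) v (δ p gp))
      (∣m∣n⇒∣m-n (∣n⇒∣m*n (l p gp) (difference-congruence p gp z Az a₀ (Ax s₀)))
                 (∣n⇒∣m*n (κ p gp z Az) (v-congruence p gp)))
      where
      eliminate : ∀ l k u v δ → l * (u - k * δ) - k * (v - l * δ) ≡ l * u - k * v
      eliminate = ℤ-Ring.solve-∀

    squares-factor : ∀ l k u v → (l * u - k * v) * (l * u + k * v) ≡ l * l * (u * u) - k * k * (v * v)
    squares-factor = ℤ-Ring.solve-∀

    prime∣factor : ∀ p gp z Az i → ∣ l p gp ∣ ≡ suc i → p ℕ∣.∣ factor (z - a₀) i ∣ κ p gp z Az ∣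
    prime∣factor p gp z Az i eq = ∣⇒∣ᵤ (subst (+ p ∣_) (begin
      (l p gp * u - k * v) * (l p gp * u + k * v)     ≡⟨ squares-factor (l p gp) k u v ⟩
      l p gp * l p gp * (u * u) - k * k * (v * v)
        ≡⟨ cong₂ (λ a b → a * (u * u) - b * (v * v))
             (trans (sym (square-∣∣ (l p gp))) (cong (λ a → + a * + a) eq)) (sym (square-∣∣ k)) ⟩
      + suc i * + suc i * (u * u) - + ∣ k ∣ * + ∣ k ∣ * (v * v) ∎)
      (∣m⇒∣m*n (l p gp * u + k * v) (cross-congruence p gp z Az)))
      where
      open ≡-Reasoning
      u k : ℤ
      u = z - a₀
      k = κ p gp z Az

    row : ℤ → ℕ → ℕ
    row u i = Π< (suc X) (factor u i)

    -- The factor |d| accounts for the primes dividing `d`, for which `l-bound` gives nothing.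
    W : ℤ → ℕ
    W u = Π< t (row u) ℕ.* ∣ d ∣

    prime∣W : ∀ z → A z → ∀ p → Prime p → n ℕ.< p → p ℕ.≤ n ℕ.+ n → p ℕ∣.∣ W (z - a₀)
    prime∣W z Az p pp n<p p≤2n = cases lem
      where
      gp : good p
      gp = dyadic⇒good p pp n<p p≤2n
      nonzero : ¬ (+ p ∣ d) → ∀ c → ∣ l p gp ∣ ≡ c → p ℕ∣.∣ W (z - a₀)
      nonzero p∤d zero eq = ⊥-elim (l-congruence p gp p∤d
        (subst (+ p ∣_) (sym (ℤₚ.∣i∣≡0⇒i≡0 eq)) (ℤ∣.divides (+ 0) refl)))
      nonzero p∤d (suc i) eq = ℕ∣.∣m⇒∣m*n ∣ d ∣ (ℕ∣.∣-trans (prime∣factor p gp z Az i eq)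
        (ℕ∣.∣-trans (∣Π< (suc X) (factor (z - a₀) i) ∣ κ p gp z Az ∣ (ℕ.s≤s (∣κ∣≤X p gp z Az)))
                    (∣Π< t (row (z - a₀)) i i<t)))
        where
        i<t : suc i ℕ.≤ t
        i<t = m*n≤o⇒m≤o/n (suc i) m X (ℕₚ.≤-trans (ℕₚ.≤-reflexive (trans (ℕₚ.*-comm (suc i) m) (cong (m ℕ.*_) (sym eq))))
                (l-bound p gp p∤d))
      cases : Dec (+ p ∣ d) → p ℕ∣.∣ W (z - a₀)
      cases (yes p∣d) = ℕ∣.∣n⇒∣m*n (Π< t (row (z - a₀))) (∣⇒∣ᵤ p∣d)
      cases (no p∤d) = nonzero p∤d _ refl

    t*m≤X : t ℕ.* m ℕ.≤ X
    t*m≤X = DM.m/n*n≤m X m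

    1≤t : 1 ℕ.≤ t
    1≤t = m*n≤o⇒m≤o/n 1 m X (ℕₚ.≤-trans (ℕₚ.≤-reflexive (ℕₚ.*-identityˡ m)) m≤X)

    suc-i≤X : ∀ {i} → i ℕ.< t → suc i ℕ.≤ X
    suc-i≤X {i} i<t = ℕₚ.≤-trans (ℕₚ.≤-trans i<t (ℕₚ.m≤m*n t m)) t*m≤X

    factor≤ : ∀ z → A z → ∀ i k → i ℕ.< t → k ℕ.≤ X → factor (z - a₀) i k ℕ.≤ N ℕ.^ 5
    factor≤ z Az i k i<t k≤X = begin
      factor u i k
        ≤⟨ ∣i*j-k*l∣≤ (+ suc i * + suc i) (u * u) (+ k * + k) (v * v) ⟩
      ∣ + suc i * + suc i ∣ ℕ.* ∣ u * u ∣ ℕ.+ ∣ + k * + k ∣ ℕ.* ∣ v * v ∣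
        ≡⟨ cong₂ ℕ._+_ (cong₂ ℕ._*_ (ℤₚ.abs-* (+ suc i) (+ suc i)) (ℤₚ.abs-* u u))
                       (cong₂ ℕ._*_ (ℤₚ.abs-* (+ k) (+ k)) (ℤₚ.abs-* v v)) ⟩
      suc i ℕ.* suc i ℕ.* (∣ u ∣ ℕ.* ∣ u ∣) ℕ.+ k ℕ.* k ℕ.* (∣ v ∣ ℕ.* ∣ v ∣)
        ≤⟨ factor-bound N X (suc i) k (∣ u ∣) (∣ v ∣) 8≤N X≤2N (suc-i≤X i<t) k≤X (∣A-A∣≤N z a₀ Az (Ax s₀)) ∣v∣≤N ⟩
      N ℕ.^ 5 ∎
      where
      open ℕₚ.≤-Reasoning
      u : ℤ
      u = z - a₀

    some-factor-vanishes : ∀ z → A z → ¬ (∀ i k → i ℕ.< t → k ℕ.≤ X → factor (z - a₀) i k ≢ 0)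
    some-factor-vanishes z Az h = size-contradiction N X t m n (W u) (ℕₚ.≤-trans (ℕ.s≤s ℕ.z≤n) 4≤N) 1≤m t*m≤X 1≤t 3≤X 3≤n ineq
      (ℕₚ.*-mono-≤ (Π<-≤ t (row u) ((N ℕ.^ 5) ℕ.^ suc X) λ i i<t →
          Π<-≤ (suc X) (factor u i) (N ℕ.^ 5) λ k k≤X → factor≤ z Az i k i<t (ℕ.s≤s⁻¹ k≤X)) ∣d∣≤N)
      (Chebyshev.primes-in-dyadic-interval n n₀≤n (W u) W>0 (prime∣W z Az))
      where
      u : ℤ
      u = z - a₀
      W>0 : 0 ℕ.< W u
      W>0 = ℕₚ.*-mono-≤ (Π<-pos t (row u) λ i i<t → Π<-pos (suc X) (factor u i) λ k k≤X →
              ℕₚ.n≢0⇒n>0 (h i k i<t (ℕ.s≤s⁻¹ k≤X)))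
            (ℕₚ.n≢0⇒n>0 λ ∣d∣≡0 → d≢0 (ℤₚ.∣i∣≡0⇒i≡0 ∣d∣≡0))

    -- The pair (i, k) depends on no prime. The bound on i + 1 keeps its factor `m`, which later
    -- makes the cross product in `linear₀` smaller than `p`.
    Ratio : ℤ → Set
    Ratio z = ∃₂ λ i k → m ℕ.* suc i ℕ.≤ X × ∣ k ∣ ℕ.≤ X × + suc i * (z - a₀) ≡ k * v

    ratio : ∀ z → A z → Ratio z
    ratio z Az = cases lem
      where
      u : ℤ
      u = z - a₀
      negate : ∀ i k v → i + k * v ≡ + 0 → i ≡ - k * v
      negate i k v eq = trans (shift i (k * v)) (trans (cong (_- k * v) eq) (zero-minus k v))
        where
        shift : ∀ i w → i ≡ i + w - w
        shift = ℤ-Ring.solve-∀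
        zero-minus : ∀ k v → + 0 - k * v ≡ - k * v
        zero-minus = ℤ-Ring.solve-∀
      cases : Dec (∃₂ λ i k → i ℕ.< t × k ℕ.≤ X × factor u i k ≡ 0) → Ratio z
      cases (no none) = ⊥-elim (some-factor-vanishes z Az λ i k i<t k≤X eq → none (i , k , i<t , k≤X , eq))
      cases (yes (i , k , i<t , k≤X , eq)) = [ plus , minus ]′
        (ℤₚ.i*j≡0⇒i≡0∨j≡0 (+ suc i * u - + k * v) (trans (squares-factor (+ suc i) (+ k) u v) (ℤₚ.∣i∣≡0⇒i≡0 eq)))
        where
        m[1+i]≤X : m ℕ.* suc i ℕ.≤ X
        m[1+i]≤X = ℕₚ.≤-trans (ℕₚ.*-monoʳ-≤ m i<t) (ℕₚ.≤-trans (ℕₚ.≤-reflexive (ℕₚ.*-comm m t)) t*m≤X)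
        plus : + suc i * u - + k * v ≡ + 0 → Ratio z
        plus e = i , + k , m[1+i]≤X , k≤X , ℤₚ.i-j≡0⇒i≡j (+ suc i * u) (+ k * v) e
        minus : + suc i * u + + k * v ≡ + 0 → Ratio z
        minus e = i , - + k , m[1+i]≤X , ℕₚ.≤-trans (ℕₚ.≤-reflexive (ℤₚ.∣-i∣≡∣i∣ (+ k))) k≤X
                  , negate (+ suc i * u) (+ k) v e

    p∣d⇒p∣v : ∀ {p} → + p ∣ d → + p ∣ v
    p∣d⇒p∣v = ∣n⇒∣m*n (+ γ)

    -- Both sides are too large for a congruence mod `p` to decide. Replacing (z - a₀) / v by k′ /
    -- (i + 1) turns it into divisibility of l k′ - κ (i + 1) by `p`, and `m` times this number is
    -- at most 2 X² < m n ≤ m p.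
    linear₀ : ∀ p gp → ¬ (+ p ∣ v) → ∀ z Az → l p gp * (z - a₀) ≡ κ p gp z Az * v
    linear₀ p gp p∤v z Az = cases (ratio z Az)
      where
      u k : ℤ
      u = z - a₀
      k = κ p gp z Az
      regroup : ∀ s l k u v k′ → s * u ≡ k′ * v → s * (l * u - k * v) ≡ (l * k′ - k * s) * v
      regroup s l k u v k′ eq = trans (r₁ s l k u v) (trans (cong (λ z → l * z - k * s * v) eq) (r₂ s l k v k′))
        where
        r₁ : ∀ s l k u v → s * (l * u - k * v) ≡ l * (s * u) - k * s * v
        r₁ = ℤ-Ring.solve-∀
        r₂ : ∀ s l k v k′ → l * (k′ * v) - k * s * v ≡ (l * k′ - k * s) * v
        r₂ = ℤ-Ring.solve-∀
      cases : Ratio z → l p gp * u ≡ k * v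
      cases (i , k′ , i-bound , k′-bound , eq) = ℤₚ.i-j≡0⇒i≡j (l p gp * u) (k * v)
        ([ (λ ()) , (λ e → e) ]′ (ℤₚ.i*j≡0⇒i≡0∨j≡0 (+ suc i)
          (trans (regroup (+ suc i) (l p gp) k u v k′ eq) (cong (_* v) coefficient≡0))))
        where
        coefficient : ℤ
        coefficient = l p gp * k′ - k * + suc i
        divisible : + p ∣ coefficient
        divisible = [ (λ e → e) , (λ e → ⊥-elim (p∤v e)) ]′ (prime∣*ℤ (good⇒prime p gp) coefficient v
          (subst (+ p ∣_) (regroup (+ suc i) (l p gp) k u v k′ eq) (∣n⇒∣m*n (+ suc i) (cross-congruence p gp z Az))))
        distribute : ∀ m a b c d → m ℕ.* (a ℕ.* b ℕ.+ c ℕ.* d) ≡ m ℕ.* a ℕ.* b ℕ.+ c ℕ.* (m ℕ.* d)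
        distribute = ℕ-Ring.solve-∀
        twice : ∀ x → x ℕ.+ x ≡ 2 ℕ.* x
        twice = ℕ-Ring.solve-∀
        small : ∣ coefficient ∣ ℕ.< p
        small = ℕₚ.*-cancelˡ-< m _ _ (begin-strict
          m ℕ.* ∣ coefficient ∣
            ≤⟨ ℕₚ.*-monoʳ-≤ m (∣i*j-k*l∣≤ (l p gp) k′ k (+ suc i)) ⟩
          m ℕ.* (∣ l p gp ∣ ℕ.* ∣ k′ ∣ ℕ.+ ∣ k ∣ ℕ.* suc i)     ≡⟨ distribute m (∣ l p gp ∣) (∣ k′ ∣) (∣ k ∣) (suc i) ⟩
          m ℕ.* ∣ l p gp ∣ ℕ.* ∣ k′ ∣ ℕ.+ ∣ k ∣ ℕ.* (m ℕ.* suc i)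
            ≤⟨ ℕₚ.+-mono-≤ (ℕₚ.*-mono-≤ (l-bound p gp λ p∣d → p∤v (p∣d⇒p∣v p∣d)) k′-bound) (ℕₚ.*-mono-≤ (∣κ∣≤X p gp z Az) i-bound) ⟩
          X ℕ.* X ℕ.+ X ℕ.* X     ≡⟨ twice (X ℕ.* X) ⟩
          2 ℕ.* (X ℕ.* X)         ≤⟨ ℕₚ.*-monoˡ-≤ (X ℕ.* X) (ℕₚ.≤ᵇ⇒≤ 2 10 tt) ⟩
          10 ℕ.* (X ℕ.* X)        <⟨ 10X²<mn ⟩
          m ℕ.* n                 ≤⟨ ℕₚ.*-monoʳ-≤ m (n≤good p gp) ⟩
          m ℕ.* p                 ∎)
          where open ℕₚ.≤-Reasoning
        coefficient≡0 : coefficient ≡ + 0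
        coefficient≡0 = ∣∧<⇒≡0 coefficient divisible small

    linear : ∀ p gp → ¬ (+ p ∣ v) → ∀ y Ay z Az →
      l p gp * (y - z) ≡ (+ J p gp y Ay - + J p gp z Az) * v
    linear p gp p∤v y Ay z Az = begin
      l p gp * (y - z)                               ≡⟨ r₁ (l p gp) y z a₀ ⟩
      l p gp * (y - a₀) - l p gp * (z - a₀)          ≡⟨ cong₂ _-_ (linear₀ p gp p∤v y Ay) (linear₀ p gp p∤v z Az) ⟩
      κ p gp y Ay * v - κ p gp z Az * v              ≡⟨ r₂ (+ J p gp y Ay) (+ J p gp z Az) (+ J p gp a₀ (Ax s₀)) v ⟩
      (+ J p gp y Ay - + J p gp z Az) * v            ∎
      where
      open ≡-Reasoning
      r₁ : ∀ l y z a → l * (y - z) ≡ l * (y - a) - l * (z - a)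
      r₁ = ℤ-Ring.solve-∀
      r₂ : ∀ j k i v → (j - i) * v - (k - i) * v ≡ (j - k) * v
      r₂ = ℤ-Ring.solve-∀

    -- `p` divides (i + 1)(z - a₀) = k v, but not i + 1 ≤ X < p. So all of `A` lies in one residue
    -- class for such a prime.
    vanishing₀ : ∀ p → good p → + p ∣ v → ∀ z → A z → + p ∣ z - a₀
    vanishing₀ p gp p∣v z Az =
      let i , k , i-bound , _ , eq = ratio z Az in
      [ (λ p∣s → ⊥-elim (absurd i (prime∤small (+ suc i) gp
            (ℕₚ.≤-trans (ℕₚ.m≤n*m (suc i) m) i-bound) p∣s)))
      , (λ e → e) ]′
        (prime∣*ℤ (good⇒prime p gp) (+ suc i) (z - a₀) (subst (+ p ∣_) (sym eq) (∣n⇒∣m*n k p∣v)))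
      where
      absurd : ∀ i → ¬ (+ suc i ≡ + 0)
      absurd i ()

    vanishing : ∀ p → good p → + p ∣ v → ∀ y → A y → ∀ z → A z → + p ∣ y - z
    vanishing p gp p∣v y Ay z Az = subst (+ p ∣_) (rearrange y z a₀)
      (∣m∣n⇒∣m-n (vanishing₀ p gp p∣v y Ay) (vanishing₀ p gp p∣v z Az))
      where
      rearrange : ∀ y z a → (y - a) - (z - a) ≡ y - z
      rearrange = ℤ-Ring.solve-∀

    -- Position between 0 and `q` for either sign of `q`: along R p the index may decrease while the
    -- element increases.
    data Between : ℤ → ℤ → Set where
      increasing : ∀ {e q} → + 0 ≤ e → e ≤ q → Between e q
      decreasing : ∀ {e q} → q ≤ e → e ≤ + 0 → Between e q

    between-* : ∀ {e q} → Between e q → ∀ g → Between (e * g) (q * g)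
    between-* (increasing 0≤e e≤q) (+ g) = increasing (ℤₚ.*-monoʳ-≤-nonNeg (+ g) 0≤e) (ℤₚ.*-monoʳ-≤-nonNeg (+ g) e≤q)
    between-* (increasing 0≤e e≤q) -[1+ g ] = decreasing (ℤₚ.*-monoʳ-≤-nonPos -[1+ g ] e≤q) (ℤₚ.*-monoʳ-≤-nonPos -[1+ g ] 0≤e)
    between-* (decreasing q≤e e≤0) (+ g) = decreasing (ℤₚ.*-monoʳ-≤-nonNeg (+ g) q≤e) (ℤₚ.*-monoʳ-≤-nonNeg (+ g) e≤0)
    between-* (decreasing q≤e e≤0) -[1+ g ] = increasing (ℤₚ.*-monoʳ-≤-nonPos -[1+ g ] e≤0) (ℤₚ.*-monoʳ-≤-nonPos -[1+ g ] q≤e)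

    between-convex : ∀ {e q} → Between e q → ∀ b lo hi → lo ≤ b → b ≤ hi → lo ≤ b + q → b + q ≤ hi →
      lo ≤ b + e × b + e ≤ hi
    between-convex (increasing 0≤e e≤q) b lo hi lo≤b _ _ b+q≤hi =
      ℤₚ.≤-trans lo≤b (subst (_≤ b + _) (ℤₚ.+-identityʳ b) (ℤₚ.+-monoʳ-≤ b 0≤e)) ,
      ℤₚ.≤-trans (ℤₚ.+-monoʳ-≤ b e≤q) b+q≤hi
    between-convex (decreasing q≤e e≤0) b lo hi _ b≤hi lo≤b+q _ =
      ℤₚ.≤-trans lo≤b+q (ℤₚ.+-monoʳ-≤ b q≤e) ,
      ℤₚ.≤-trans (subst (b + _ ≤_) (ℤₚ.+-identityʳ b) (ℤₚ.+-monoʳ-≤ b e≤0)) b≤hi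

    -- The indices of elements of A along R p are an affine function of the elements, so a common
    -- measure g of differences in A is a step that stays inside every R p.
    between : ∀ c (Ac : A c) c′ (Ac′ : A c′) b (Ab : A b) z (Az : A z) α β q g →
      g ≡ α * (c′ - c) + β * (z - b) → z - b ≡ q * g → ∀ e → Between e q → A (b + e * g)
    between c Ac c′ Ac′ b Ab z Az α β q g g≡ z-b≡ e btw =
      proj₁ range , proj₂ range , λ p gp → Equivalence.from (R⇔ p gp (b + e * g)) (member p gp lem)
      where
      shift : ∀ b z → b + (z - b) ≡ z
      shift = ℤ-Ring.solve-∀
      b+qg≡z : b + q * g ≡ z
      b+qg≡z = trans (cong (λ x → b + x) (sym z-b≡)) (shift b z)
      range : + 0 ≤ b + e * g × b + e * g ≤ + N
      range = between-convex (between-* btw g) b (+ 0) (+ N) (proj₁ Ab) (proj₁ (proj₂ Ab))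
        (subst (+ 0 ≤_) (sym b+qg≡z) (proj₁ Az)) (subst (_≤ + N) (sym b+qg≡z) (proj₁ (proj₂ Az)))
      r₁ : ∀ b e g r j δ → (b - (r + j * δ)) + e * g ≡ (b + e * g) - (r + j * δ)
      r₁ = ℤ-Ring.solve-∀
      r₂ : ∀ b e g r j δ μ → (b - (r + j * δ)) + e * (g - μ * δ) ≡ (b + e * g) - (r + (j + e * μ) * δ)
      r₂ = ℤ-Ring.solve-∀
      member : ∀ p gp → Dec (+ p ∣ v) → ∃ λ j → j ℕ.≤ K p gp × + p ∣ (b + e * g) - (r p gp + + j * δ p gp)
      -- Here `p` divides every difference in `A`, hence `g`, and the index of `b` serves again.
      member p gp (yes p∣v) = J p gp b Ab , J≤K p gp b Ab ,
        subst (+ p ∣_) (r₁ b e g (r p gp) (+ J p gp b Ab) (δ p gp))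
          (∣m∣n⇒∣m+n (proj₂ (proj₂ (index p gp b Ab))) (∣n⇒∣m*n e (subst (+ p ∣_) (sym g≡)
            (∣m∣n⇒∣m+n (∣n⇒∣m*n α (vanishing p gp p∣v c′ Ac′ c Ac)) (∣n⇒∣m*n β (vanishing p gp p∣v z Az b Ab))))))
      member p gp (no p∤v) = j′ , ℤₚ.drop‿+≤+ (subst (_≤ + K p gp) (sym +j′≡) (proj₂ bounds)) ,
        subst (+ p ∣_) (trans (r₂ b e g (r p gp) Jb (δ p gp) μ)
                         (cong (λ w → (b + e * g) - (r p gp + w * δ p gp)) (sym +j′≡)))
          (∣m∣n⇒∣m+n (proj₂ (proj₂ (index p gp b Ab))) (∣n⇒∣m*n e g-congruence))
        where
        open ≡-Reasoning
        Jb Jz Jc Jc′ μ : ℤ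
        Jb = + J p gp b Ab
        Jz = + J p gp z Az
        Jc = + J p gp c Ac
        Jc′ = + J p gp c′ Ac′
        -- The index increment belonging to `g`, by the same combination of α and β. Multiplying by
        -- `v` and applying `linear` shows q μ = Jz - Jb, so the new index Jb + e μ lies between two
        -- indices of R p.
        μ = α * (Jc′ - Jc) + β * (Jz - Jb)
        r₃ : ∀ q α β x y v → q * (α * x + β * y) * v ≡ q * (α * (x * v) + β * (y * v))
        r₃ = ℤ-Ring.solve-∀
        r₄ : ∀ q α β l x y → q * (α * (l * x) + β * (l * y)) ≡ l * (q * (α * x + β * y))
        r₄ = ℤ-Ring.solve-∀
        r₅ : ∀ α β x y j k δ → α * (x - j * δ) + β * (y - k * δ) ≡ (α * x + β * y) - (α * j + β * k) * δ
        r₅ = ℤ-Ring.solve-∀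
        qμ≡ : q * μ ≡ Jz - Jb
        qμ≡ = ℤₚ.*-cancelʳ-≡ (q * μ) (Jz - Jb) v {{ℤ.≢-nonZero v≢0}} (begin
          q * μ * v                                                    ≡⟨ r₃ q α β (Jc′ - Jc) (Jz - Jb) v ⟩
          q * (α * ((Jc′ - Jc) * v) + β * ((Jz - Jb) * v))
            ≡⟨ cong₂ (λ s t → q * (α * s + β * t)) (linear p gp p∤v c′ Ac′ c Ac) (linear p gp p∤v z Az b Ab) ⟨
          q * (α * (l p gp * (c′ - c)) + β * (l p gp * (z - b)))       ≡⟨ r₄ q α β (l p gp) (c′ - c) (z - b) ⟩
          l p gp * (q * (α * (c′ - c) + β * (z - b)))                  ≡⟨ cong (λ w → l p gp * (q * w)) g≡ ⟨
          l p gp * (q * g)                                             ≡⟨ cong (l p gp *_) z-b≡ ⟨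
          l p gp * (z - b)                                             ≡⟨ linear p gp p∤v z Az b Ab ⟩
          (Jz - Jb) * v                                                ∎)
        Jb+qμ≡Jz : Jb + q * μ ≡ Jz
        Jb+qμ≡Jz = trans (cong (λ w → Jb + w) qμ≡) (shift Jb Jz)
        bounds : + 0 ≤ Jb + e * μ × Jb + e * μ ≤ + K p gp
        bounds = between-convex (between-* btw μ) Jb (+ 0) (+ K p gp) (+≤+ ℕ.z≤n) (+≤+ (J≤K p gp b Ab))
          (subst (+ 0 ≤_) (sym Jb+qμ≡Jz) (+≤+ ℕ.z≤n)) (subst (_≤ + K p gp) (sym Jb+qμ≡Jz) (+≤+ (J≤K p gp z Az)))
        j′ : ℕ
        j′ = ∣ Jb + e * μ ∣
        +j′≡ : + j′ ≡ Jb + e * μ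
        +j′≡ = ℤₚ.0≤i⇒+∣i∣≡i (proj₁ bounds)
        g-congruence : + p ∣ g - μ * δ p gp
        g-congruence = subst (+ p ∣_) (trans (r₅ α β (c′ - c) (z - b) (Jc′ - Jc) (Jz - Jb) (δ p gp))
                                       (cong (λ w → w - μ * δ p gp) (sym g≡)))
          (∣m∣n⇒∣m+n (∣n⇒∣m*n α (difference-congruence p gp c′ Ac′ c Ac))
                     (∣n⇒∣m*n β (difference-congruence p gp z Az b Ab)))

    IsDifference : ℕ → Set
    IsDifference g = 0 ℕ.< g × ∃₂ λ c c′ → A c × A c′ × c′ - c ≡ + g

    some-difference : ∃ IsDifference
    some-difference = by-sign v refl
      where
      negate : ∀ x y → y - x ≡ - (x - y)
      negate = ℤ-Ring.solve-∀
      by-sign : ∀ w → v ≡ w → ∃ IsDifference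
      by-sign (+ zero) v≡w = ⊥-elim (v≢0 v≡w)
      by-sign (+ suc k) v≡w = suc k , ℕ.s≤s ℕ.z≤n , a₀ , point s₁ , Ax s₀ , Ax s₁ , trans v≡ v≡w
      by-sign -[1+ k ] v≡w = suc k , ℕ.s≤s ℕ.z≤n , point s₁ , a₀ , Ax s₁ , Ax s₀ ,
        trans (negate (point s₁) a₀) (cong -_ (trans v≡ v≡w))

    bezout : ∀ w u → ∃₂ λ α β → + gcd w u ≡ α * + w + β * + u
    bezout w u with Bézout.identity (gcd-GCD w u)
    ... | Bézout.+- x y eq = + x , - + y , solve₁ (+ gcd w u) (+ y * + u) (+ x * + w) (+ y) (+ u)
            (trans (trans (cong (λ x → + gcd w u + x) (sym (ℤₚ.pos-* y u))) (sym (ℤₚ.pos-+ (gcd w u) (y ℕ.* u)))) (trans (cong +_ eq) (ℤₚ.pos-* x w))) refl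
      where
      solve₁ : ∀ d yu xw y u → d + yu ≡ xw → yu ≡ y * u → d ≡ xw + - y * u
      solve₁ d _ _ y u refl refl = cancel d y u
        where
        cancel : ∀ d y u → d ≡ (d + y * u) + - y * u
        cancel = ℤ-Ring.solve-∀
    ... | Bézout.-+ x y eq = - + x , + y , solve₂ (+ gcd w u) (+ x * + w) (+ y * + u) (+ x) (+ w)
            (trans (trans (cong (λ x → + gcd w u + x) (sym (ℤₚ.pos-* x w))) (sym (ℤₚ.pos-+ (gcd w u) (x ℕ.* w)))) (trans (cong +_ eq) (ℤₚ.pos-* y u))) refl
      where
      solve₂ : ∀ d xw yu x w → d + xw ≡ yu → xw ≡ x * w → d ≡ - x * w + yu
      solve₂ d _ _ x w refl refl = cancel d x w
        where
        cancel : ∀ d x w → d ≡ - x * w + (d + x * w)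
        cancel = ℤ-Ring.solve-∀

    module Minimal (w : ℕ) (0<w : 0 ℕ.< w) (c c′ : ℤ) (Ac : A c) (Ac′ : A c′) (w≡ : c′ - c ≡ + w)
        (minimal : ∀ g → g ℕ.< w → ¬ IsDifference g) where
      -- gcd(w, |z - c|) is again a difference of elements of A, so it is at least w.
      w∣difference : ∀ z → A z → + w ∣ z - c
      w∣difference z Az = by-sign (z - c) refl
        where
        -- `s` is the sign of z - c, so that points on both sides of `c` are treated at once.
        module _ (k : ℕ) (s : ℤ) (z-c≡ : z - c ≡ s * + suc k)
                 (step : ∀ q → suc k ≡ suc q ℕ.* gcd w (suc k) → Between s (s * + suc q))
                 (s²≡1 : s * s ≡ + 1)
                 (difference : A (c + s * + gcd w (suc k)) → 0 ℕ.< gcd w (suc k) → IsDifference (gcd w (suc k))) where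
          g : ℕ
          g = gcd w (suc k)
          α β : ℤ
          α = proj₁ (bezout w (suc k))
          β = proj₁ (proj₂ (bezout w (suc k)))
          g∣w : g ℕ∣.∣ w
          g∣w = gcd[m,n]∣m w (suc k)
          0<g : 0 ℕ.< g
          0<g = ℕₚ.n≢0⇒n>0 λ g≡0 → ℕₚ.<⇒≢ 0<w (sym (ℕ∣.0∣⇒≡0 (subst (ℕ∣._∣ w) g≡0 g∣w)))
          s*s* : ∀ s x → s * s ≡ + 1 → s * (s * x) ≡ x
          s*s* s x eq = trans (sym (ℤₚ.*-assoc s s x)) (trans (cong (_* x) eq) (ℤₚ.*-identityˡ x))
          g≡ : + g ≡ α * (c′ - c) + (β * s) * (z - c)
          g≡ = trans (proj₂ (proj₂ (bezout w (suc k)))) (cong₂ _+_ (cong (α *_) (sym w≡))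
            (sym (trans (cong (λ x → β * s * x) z-c≡) (trans (ℤₚ.*-assoc β s (s * + suc k))
              (cong (β *_) (s*s* s (+ suc k) s²≡1))))))
          new : A (c + s * + g)
          new = from-quotient (gcd[m,n]∣n w (suc k))
            where
            from-quotient : g ℕ∣.∣ suc k → A (c + s * + g)
            from-quotient (ℕ∣.divides (suc q) eq) = between c Ac c′ Ac′ c Ac z Az α (β * s) (s * + suc q) (+ g) g≡
              (trans z-c≡ (trans (cong (s *_) (trans (cong +_ eq) (ℤₚ.pos-* (suc q) g))) (sym (ℤₚ.*-assoc s (+ suc q) (+ g)))))
              s (step q eq)
          w∣ : + w ∣ z - c
          w∣ = subst (+ w ∣_) (sym z-c≡) (∣n⇒∣m*n s (∣ᵤ⇒∣ (subst (ℕ∣._∣ suc k) g≡w (gcd[m,n]∣n w (suc k)))))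
            where
            g≡w : g ≡ w
            g≡w = ℕₚ.≤-antisym (ℕ∣.∣⇒≤ {{ℕ.>-nonZero 0<w}} g∣w)
                    (ℕₚ.≮⇒≥ λ g<w → minimal g g<w (difference new 0<g))
        cancel₁ : ∀ c g → (c + + 1 * g) - c ≡ g
        cancel₁ = ℤ-Ring.solve-∀
        cancel₂ : ∀ c g → c - (c + - (+ 1) * g) ≡ g
        cancel₂ = ℤ-Ring.solve-∀
        by-sign : ∀ u → z - c ≡ u → + w ∣ z - c
        by-sign (+ zero) eq = subst (+ w ∣_) (sym eq) (ℤ∣.divides (+ 0) refl)
        by-sign (+ suc k) eq = w∣ k (+ 1) (trans eq (sym (ℤₚ.*-identityˡ (+ suc k))))
          (λ q _ → increasing (+≤+ ℕ.z≤n) (subst (+ 1 ≤_) (sym (ℤₚ.*-identityˡ (+ suc q))) (+≤+ (ℕ.s≤s ℕ.z≤n)))) refl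
          (λ new 0<g → 0<g , c , _ , Ac , new , cancel₁ c (+ gcd w (suc k)))
        by-sign -[1+ k ] eq = w∣ k (- (+ 1)) (trans eq (sym (ℤₚ.-1*i≡-i (+ suc k))))
          (λ q _ → decreasing (subst (_≤ - (+ 1)) (sym (ℤₚ.-1*i≡-i (+ suc q))) (ℤ.-≤- ℕ.z≤n)) ℤ.-≤+) refl
          (λ new 0<g → 0<g , _ , c , new , Ac , cancel₂ c (+ gcd w (suc k)))

      quotient-of-difference : ∀ y z → A (+ y) → A (+ z) → y ℕ.≤ z → ∃ λ j → z ≡ y ℕ.+ j ℕ.* w
      quotient-of-difference y z Ay Az y≤z = from-divides (subst (w ℕ∣.∣_)
          (trans (cong ∣_∣ (ℤₚ.m-n≡m⊖n z y)) (cong ∣_∣ (ℤₚ.⊖-≥ y≤z)))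
          (∣⇒∣ᵤ (subst (+ w ∣_) (rearrange (+ z) (+ y) c) (∣m∣n⇒∣m-n (w∣difference (+ z) Az) (w∣difference (+ y) Ay)))))
        where
        rearrange : ∀ z y c → (z - c) - (y - c) ≡ z - y
        rearrange = ℤ-Ring.solve-∀
        from-divides : w ℕ∣.∣ z ℕ.∸ y → ∃ λ j → z ≡ y ℕ.+ j ℕ.* w
        from-divides (ℕ∣.divides j eq) = j , trans (sym (ℕₚ.m+[n∸m]≡n y≤z)) (cong (y ℕ.+_) eq)

      nonneg-form : ∀ z → A z → ∃ λ y → z ≡ + y × y ℕ.≤ N
      nonneg-form (+ y) (_ , +≤+ y≤N , _) = y , refl , y≤N

      module Extremes (lo hi : ℕ) (Alo : A (+ lo)) (Ahi : A (+ hi)) (lo-min : ∀ y → A (+ y) → lo ℕ.≤ y)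
          (hi-max : ∀ y → A (+ y) → y ℕ.≤ hi) where
        +-+ : ∀ y j → + (y ℕ.+ j ℕ.* w) ≡ + y + + j * + w
        +-+ y j = trans (ℤₚ.pos-+ y (j ℕ.* w)) (cong (λ x → + y + x) (ℤₚ.pos-* j w))

        progression : ∃₂ λ b q → ∃ λ k → ∀ z → A z ⇔ (∃ λ j → j ℕ.≤ k × z ≡ b + + j * q)
        progression = + lo , + w , k , λ z → mk⇔ (to z) (from z)
          where
          k : ℕ
          k = proj₁ (quotient-of-difference lo hi Alo Ahi (lo-min hi Ahi))
          hi≡ : hi ≡ lo ℕ.+ k ℕ.* w
          hi≡ = proj₂ (quotient-of-difference lo hi Alo Ahi (lo-min hi Ahi))
          to : ∀ z → A z → ∃ λ j → j ℕ.≤ k × z ≡ + lo + + j * + w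
          to z Az = cases z (nonneg-form z Az) Az
            where
            cases : ∀ z → (∃ λ y → z ≡ + y × y ℕ.≤ N) → A z → ∃ λ j → j ℕ.≤ k × z ≡ + lo + + j * + w
            cases _ (y , refl , _) Ay =
              let j , y≡ = quotient-of-difference lo y Alo Ay (lo-min y Ay) in
              j , ℕₚ.*-cancelʳ-≤ j k w {{ℕ.>-nonZero 0<w}} (ℕₚ.+-cancelˡ-≤ lo (j ℕ.* w) (k ℕ.* w)
                    (subst₂ ℕ._≤_ y≡ hi≡ (hi-max y Ay))) , trans (cong +_ y≡) (+-+ lo j)
          cancel : ∀ a b → (a + b) - a ≡ b
          cancel = ℤ-Ring.solve-∀
          combination : ∀ x y → x ≡ + 1 * x + + 0 * y
          combination = ℤ-Ring.solve-∀
          from : ∀ z → (∃ λ j → j ℕ.≤ k × z ≡ + lo + + j * + w) → A z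
          -- The step g is c′ - c itself, combined with coefficients 1 and 0, and convexity is
          -- applied to the whole span from `lo` to `hi`.
          from z (j , j≤k , refl) = between c Ac c′ Ac′ (+ lo) Alo (+ hi) Ahi (+ 1) (+ 0) (+ k) (+ w)
            (trans (combination (+ w) (+ hi - + lo)) (cong (λ x → + 1 * x + + 0 * (+ hi - + lo)) (sym w≡)))
            (trans (cong (λ x → x - + lo) (trans (cong +_ hi≡) (+-+ lo k))) (cancel (+ lo) (+ k * + w)))
            (+ j) (increasing (+≤+ ℕ.z≤n) (+≤+ j≤k))

      progression-from-minimal : ∃₂ λ b q → ∃ λ k → ∀ z → A z ⇔ (∃ λ j → j ℕ.≤ k × z ≡ b + + j * q)
      -- The largest element is found as N ∸ k with the least k.
      progression-from-minimal = extremes (least lem (λ n → A (+ n)) some) (least lem (λ k → A (+ (N ℕ.∸ k))) some-co)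
        where
        c-form : ∃ λ y → c ≡ + y × y ℕ.≤ N
        c-form = nonneg-form c Ac
        some : ∃ λ n → A (+ n)
        some = proj₁ c-form , subst A (proj₁ (proj₂ c-form)) Ac
        some-co : ∃ λ k → A (+ (N ℕ.∸ k))
        some-co = N ℕ.∸ proj₁ c-form , subst A (trans (proj₁ (proj₂ c-form))
          (cong +_ (sym (ℕₚ.m∸[m∸n]≡n (proj₂ (proj₂ c-form)))))) Ac
        extremes : (∃ λ n → A (+ n) × ∀ i → i ℕ.< n → ¬ A (+ i)) →
          (∃ λ k → A (+ (N ℕ.∸ k)) × ∀ i → i ℕ.< k → ¬ A (+ (N ℕ.∸ i))) →
          ∃₂ λ b q → ∃ λ k → ∀ z → A z ⇔ (∃ λ j → j ℕ.≤ k × z ≡ b + + j * q)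
        extremes (lo , Alo , lo-min) (k , Ahi , hi-max) = Extremes.progression lo (N ℕ.∸ k) Alo Ahi
          (λ y Ay → ℕₚ.≮⇒≥ λ y<lo → lo-min y y<lo Ay)
          (λ y Ay → let y≤N = ℤₚ.drop‿+≤+ (proj₁ (proj₂ Ay)) in
            subst (ℕ._≤ N ℕ.∸ k) (ℕₚ.m∸[m∸n]≡n y≤N) (ℕₚ.∸-monoʳ-≤ N (ℕₚ.≮⇒≥ λ lt →
              hi-max (N ℕ.∸ y) lt (subst (λ x → A (+ x)) (sym (ℕₚ.m∸[m∸n]≡n y≤N)) Ay))))

    conclusion : ∃₂ λ b q → ∃ λ k → ∀ z → A z ⇔ (∃ λ j → j ℕ.≤ k × z ≡ b + + j * q)
    conclusion = let w , (0<w , c , c′ , Ac , Ac′ , w≡) , minimal = least lem IsDifference some-difference in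
      Minimal.progression-from-minimal w 0<w c c′ Ac Ac′ w≡ minimal

  sifted-progression : ∀ (a d : ℤ) → d ≢ + 0 → (x : Fin (suc m) → ℕ) → (∀ u v → x u ≡ x v → u ≡ v) →
    (∀ u → x u ℕ.≤ L) → (∀ u → A (a + + x u * d)) →
    ∃₂ λ b q → ∃ λ k → ∀ z → A z ⇔ (∃ λ j → j ℕ.≤ k × z ≡ b + + j * q)
  sifted-progression a d d≢0 x x-inj x≤L Ax =
    let s₀ , s₁ , u₀ , u₁ , γ , I , xs-eq , 0<γ , xu-eq , mγ≤I = closest-pair m x L 1≤m x-inj x≤L in
    Points.conclusion a d d≢0 x x-inj x≤L Ax s₀ s₁ u₀ u₁ γ I xs-eq 0<γ xu-eq mγ≤I

-- Cardinalities, repetition-free progressions and a dense window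

module Counting where
  open import Data.List as List using (List; []; _∷_; length; filter; upTo; applyUpTo; lookup)
  import Data.List.Properties as Listₚ
  open import Data.List.Relation.Unary.All as All using (All; []; _∷_)
  open import Data.List.Relation.Unary.AllPairs using (AllPairs; []; _∷_)
  import Data.List.Relation.Unary.Any as Any
  open import Data.List.Relation.Unary.Any.Properties using (lookup-index)
  import Data.List.Membership.Setoid as Membership
  import Data.List.Membership.Setoid.Properties as Membershipₚ
  open import Data.List.Membership.Propositional using (_∈_)
  import Data.List.Membership.Propositional.Properties as ∈ₚ
  import Data.List.Relation.Unary.Unique.Setoid as UniqueSetoid
  import Data.List.Relation.Unary.Unique.Setoid.Properties as UniqueSetoidₚ
  open import Data.List.Relation.Unary.Unique.Propositional using (Unique)
  import Data.List.Relation.Unary.Unique.Propositional.Properties as Uniqueₚ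
  open import Algebra.Bundles using (AbelianGroup)
  import Algebra.Properties.Group as Groupₚ
  import Algebra.Properties.Monoid.Mult as Mult

  lookup-AllPairs : ∀ {A : Set} {R : A → A → Set} {xs : List A} → AllPairs R xs →
    ∀ {i j} → i Fin.< j → R (lookup xs i) (lookup xs j)
  lookup-AllPairs (px ∷ _) {Fin.zero} {Fin.suc j} _ = All.lookup px (∈ₚ.∈-lookup j)
  lookup-AllPairs (_ ∷ pxs) {Fin.suc i} {Fin.suc j} (ℕ.s≤s i<j) = lookup-AllPairs pxs i<j

  unique-lookup-injective : ∀ {xs : List ℕ} → Unique xs → ∀ i j → lookup xs i ≡ lookup xs j → i ≡ j
  unique-lookup-injective uniq i j eq with Finₚ.<-cmp i j
  ... | tri< i<j _ _ = ⊥-elim (lookup-AllPairs uniq i<j eq)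
  ... | tri≈ _ i≡j _ = i≡j
  ... | tri> _ _ j<i = ⊥-elim (lookup-AllPairs uniq j<i (sym eq))

  module _ (S : Setoid 0ℓ 0ℓ) where
    open Setoid S using (Carrier) renaming (_≈_ to _≈ˢ_; sym to symˢ; trans to transˢ)

    -- Sizes thereby become unique, so `card`, a size picked by excluded middle, equals any size
    -- that is exhibited.
    size-≤ : ∀ {P : Pred Carrier 0ℓ} {m n} → HasSize S P m → HasSize S P n → m ℕ.≤ n
    size-≤ {m = m} {n} (xs , uniq , refl , P⇔) (ys , _ , refl , P⇔′) = ℕₚ.≮⇒≥ λ n<m →
      let i , j , i<j , eq = Finₚ.pigeonhole n<m (λ i → Any.index (to-ys i)) in
      lookup-AllPairs uniq i<j (transˢ (lookup-index (to-ys i))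
        (symˢ (subst (λ k → lookup xs j ≈ˢ lookup ys k) (sym eq) (lookup-index (to-ys j)))))
      where
      open Membership S using () renaming (_∈_ to _∈ˢ_)
      to-ys : ∀ i → lookup xs i ∈ˢ ys
      to-ys i = Equivalence.to (P⇔′ (lookup xs i)) (Equivalence.from (P⇔ (lookup xs i)) (Membershipₚ.∈-lookup S xs i))

    size-unique : ∀ {P : Pred Carrier 0ℓ} {m n} → HasSize S P m → HasSize S P n → m ≡ n
    size-unique p q = ℕₚ.≤-antisym (size-≤ p q) (size-≤ q p)

  length-filter-¬ : ∀ {A : Set} {P : A → Set} (P? : ∀ x → Dec (P x)) xs →
    length xs ≡ length (filter P? xs) ℕ.+ length (filter (λ x → ¬? (P? x)) xs)
  length-filter-¬ P? [] = refl
  length-filter-¬ P? (x ∷ xs) with P? x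
  ... | yes _ = cong suc (length-filter-¬ P? xs)
  ... | no _ = trans (cong suc (length-filter-¬ P? xs)) (sym (ℕₚ.+-suc _ _))

  length-filter-filter : ∀ {A : Set} {P Q : A → Set} (P? : ∀ x → Dec (P x)) (Q? : ∀ x → Dec (Q x)) xs →
    length (filter P? (filter Q? xs)) ℕ.≤ length (filter P? xs)
  length-filter-filter P? Q? [] = ℕ.z≤n
  length-filter-filter P? Q? (x ∷ xs) with Q? x
  length-filter-filter P? Q? (x ∷ xs) | yes _ with P? x
  ... | yes _ = ℕ.s≤s (length-filter-filter P? Q? xs)
  ... | no _ = length-filter-filter P? Q? xs
  length-filter-filter P? Q? (x ∷ xs) | no _ with P? x
  ... | yes _ = ℕₚ.m≤n⇒m≤1+n (length-filter-filter P? Q? xs)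
  ... | no _ = length-filter-filter P? Q? xs

  -- The fullest class is at least average. The induction splits off the top class and keeps the
  -- larger of two candidates.
  pigeonhole-class : ∀ (f : ℕ → ℕ) b js → (∀ j → j ∈ js → f j ℕ.< b) →
    ∃ λ q → length js ℕ.≤ b ℕ.* length (filter (λ j → f j ℕ.≟ q) js)
  pigeonhole-class f zero [] h = 0 , ℕ.z≤n
  pigeonhole-class f zero (j ∷ js) h = ⊥-elim (ℕₚ.<⇒≱ (h j (Any.here refl)) ℕ.z≤n)
  pigeonhole-class f (suc b) js h
    with q , ih ← pigeonhole-class f b (filter (λ j → ¬? (f j ℕ.≟ b)) js) (λ j j∈ →
           let j∈js , fj≢b = ∈ₚ.∈-filter⁻ (λ j → ¬? (f j ℕ.≟ b)) {xs = js} j∈ in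
           ℕₚ.≤∧≢⇒< (ℕ.s≤s⁻¹ (h j j∈js)) fj≢b) =
    choose (ℕₚ.≤-total (length (cls q)) (length (cls b)))
    where
    cls : ℕ → List ℕ
    cls q = filter (λ j → f j ℕ.≟ q) js
    total : length js ℕ.≤ length (cls b) ℕ.+ b ℕ.* length (cls q)
    total = ℕₚ.≤-trans (ℕₚ.≤-reflexive (length-filter-¬ (λ j → f j ℕ.≟ b) js))
      (ℕₚ.+-monoʳ-≤ (length (cls b)) (ℕₚ.≤-trans ih (ℕₚ.*-monoʳ-≤ b (length-filter-filter (λ j → f j ℕ.≟ q) (λ j → ¬? (f j ℕ.≟ b)) js))))
    choose : length (cls q) ℕ.≤ length (cls b) ⊎ length (cls b) ℕ.≤ length (cls q) →
      ∃ λ q → length js ℕ.≤ suc b ℕ.* length (cls q)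
    choose (inj₁ le) = b , ℕₚ.≤-trans total (ℕₚ.+-monoʳ-≤ (length (cls b)) (ℕₚ.*-monoʳ-≤ b le))
    choose (inj₂ le) = q , ℕₚ.≤-trans total (ℕₚ.+-monoˡ-≤ (b ℕ.* length (cls q)) le)

  injection-bound : ∀ {M} L (x : Fin M → ℕ) → (∀ u v → x u ≡ x v → u ≡ v) → (∀ u → x u ℕ.< L) → M ℕ.≤ L
  injection-bound L x x-inj x<L = Finₚ.injective⇒≤ {f = λ u → Fin.fromℕ< (x<L u)} λ {u} {v} eq →
    x-inj u v (trans (sym (Finₚ.toℕ-fromℕ< (x<L u))) (trans (cong Fin.toℕ eq) (Finₚ.toℕ-fromℕ< (x<L v))))

  module _ (lem : ExcludedMiddle 0ℓ) where
    open Classical lem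

    pick-spec : ∀ {X : Set} (P : X → Set) d → ∃ P → P (pick P d)
    pick-spec P d w with lem {∃ P}
    ... | yes (_ , p) = p
    ... | no none = ⊥-elim (none w)

    card-≡ : ∀ G {P} {n} → HasSize (AbelianGroup.setoid G) P n → card G P ≡ n
    card-≡ G {P} {n} h = size-unique (AbelianGroup.setoid G)
      (pick-spec (HasSize (AbelianGroup.setoid G) P) 0 (n , h)) h

    module _ (G : AbelianGroup 0ℓ 0ℓ) where
      open AbelianGroup G using (Carrier; _∙_; ε; setoid; monoid; group; ∙-cong; ∙-congˡ; identityʳ; assoc)
        renaming (_≈_ to _≈ᴳ_; refl to reflᴳ; sym to symᴳ; trans to transᴳ)
      open Mult monoid using (×-homo-+) renaming (_×_ to _·_)

      IsProgressionOfLength : Pred Carrier 0ℓ → ℕ → Set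
      IsProgressionOfLength P k = ∃₂ λ a d → ∀ x → P x ⇔ (∃ λ j → j ℕ.≤ k × x ≈ᴳ a ∙ (j · d))

      -- In a shortest representation no term repeats: otherwise its last term could be dropped.
      shortest-distinct : ∀ P k → (∀ i → i ℕ.< k → ¬ IsProgressionOfLength P i) → ∀ a d →
        (∀ x → P x ⇔ (∃ λ j → j ℕ.≤ k × x ≈ᴳ a ∙ (j · d))) →
        ∀ i j → i ℕ.< j → j ℕ.≤ k → ¬ (a ∙ (i · d) ≈ᴳ a ∙ (j · d))
      shortest-distinct P zero minimal a d P⇔ i j i<j j≤0 _ = ℕₚ.<⇒≱ i<j (ℕₚ.≤-trans j≤0 ℕ.z≤n)
      shortest-distinct P (suc k) minimal a d P⇔ i j i<j j≤k eq = minimal k ℕₚ.≤-refl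
        (a , d , λ x → mk⇔ (shorten x ∘ Equivalence.to (P⇔ x))
          (λ (j , j≤ , e) → Equivalence.from (P⇔ x) (j , ℕₚ.m≤n⇒m≤1+n j≤ , e)))
        where
        r : ℕ
        r = j ℕ.∸ i
        0<r : 0 ℕ.< r
        0<r = ℕₚ.m<n⇒0<n∸m i<j
        r≤k : r ℕ.≤ suc k
        r≤k = ℕₚ.≤-trans (ℕₚ.m∸n≤m j i) j≤k
        rd≈ε : r · d ≈ᴳ ε
        rd≈ε = Groupₚ.∙-cancelˡ group (i · d) (r · d) ε (transᴳ (symᴳ (×-homo-+ d i r))
          (transᴳ (subst (λ z → z · d ≈ᴳ i · d) (sym (ℕₚ.m+[n∸m]≡n (ℕₚ.<⇒≤ i<j)))
            (symᴳ (Groupₚ.∙-cancelˡ group a (i · d) (j · d) eq))) (symᴳ (identityʳ (i · d)))))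
        last : a ∙ (suc k · d) ≈ᴳ a ∙ ((suc k ℕ.∸ r) · d)
        last = ∙-congˡ (transᴳ (subst (λ z → suc k · d ≈ᴳ z · d) (sym (ℕₚ.m∸n+n≡m r≤k)) reflᴳ)
          (transᴳ (×-homo-+ d (suc k ℕ.∸ r) r) (transᴳ (∙-congˡ rd≈ε) (identityʳ _))))
        shorten : ∀ x → (∃ λ j → j ℕ.≤ suc k × x ≈ᴳ a ∙ (j · d)) → ∃ λ j → j ℕ.≤ k × x ≈ᴳ a ∙ (j · d)
        shorten x (j₁ , j≤ , e) with ℕₚ.m≤n⇒m<n∨m≡n j≤
        ... | inj₁ j<  = j₁ , ℕ.s≤s⁻¹ j< , e
        ... | inj₂ refl = suc k ℕ.∸ r , ℕ.s≤s⁻¹ (ℕₚ.∸-monoʳ-< 0<r r≤k) , transᴳ e last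

      -- A given progression may wrap around mod p or have step 0, and then it has more terms than
      -- elements. A bound on the cardinality bounds the length only in a representation without
      -- repetition.
      Reduced : Pred Carrier 0ℓ → Set
      Reduced P = ∃₂ λ a d → ∃ λ k →
        (∀ x → P x ⇔ (∃ λ j → j ℕ.≤ k × x ≈ᴳ a ∙ (j · d))) ×
        (∀ i j → i ℕ.< j → j ℕ.≤ k → ¬ (a ∙ (i · d) ≈ᴳ a ∙ (j · d))) × card G P ≡ suc k

      reduced-progression : ∀ P → IsArithmeticProgression G P → Reduced P
      reduced-progression P (a , d , k , P⇔) = build (least lem (IsProgressionOfLength P) (k , a , d , P⇔))
        where
        build : (∃ λ k → IsProgressionOfLength P k × ∀ i → i ℕ.< k → ¬ IsProgressionOfLength P i) → Reduced P
        build (k , (a , d , P⇔) , minimal) = a , d , k , P⇔ , distinct , card-≡ G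
          ( applyUpTo (λ j → a ∙ (j · d)) (suc k)
          , UniqueSetoidₚ.applyUpTo⁺₁ setoid _ (suc k) (λ {i} {j} i<j j<1+k → distinct i j i<j (ℕ.s≤s⁻¹ j<1+k))
          , Listₚ.length-applyUpTo (λ j → a ∙ (j · d)) (suc k)
          , λ x → mk⇔ (λ Px → let j , j≤k , e = Equivalence.to (P⇔ x) Px in
                Membershipₚ.∈-resp-≈ setoid (symᴳ e) (Membershipₚ.∈-applyUpTo⁺ setoid (λ j → a ∙ (j · d)) (ℕ.s≤s j≤k)))
              (λ x∈ → let j , j<1+k , e = Membershipₚ.∈-applyUpTo⁻ setoid (λ j → a ∙ (j · d)) x∈ in
                Equivalence.from (P⇔ x) (j , ℕ.s≤s⁻¹ j<1+k , e)))
          where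
          distinct = shortest-distinct P k minimal a d P⇔

    -- With |Q| = k + 1, the last condition says that the density M / L of `B` in the window is at
    -- least half its density in `Q`.
    Window : (B Q : Pred ℤ 0ℓ) (d : ℤ) (k L : ℕ) → Set
    Window B Q d k L = ∃ λ M → ∃₂ λ a (x : Fin M → ℕ) → (∀ u v → x u ≡ x v → u ≡ v) × (∀ u → x u ℕ.< L) ×
      (∀ u → B (a ℤ.+ + x u ℤ.* d)) × card ℤ-group (B ∩ Q) ℕ.* L ℕ.≤ M ℕ.* (2 ℕ.* suc k)

    -- The indices are cut into ⌊k / L⌋ + 1 blocks of length `L`, and the fullest one is taken. The
    -- last block may be incomplete; L ≤ k + 1 limits the loss to a factor 2, which turns the 8 of
    -- the density hypothesis into 4.
    dense-window : ∀ (B Q : Pred ℤ 0ℓ) a d k →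
      (∀ x → Q x ⇔ (∃ λ j → j ℕ.≤ k × x ≡ a ℤ.+ + j ℤ.* d)) →
      (∀ i j → i ℕ.< j → j ℕ.≤ k → a ℤ.+ + i ℤ.* d ≢ a ℤ.+ + j ℤ.* d) →
      ∀ L .{{_ : ℕ.NonZero L}} → L ℕ.≤ suc k →
      Window B Q d k L
    dense-window B Q a d k Q⇔ distinct L L≤ = window (pigeonhole-class (ℕ._/ L) (suc (k ℕ./ L)) js
        (λ j j∈ → ℕ.s≤s (DM./-monoˡ-≤ L (ℕ.s≤s⁻¹ (∈ₚ.∈-upTo⁻ (proj₁ (∈js⇒ j∈)))))))
      where
      term : ℕ → ℤ
      term j = a ℤ.+ + j ℤ.* d
      B? : ∀ j → Dec (B (term j))
      B? j = lem
      js : List ℕ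
      js = filter B? (upTo (suc k))
      ∈js⇒ : ∀ {j} → j ∈ js → j ∈ upTo (suc k) × B (term j)
      ∈js⇒ = ∈ₚ.∈-filter⁻ B? {xs = upTo (suc k)}
      js-unique : Unique js
      js-unique = Uniqueₚ.filter⁺ B? (Uniqueₚ.upTo⁺ (suc k))
      terms-unique : ∀ ks → Unique ks → All (ℕ._≤ k) ks → Unique (List.map term ks)
      terms-unique [] [] [] = []
      terms-unique (i ∷ ks) (i∉ ∷ uniq) (i≤k ∷ ks≤k) = go ks i∉ ks≤k ∷ terms-unique ks uniq ks≤k
        where
        go : ∀ ks → All (i ≢_) ks → All (ℕ._≤ k) ks → All (term i ≢_) (List.map term ks)
        go [] [] [] = []
        go (j ∷ ks) (i≢j ∷ rest) (j≤k ∷ ks≤k) = ne ∷ go ks rest ks≤k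
          where
          ne : term i ≢ term j
          ne eq with ℕₚ.<-cmp i j
          ... | tri< i<j _ _ = distinct i j i<j j≤k eq
          ... | tri≈ _ i≡j _ = i≢j i≡j
          ... | tri> _ _ j<i = distinct j i j<i i≤k (sym eq)
      size : card ℤ-group (B ∩ Q) ≡ length js
      size = card-≡ ℤ-group
        ( List.map term js
        , terms-unique js js-unique (All.tabulate λ j∈ → ℕ.s≤s⁻¹ (∈ₚ.∈-upTo⁻ (proj₁ (∈js⇒ j∈))))
        , Listₚ.length-map term js
        , λ x → mk⇔ (to x) (from x))
        where
        to : ∀ x → (B ∩ Q) x → x ∈ List.map term js
        to x (Bx , Qx) with Equivalence.to (Q⇔ x) Qx
        ... | j , j≤k , refl = ∈ₚ.∈-map⁺ term (∈ₚ.∈-filter⁺ B? (∈ₚ.∈-upTo⁺ (ℕ.s≤s j≤k)) Bx)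
        from : ∀ x → x ∈ List.map term js → (B ∩ Q) x
        from x x∈ with ∈ₚ.∈-map⁻ term x∈
        ... | j , j∈ , refl = let j∈upTo , Bj = ∈js⇒ j∈ in
              Bj , Equivalence.from (Q⇔ _) (j , ℕ.s≤s⁻¹ (∈ₚ.∈-upTo⁻ j∈upTo) , refl)
      window : (∃ λ q → length js ℕ.≤ suc (k ℕ./ L) ℕ.* length (filter (λ j → (j ℕ./ L) ℕ.≟ q) js)) → Window B Q d k L
      window (q , many) = length ws , a ℤ.+ + (q ℕ.* L) ℤ.* d , x , x-injective , (λ u → DM.m%n<n (lookup ws u) L) , member , bound
        where
        ws : List ℕ
        ws = filter (λ j → (j ℕ./ L) ℕ.≟ q) js
        ∈ws⇒ : ∀ u → lookup ws u ∈ js × (lookup ws u ℕ./ L ≡ q)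
        ∈ws⇒ u = ∈ₚ.∈-filter⁻ (λ j → (j ℕ./ L) ℕ.≟ q) {xs = js} (∈ₚ.∈-lookup u)
        x : Fin (length ws) → ℕ
        x u = lookup ws u ℕ.% L
        lookup≡ : ∀ u → lookup ws u ≡ x u ℕ.+ q ℕ.* L
        lookup≡ u = trans (DM.m≡m%n+[m/n]*n (lookup ws u) L) (cong (λ z → x u ℕ.+ z ℕ.* L) (proj₂ (∈ws⇒ u)))
        x-injective : ∀ u v → x u ≡ x v → u ≡ v
        x-injective u v eq = unique-lookup-injective (Uniqueₚ.filter⁺ (λ j → (j ℕ./ L) ℕ.≟ q) js-unique) u v
          (trans (lookup≡ u) (trans (cong (ℕ._+ q ℕ.* L) eq) (sym (lookup≡ v))))
        member : ∀ u → B ((a ℤ.+ + (q ℕ.* L) ℤ.* d) ℤ.+ + x u ℤ.* d)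
        member u = subst B (trans (cong (λ z → a ℤ.+ z ℤ.* d) (trans (cong +_ (lookup≡ u)) (ℤₚ.pos-+ (x u) (q ℕ.* L))))
            (regroup a (+ x u) (+ (q ℕ.* L)) d)) (proj₂ (∈js⇒ (proj₁ (∈ws⇒ u))))
          where
          regroup : ∀ a x y d → a ℤ.+ (x ℤ.+ y) ℤ.* d ≡ (a ℤ.+ y ℤ.* d) ℤ.+ x ℤ.* d
          regroup = ℤ-Ring.solve-∀
        bound : card ℤ-group (B ∩ Q) ℕ.* L ℕ.≤ length ws ℕ.* (2 ℕ.* suc k)
        bound = begin
          card ℤ-group (B ∩ Q) ℕ.* L                   ≡⟨ cong (ℕ._* L) size ⟩
          length js ℕ.* L                              ≤⟨ ℕₚ.*-monoˡ-≤ L many ⟩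
          suc (k ℕ./ L) ℕ.* length ws ℕ.* L            ≡⟨ rotate (suc (k ℕ./ L)) (length ws) L ⟩
          length ws ℕ.* (suc (k ℕ./ L) ℕ.* L)
            ≤⟨ ℕₚ.*-monoʳ-≤ (length ws) (ℕₚ.+-mono-≤ L≤ (ℕₚ.≤-trans (DM.m/n*n≤m k L) (ℕₚ.n≤1+n k))) ⟩
          length ws ℕ.* (suc k ℕ.+ suc k)              ≡⟨ cong (λ z → length ws ℕ.* (suc k ℕ.+ z)) (ℕₚ.+-identityʳ (suc k)) ⟨
          length ws ℕ.* (2 ℕ.* suc k)                  ∎
          where
          open ℕₚ.≤-Reasoning
          rotate : ∀ a b c → a ℕ.* b ℕ.* c ≡ b ℕ.* (a ℕ.* c)
          rotate = ℕ-Ring.solve-∀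

open Counting

-- The functional equation of exp on the level of partial sums

module ExponentialSums where
  open import Data.Rational using (_+_; _*_; _-_; -_; _≤_; _<_; ∣_∣)
  open ℚₚ
  open RationalIdentities using (ring)
  open RationalLemmas
  open ExpLemmas

  -- The coefficient of degree `k` in the Cauchy product of two power series.
  conv : ℕ → (ℕ → ℚ) → (ℕ → ℚ) → ℚ
  conv zero    f g = f 0 * g 0
  conv (suc k) f g = f 0 * g (suc k) + conv k (f ∘ suc) g

  conv-congˡ : ∀ k {f f′ : ℕ → ℚ} g → (∀ i → f i ≡ f′ i) → conv k f g ≡ conv k f′ g
  conv-congˡ zero    g h = cong (_* g 0) (h 0)
  conv-congˡ (suc k) g h = cong₂ (λ x y → x * g (suc k) + y) (h 0) (conv-congˡ k g (h ∘ suc))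

  conv-congʳ : ∀ k f {g g′ : ℕ → ℚ} → (∀ i → g i ≡ g′ i) → conv k f g ≡ conv k f g′
  conv-congʳ zero    f h = cong (λ z → f 0 * z) (h 0)
  conv-congʳ (suc k) f h = cong₂ (λ x y → f 0 * x + y) (h (suc k)) (conv-congʳ k (f ∘ suc) h)

  conv-+ˡ : ∀ k f f′ g → conv k (λ i → f i + f′ i) g ≡ conv k f g + conv k f′ g
  conv-+ˡ zero    f f′ g = *-distribʳ-+ (g 0) (f 0) (f′ 0)
  conv-+ˡ (suc k) f f′ g = trans
    (cong (λ z → (f 0 + f′ 0) * g (suc k) + z) (conv-+ˡ k (f ∘ suc) (f′ ∘ suc) g))
    (lem (f 0) (f′ 0) (g (suc k)) _ _)
    where
    lem : ∀ a b c x y → (a + b) * c + (x + y) ≡ (a * c + x) + (b * c + y)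
    lem = solve-∀ ring

  conv-*ˡ : ∀ k a f g → conv k (λ i → a * f i) g ≡ a * conv k f g
  conv-*ˡ zero    a f g = *-assoc a (f 0) (g 0)
  conv-*ˡ (suc k) a f g = trans (cong (λ z → a * f 0 * g (suc k) + z) (conv-*ˡ k a (f ∘ suc) g))
    (lem a (f 0) (g (suc k)) _)
    where
    lem : ∀ a b c x → a * b * c + a * x ≡ a * (b * c + x)
    lem = solve-∀ ring

  conv-*ʳ : ∀ k a f g → conv k f (λ i → a * g i) ≡ a * conv k f g
  conv-*ʳ zero    a f g = lem a (f 0) (g 0)
    where
    lem : ∀ a b c → b * (a * c) ≡ a * (b * c)
    lem = solve-∀ ring
  conv-*ʳ (suc k) a f g = trans (cong (λ z → f 0 * (a * g (suc k)) + z) (conv-*ʳ k a (f ∘ suc) g))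
    (lem a (f 0) (g (suc k)) _)
    where
    lem : ∀ a b c x → b * (a * c) + a * x ≡ a * (b * c + x)
    lem = solve-∀ ring

  conv--ʳ : ∀ k f g g′ → conv k f (λ j → g j - g′ j) ≡ conv k f g - conv k f g′
  conv--ʳ zero    f g g′ = lem (f 0) (g 0) (g′ 0)
    where
    lem : ∀ a b c → a * (b - c) ≡ a * b - a * c
    lem = solve-∀ ring
  conv--ʳ (suc k) f g g′ = trans
    (cong (λ z → f 0 * (g (suc k) - g′ (suc k)) + z) (conv--ʳ k (f ∘ suc) g g′))
    (lem (f 0) (g (suc k)) (g′ (suc k)) _ _)
    where
    lem : ∀ a b c x y → a * (b - c) + (x - y) ≡ (a * b + x) - (a * c + y)
    lem = solve-∀ ring

  deriv : (ℕ → ℚ) → ℕ → ℚ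
  deriv f i = (suc i) /1 * f (suc i)

  -- The product rule for formal power series.
  conv-deriv : ∀ k f g → (suc k) /1 * conv (suc k) f g ≡ conv k (deriv f) g + conv k f (deriv g)
  conv-deriv zero f g = lem (1 /1) (f 0) (f 1) (g 0) (g 1)
    where
    lem : ∀ c f₀ f₁ g₀ g₁ → c * (f₀ * g₁ + f₁ * g₀) ≡ c * f₁ * g₀ + f₀ * (c * g₁)
    lem = solve-∀ ring
  conv-deriv (suc k) f g = begin
    K₂ * (f 0 * G + C)
      ≡⟨ lem K₂ (f 0) G C ⟩
    K₂ * C + f 0 * (K₂ * G)
      ≡⟨ cong (λ z → z * C + f 0 * (K₂ * G)) (/1-suc (suc k)) ⟩
    (K₁ + 1ℚ) * C + f 0 * (K₂ * G)
      ≡⟨ lem₂ K₁ C (f 0 * (K₂ * G)) ⟩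
    K₁ * C + C + f 0 * (K₂ * G)
      ≡⟨ cong (λ z → z + C + f 0 * (K₂ * G)) (conv-deriv k sf g) ⟩
    conv k (deriv sf) g + conv k sf (deriv g) + C + f 0 * (K₂ * G)
      ≡⟨ lem₃ (conv k (deriv sf) g) (conv k sf (deriv g)) (f 1 * g (suc k)) (conv k (sf ∘ suc) g)
           (f 0 * (K₂ * G)) ⟩
    (f 1 * g (suc k) + (conv k (deriv sf) g + conv k (sf ∘ suc) g))
      + (f 0 * (K₂ * G) + conv k sf (deriv g))
      ≡⟨ cong (λ z → (z * g (suc k) + (conv k (deriv sf) g + conv k (sf ∘ suc) g))
                       + (f 0 * (K₂ * G) + conv k sf (deriv g))) (*-identityˡ (f 1)) ⟨
    (1 /1 * f 1 * g (suc k) + (conv k (deriv sf) g + conv k (sf ∘ suc) g))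
      + (f 0 * (K₂ * G) + conv k sf (deriv g))
      ≡⟨ cong (λ z → (1 /1 * f 1 * g (suc k) + z) + (f 0 * (K₂ * G) + conv k sf (deriv g)))
           (trans (sym (conv-+ˡ k (deriv sf) (sf ∘ suc) g)) (conv-congˡ k g shift)) ⟩
    (1 /1 * f 1 * g (suc k) + conv k (deriv f ∘ suc) g) + (f 0 * (K₂ * G) + conv k sf (deriv g)) ∎
    where
    open ≡-Reasoning
    sf : ℕ → ℚ
    sf = f ∘ suc
    K₁ K₂ G C : ℚ
    K₁ = (suc k) /1
    K₂ = (suc (suc k)) /1
    G = g (suc (suc k))
    C = conv (suc k) sf g
    lem : ∀ a b c x → a * (b * c + x) ≡ a * x + b * (a * c)
    lem = solve-∀ ring
    lem₂ : ∀ a x y → (a + 1ℚ) * x + y ≡ a * x + x + y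
    lem₂ = solve-∀ ring
    lem₃ : ∀ a b u c d → a + b + (u + c) + d ≡ (u + (a + c)) + (d + b)
    lem₃ = solve-∀ ring
    shift : ∀ i → deriv sf i + sf (suc i) ≡ deriv f (suc i)
    shift i = trans (lem₄ ((suc i) /1) (sf (suc i))) (cong (_* sf (suc i)) (sym (/1-suc (suc i))))
      where
      lem₄ : ∀ a x → a * x + x ≡ (a + 1ℚ) * x
      lem₄ = solve-∀ ring

  term-deriv : ∀ a i → deriv (expTerm a) i ≡ a * expTerm a i
  term-deriv a i = trans (lem ((suc i) /1) (expTerm a i) a (+ 1 ℚ./ suc i))
    (trans (cong (λ z → a * expTerm a i * z) (recip i)) (*-identityʳ (a * expTerm a i)))
    where
    lem : ∀ k t a r → k * (t * a * r) ≡ a * t * (k * r)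
    lem = solve-∀ ring

  -- The binomial theorem without binomial coefficients: the formal derivative of exp(a T) exp(b T)
  -- is a + b times the product, so its coefficients obey the recurrence that defines
  -- `expTerm (a + b)`.
  conv-term : ∀ a b k → conv k (expTerm a) (expTerm b) ≡ expTerm (a + b) k
  conv-term a b zero = refl
  conv-term a b (suc k) = scale k _ _ (begin
    (suc k) /1 * conv (suc k) (expTerm a) (expTerm b)
      ≡⟨ conv-deriv k (expTerm a) (expTerm b) ⟩
    conv k (deriv (expTerm a)) (expTerm b) + conv k (expTerm a) (deriv (expTerm b))
      ≡⟨ cong₂ _+_
           (trans (conv-congˡ k (expTerm b) (term-deriv a)) (conv-*ˡ k a (expTerm a) (expTerm b)))
           (trans (conv-congʳ k (expTerm a) (term-deriv b)) (conv-*ʳ k b (expTerm a) (expTerm b))) ⟩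
    a * conv k (expTerm a) (expTerm b) + b * conv k (expTerm a) (expTerm b)
      ≡⟨ *-distribʳ-+ (conv k (expTerm a) (expTerm b)) a b ⟨
    (a + b) * conv k (expTerm a) (expTerm b)
      ≡⟨ *-comm (a + b) _ ⟩
    conv k (expTerm a) (expTerm b) * (a + b)
      ≡⟨ cong (_* (a + b)) (conv-term a b k) ⟩
    expTerm (a + b) k * (a + b) ∎)
    where
    open ≡-Reasoning
    scale : ∀ k x y → (suc k) /1 * x ≡ y → x ≡ y * (+ 1 ℚ./ suc k)
    scale k x y refl = sym (trans (lem ((suc k) /1) x (+ 1 ℚ./ suc k))
      (trans (cong (_* x) (recip k)) (*-identityˡ x)))
      where
      lem : ∀ k x r → k * x * r ≡ k * r * x
      lem = solve-∀ ring

  conv-sum-suc : ∀ b k f → conv (suc k) f (expSum b) ≡ conv k f (expSum b) + conv (suc k) f (expTerm b)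
  conv-sum-suc b zero f = lem (f 0) (f 1) (expTerm b 1)
    where
    lem : ∀ x y t → x * (1ℚ + t) + y * 1ℚ ≡ x * 1ℚ + (x * t + y * 1ℚ)
    lem = solve-∀ ring
  conv-sum-suc b (suc k) f = trans
    (cong (λ z → f 0 * (expSum b (suc k) + expTerm b (suc (suc k))) + z) (conv-sum-suc b k (f ∘ suc)))
    (lem (f 0) (expSum b (suc k)) (expTerm b (suc (suc k))) _ _)
    where
    lem : ∀ x s t u v → x * (s + t) + (u + v) ≡ (x * s + u) + (x * t + v)
    lem = solve-∀ ring

  conv-sum : ∀ a b n → conv n (expTerm a) (expSum b) ≡ expSum (a + b) n
  conv-sum a b zero = refl
  conv-sum a b (suc n) = trans (conv-sum-suc b n (expTerm a))
    (cong₂ _+_ (conv-sum a b n) (conv-term a b (suc n)))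

  conv-const-suc : ∀ k f z → conv (suc k) f (λ _ → z) ≡ conv k f (λ _ → z) + f (suc k) * z
  conv-const-suc zero f z = refl
  conv-const-suc (suc k) f z = trans (cong (λ w → f 0 * z + w) (conv-const-suc k (f ∘ suc) z))
    (sym (+-assoc (f 0 * z) _ _))

  conv-const : ∀ a n z → conv n (expTerm a) (λ _ → z) ≡ expSum a n * z
  conv-const a zero z = refl
  conv-const a (suc n) z = trans (conv-const-suc n (expTerm a) z)
    (trans (cong (_+ expTerm a (suc n) * z) (conv-const a n z))
      (sym (*-distribʳ-+ z (expSum a n) (expTerm a (suc n)))))

  conv-bound : ∀ k {f F h H : ℕ → ℚ} → (∀ i → ∣ f i ∣ ≤ F i) → (∀ j → j ℕ.≤ k → ∣ h j ∣ ≤ H j) →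
    ∣ conv k f h ∣ ≤ conv k F H
  conv-bound zero {f} {F} {h} {H} hf hh = ≤-trans (≤-reflexive (∣p*q∣≡∣p∣*∣q∣ (f 0) (h 0)))
    (*-mono (≤-trans (0≤∣p∣ (f 0)) (hf 0)) (0≤∣p∣ (h 0)) (hf 0) (hh 0 ℕ.z≤n))
  conv-bound (suc k) {f} {F} {h} {H} hf hh = ≤-trans (∣p+q∣≤∣p∣+∣q∣ (f 0 * h (suc k)) _)
    (+-mono-≤ (≤-trans (≤-reflexive (∣p*q∣≡∣p∣*∣q∣ (f 0) (h (suc k))))
                (*-mono (≤-trans (0≤∣p∣ (f 0)) (hf 0)) (0≤∣p∣ (h (suc k))) (hf 0) (hh (suc k) ℕₚ.≤-refl)))
              (conv-bound k (hf ∘ suc) (λ j j≤k → hh j (ℕₚ.m≤n⇒m≤1+n j≤k))))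

  sum-mono : ∀ {c} → 0ℚ ≤ c → ∀ d n → expSum c n ≤ expSum c (d ℕ.+ n)
  sum-mono 0≤c zero    n = ≤-refl
  sum-mono {c} 0≤c (suc d) n = ≤-trans (sum-mono 0≤c d n)
    (subst (_≤ expSum c (suc (d ℕ.+ n))) (+-identityʳ _)
      (+-monoʳ-≤ (expSum c (d ℕ.+ n)) (term-nonneg 0≤c (suc (d ℕ.+ n)))))

  conv-nonneg : ∀ k {f g : ℕ → ℚ} → (∀ i → 0ℚ ≤ f i) → (∀ i → 0ℚ ≤ g i) → 0ℚ ≤ conv k f g
  conv-nonneg zero hf hg = *-nonneg (hf 0) (hg 0)
  conv-nonneg (suc k) hf hg = +-nonneg (*-nonneg (hf 0) (hg (suc k))) (conv-nonneg k (hf ∘ suc) hg)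

  conv-head : ∀ n {f g : ℕ → ℚ} → (∀ i → 0ℚ ≤ f i) → (∀ i → 0ℚ ≤ g i) → f 0 * g n ≤ conv n f g
  conv-head zero hf hg = ≤-refl
  conv-head (suc n) {f} {g} hf hg = subst (_≤ conv (suc n) f g) (+-identityʳ _)
    (+-monoʳ-≤ (f 0 * g (suc n)) (conv-nonneg n (hf ∘ suc) hg))

  -- The rectangle i ≤ m, j ≤ n of nonnegative terms lies inside the triangle i + j ≤ m + n.
  conv-const≤ : ∀ {c} → 0ℚ ≤ c → ∀ m n {f : ℕ → ℚ} → (∀ i → 0ℚ ≤ f i) →
    conv m f (λ _ → expSum c n) ≤ conv (m ℕ.+ n) f (expSum c)
  conv-const≤ 0≤c zero n hf = conv-head n hf (sum-nonneg 0≤c)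
  conv-const≤ 0≤c (suc m) n {f} hf =
    +-mono-≤ (*-monoˡ (hf 0) (sum-mono 0≤c (suc m) n)) (conv-const≤ 0≤c m n (hf ∘ suc))

  -- The product of two partial sums differs from a partial sum of the product series by
  -- terms t i(a) t j(b) with i, j ≤ n < i + j; these are dominated by the tail of exp(2c).
  sum-+-bound : ∀ {a b c} → ∣ a ∣ ≤ c → ∣ b ∣ ≤ c → ∀ n →
    ∣ expSum a n * expSum b n - expSum (a + b) n ∣ ≤ expSum (c + c) (n ℕ.+ n) - expSum (c + c) n
  sum-+-bound {a} {b} {c} a≤c b≤c n = begin
    ∣ expSum a n * expSum b n - expSum (a + b) n ∣
      ≡⟨ cong ∣_∣ (rewrite-diff a b) ⟩
    ∣ conv n (expTerm a) (λ j → expSum b n - expSum b j) ∣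
      ≤⟨ conv-bound n (term-bound a≤c) tails ⟩
    conv n (expTerm c) (λ j → expSum c n - expSum c j)
      ≡⟨ rewrite-diff c c ⟨
    expSum c n * expSum c n - expSum (c + c) n
      ≤⟨ +-monoˡ-≤ (- expSum (c + c) n) square≤ ⟩
    expSum (c + c) (n ℕ.+ n) - expSum (c + c) n ∎
    where
    open ≤-Reasoning
    0≤c : 0ℚ ≤ c
    0≤c = ≤-trans (0≤∣p∣ a) a≤c
    rewrite-diff : ∀ a b → expSum a n * expSum b n - expSum (a + b) n
                         ≡ conv n (expTerm a) (λ j → expSum b n - expSum b j)
    rewrite-diff a b = sym (trans (conv--ʳ n (expTerm a) (λ _ → expSum b n) (expSum b))
      (cong₂ _-_ (conv-const a n (expSum b n)) (conv-sum a b n)))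
    tails : ∀ j → j ℕ.≤ n → ∣ expSum b n - expSum b j ∣ ≤ expSum c n - expSum c j
    tails j j≤n = subst (λ k → ∣ expSum b k - expSum b j ∣ ≤ expSum c k - expSum c j)
      (ℕₚ.m∸n+n≡m j≤n) (tail-bound b≤c j (n ℕ.∸ j))
    square≤ : expSum c n * expSum c n ≤ expSum (c + c) (n ℕ.+ n)
    square≤ = begin
      expSum c n * expSum c n                  ≡⟨ conv-const c n (expSum c n) ⟨
      conv n (expTerm c) (λ _ → expSum c n)    ≤⟨ conv-const≤ 0≤c n n (term-nonneg 0≤c) ⟩
      conv (n ℕ.+ n) (expTerm c) (expSum c)    ≡⟨ conv-sum c c (n ℕ.+ n) ⟩
      expSum (c + c) (n ℕ.+ n)                 ∎

  /1-+ : ∀ m n → (m ℕ.+ n) /1 ≡ m /1 + n /1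
  /1-+ zero    n = sym (+-identityˡ (n /1))
  /1-+ (suc m) n = begin
    suc (m ℕ.+ n) /1     ≡⟨ /1-suc (m ℕ.+ n) ⟩
    (m ℕ.+ n) /1 + 1ℚ    ≡⟨ cong (_+ 1ℚ) (/1-+ m n) ⟩
    m /1 + n /1 + 1ℚ     ≡⟨ lem (m /1) (n /1) ⟩
    m /1 + 1ℚ + n /1     ≡⟨ cong (_+ n /1) (/1-suc m) ⟨
    suc m /1 + n /1      ∎
    where
    open ≡-Reasoning
    lem : ∀ a b → a + b + 1ℚ ≡ a + 1ℚ + b
    lem = solve-∀ ring

  /1-* : ∀ m n → (m ℕ.* n) /1 ≡ m /1 * n /1
  /1-* zero    n = sym (*-zeroˡ (n /1))
  /1-* (suc m) n = begin
    (n ℕ.+ m ℕ.* n) /1        ≡⟨ /1-+ n (m ℕ.* n) ⟩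
    n /1 + (m ℕ.* n) /1       ≡⟨ cong (n /1 +_) (/1-* m n) ⟩
    n /1 + m /1 * n /1        ≡⟨ lem (m /1) (n /1) ⟩
    (m /1 + 1ℚ) * n /1        ≡⟨ cong (_* n /1) (/1-suc m) ⟨
    suc m /1 * n /1           ∎
    where
    open ≡-Reasoning
    lem : ∀ a b → b + a * b ≡ (a + 1ℚ) * b
    lem = solve-∀ ring

  tail-small : ∀ b e → 0ℚ < e → ∃ λ N → ∀ n → N ℕ.≤ n → ∀ d →
    expSum (b /1) (d ℕ.+ n) - expSum (b /1) n ≤ e
  tail-small b e 0<e = let N , h = term-small b e 0<e in suc (N ℕ.⊔ (b ℕ.+ b)) , bound N h
    where
    open ≤-Reasoning
    bound : ∀ N → (∀ n → N ℕ.≤ n → expTerm (b /1) (suc n) ≤ e) →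
      ∀ n → suc (N ℕ.⊔ (b ℕ.+ b)) ℕ.≤ n → ∀ d → expSum (b /1) (d ℕ.+ n) - expSum (b /1) n ≤ e
    bound N h (suc n) (ℕ.s≤s N≤n) d = begin
      expSum (b /1) (d ℕ.+ suc n) - expSum (b /1) (suc n)
        ≤⟨ tail≤term b (suc n) d (ℕₚ.m≤n⇒m≤1+n (ℕₚ.m⊔n≤o⇒n≤o N (b ℕ.+ b) N≤n)) ⟩
      expTerm (b /1) (suc n)
        ≤⟨ h n (ℕₚ.m⊔n≤o⇒m≤o N (b ℕ.+ b) N≤n) ⟩
      e ∎

  sum≥1+ : ∀ {a} → 0ℚ ≤ a → ∀ n → 1ℚ + a ≤ expSum a (suc n)
  sum≥1+ {a} 0≤a zero = ≤-reflexive (lem a)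
    where
    lem : ∀ a → 1ℚ + a ≡ 1ℚ + 1ℚ * a * 1ℚ
    lem = solve-∀ ring
  sum≥1+ {a} 0≤a (suc n) = ≤-trans (sum≥1+ 0≤a n) (sum-mono 0≤a 1 (suc n))

  exp-0 : ∀ n → expSum 0ℚ n ≡ 1ℚ
  exp-0 zero = refl
  exp-0 (suc n) = trans (cong₂ _+_ (exp-0 n) (lem (expTerm 0ℚ n) (+ 1 ℚ./ suc n))) (+-identityʳ 1ℚ)
    where
    lem : ∀ t r → t * 0ℚ * r ≡ 0ℚ
    lem t r = trans (cong (_* r) (*-zeroʳ t)) (*-zeroˡ r)

  sum1≤3 : ∀ n → expSum 1ℚ n ≤ 3 /1
  sum1≤3 0 = /1-mono {1} {3} (ℕ.s≤s ℕ.z≤n)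
  sum1≤3 1 = /1-mono {2} {3} (ℕ.s≤s (ℕ.s≤s ℕ.z≤n))
  -- 3 is the partial sum 1 + 1 + 1/2 plus its last term 1/2; from there on, partial sum plus last
  -- term does not increase.
  sum1≤3 (suc (suc n)) = ≤-trans
    (subst (_≤ expSum 1ℚ (suc (suc n)) + expTerm 1ℚ (suc (suc n))) (+-identityʳ _)
      (+-monoʳ-≤ (expSum 1ℚ (suc (suc n))) (term-nonneg (/1-nonneg 1) (suc (suc n)))))
    (subst (λ k → expSum 1ℚ k + expTerm 1ℚ k ≤ 3 /1) (ℕₚ.+-comm n 2) (sum+term-antitone 1 2 n ℕₚ.≤-refl))

open ExponentialSums using (/1-+; /1-*; sum-+-bound; tail-small; sum≥1+; exp-0; sum1≤3; sum-mono)

-- Rational inequalities with an error term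

module RationalBounds where
  open import Data.Rational using (_+_; _*_; _-_; -_; _≤_; _<_; ∣_∣)
  open ℚₚ
  open RationalIdentities using (ring)
  open RationalLemmas

  p≤∣p∣ : ∀ p → p ≤ ∣ p ∣
  p≤∣p∣ p with ≤-total 0ℚ p
  ... | inj₁ 0≤p = ≤-reflexive (sym (0≤p⇒∣p∣≡p 0≤p))
  ... | inj₂ p≤0 = ≤-trans p≤0 (0≤∣p∣ p)

  ∣-∣≤ : ∀ {a b e} → a ≤ b + e → b ≤ a + e → ∣ a - b ∣ ≤ e
  ∣-∣≤ {a} {b} {e} a≤ b≤ with ∣p∣≡p∨∣p∣≡-p (a - b)
  ... | inj₁ eq = subst (_≤ e) (sym eq) (subst (a - b ≤_) (lem b e) (+-monoˡ-≤ (- b) a≤))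
    where
    lem : ∀ b e → (b + e) - b ≡ e
    lem = solve-∀ ring
  ... | inj₂ eq = subst (_≤ e) (sym (trans eq (lem₁ a b))) (subst (b - a ≤_) (lem a e) (+-monoˡ-≤ (- a) b≤))
    where
    lem : ∀ b e → (b + e) - b ≡ e
    lem = solve-∀ ring
    lem₁ : ∀ a b → - (a - b) ≡ b - a
    lem₁ = solve-∀ ring

  ∣-∣≤⇒≤ : ∀ {a b e} → ∣ a - b ∣ ≤ e → a ≤ b + e
  ∣-∣≤⇒≤ {a} {b} {e} h = subst (_≤ b + e) (lem a b) (+-monoʳ-≤ b (≤-trans (p≤∣p∣ (a - b)) h))
    where
    lem : ∀ a b → b + (a - b) ≡ a
    lem = solve-∀ ring

  ∣-∣≤⇒≤′ : ∀ {a b e} → ∣ a - b ∣ ≤ e → b ≤ a + e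
  ∣-∣≤⇒≤′ {a} {b} h = ∣-∣≤⇒≤ (≤-trans (≤-reflexive (∣-∣-sym b a)) h)

  -- The terms of a sequence representing a nonnegative real are only eventually at least -d, for
  -- each d > 0. If just one factor is negative, it is at least -d and the other at most `B`.
  almost-nonneg-* : ∀ {a b d B} → 0ℚ ≤ d → ∣ a ∣ ≤ B → ∣ b ∣ ≤ B → 0ℚ ≤ a + d → 0ℚ ≤ b + d → 0ℚ ≤ a * b + B * d
  almost-nonneg-* {a} {b} {d} {B} 0≤d ∣a∣≤ ∣b∣≤ 0≤a+d 0≤b+d with ≤-total 0ℚ a | ≤-total 0ℚ b
  ... | inj₁ 0≤a | inj₁ 0≤b = +-nonneg (*-nonneg 0≤a 0≤b) (*-nonneg (≤-trans (0≤∣p∣ a) ∣a∣≤) 0≤d)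
  ... | inj₁ 0≤a | inj₂ b≤0 = begin
    0ℚ                ≤⟨ *-nonneg 0≤a 0≤b+d ⟩
    a * (b + d)       ≡⟨ *-distribˡ-+ a b d ⟩
    a * b + a * d     ≤⟨ +-monoʳ-≤ (a * b) (*-monoʳ 0≤d (≤-trans (p≤∣p∣ a) ∣a∣≤)) ⟩
    a * b + B * d     ∎
    where open ≤-Reasoning
  ... | inj₂ a≤0 | inj₁ 0≤b = begin
    0ℚ                ≤⟨ *-nonneg 0≤b 0≤a+d ⟩
    b * (a + d)       ≡⟨ lem a b d ⟩
    a * b + b * d     ≤⟨ +-monoʳ-≤ (a * b) (*-monoʳ 0≤d (≤-trans (p≤∣p∣ b) ∣b∣≤)) ⟩
    a * b + B * d     ∎
    where
    open ≤-Reasoning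
    lem : ∀ a b d → b * (a + d) ≡ a * b + b * d
    lem = solve-∀ ring
  ... | inj₂ a≤0 | inj₂ b≤0 = +-nonneg (subst (0ℚ ≤_) (lem a b) (*-nonneg (neg a≤0) (neg b≤0)))
                                (*-nonneg (≤-trans (0≤∣p∣ a) ∣a∣≤) 0≤d)
    where
    neg : ∀ {x} → x ≤ 0ℚ → 0ℚ ≤ - x
    neg = neg-antimono-≤
    lem : ∀ a b → (- a) * (- b) ≡ a * b
    lem = solve-∀ ring

  square-nonneg : ∀ a → 0ℚ ≤ a * a
  square-nonneg a with ≤-total 0ℚ a
  ... | inj₁ 0≤a = *-nonneg 0≤a 0≤a
  ... | inj₂ a≤0 = subst (0ℚ ≤_) (lem a) (*-nonneg (neg-antimono-≤ a≤0) (neg-antimono-≤ a≤0))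
    where
    lem : ∀ a → (- a) * (- a) ≡ a * a
    lem = solve-∀ ring

  -- For -d ≤ z ≤ 0 the sum differs from its value 1 at 0 by at most 3 d, by the Lipschitz estimate
  -- on [-1, 1].
  sum≥1+-approx : ∀ {z d} n → 0ℚ ≤ d → d ≤ 1ℚ → 0ℚ ≤ z + d → 1ℚ + z ≤ expSum z (suc n) + 3 /1 * d
  sum≥1+-approx {z} {d} n 0≤d d≤1 0≤z+d with ≤-total 0ℚ z
  ... | inj₁ 0≤z = subst (_≤ expSum z (suc n) + 3 /1 * d) (+-identityʳ _)
                     (+-mono-≤ (sum≥1+ 0≤z n) (*-nonneg (/1-nonneg 3) 0≤d))
  ... | inj₂ z≤0 = begin
    1ℚ + z                      ≤⟨ +-monoʳ-≤ 1ℚ z≤0 ⟩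
    1ℚ + 0ℚ                     ≡⟨ +-identityʳ 1ℚ ⟩
    1ℚ                          ≡⟨ exp-0 (suc n) ⟨
    expSum 0ℚ (suc n)           ≤⟨ ∣-∣≤⇒≤′ {expSum z (suc n)} lip ⟩
    expSum z (suc n) + 3 /1 * d ∎
    where
    open ≤-Reasoning
    ∣z∣≤d : ∣ z ∣ ≤ d
    ∣z∣≤d = subst (_≤ d) (cong ∣_∣ (+-identityʳ z))
      (∣-∣≤ (≤-trans z≤0 (≤-trans 0≤d (≤-reflexive (sym (+-identityˡ d))))) 0≤z+d)
    lip : ∣ expSum z (suc n) - expSum 0ℚ (suc n) ∣ ≤ 3 /1 * d
    lip = begin
      ∣ expSum z (suc n) - expSum 0ℚ (suc n) ∣
        ≤⟨ ExpLemmas.sum-lipschitz (≤-trans ∣z∣≤d d≤1) (/1-nonneg 1) n ⟩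
      ∣ z - 0ℚ ∣ * expSum 1ℚ n   ≡⟨ cong (λ w → ∣ w ∣ * expSum 1ℚ n) (+-identityʳ z) ⟩
      ∣ z ∣ * expSum 1ℚ n        ≤⟨ *-mono 0≤d (≤-trans (0≤∣p∣ _) (≤-reflexive (0≤p⇒∣p∣≡p (ExpLemmas.sum-nonneg (/1-nonneg 1) n)))) ∣z∣≤d (sum1≤3 n) ⟩
      d * 3 /1                   ≡⟨ *-comm d (3 /1) ⟩
      3 /1 * d                   ∎

  sum≤1+3 : ∀ {r} n → 0ℚ ≤ r → r ≤ 1ℚ → expSum r (suc n) ≤ 1ℚ + 3 /1 * r
  sum≤1+3 {r} n 0≤r r≤1 = subst (λ w → expSum r (suc n) ≤ w + 3 /1 * r) (exp-0 (suc n)) (∣-∣≤⇒≤ (begin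
      ∣ expSum r (suc n) - expSum 0ℚ (suc n) ∣
        ≤⟨ ExpLemmas.sum-lipschitz (≤-trans (≤-reflexive (0≤p⇒∣p∣≡p 0≤r)) r≤1) (/1-nonneg 1) n ⟩
      ∣ r - 0ℚ ∣ * expSum 1ℚ n   ≡⟨ cong (λ w → ∣ w ∣ * expSum 1ℚ n) (+-identityʳ r) ⟩
      ∣ r ∣ * expSum 1ℚ n        ≡⟨ cong (_* expSum 1ℚ n) (0≤p⇒∣p∣≡p 0≤r) ⟩
      r * expSum 1ℚ n            ≤⟨ *-monoˡ 0≤r (sum1≤3 n) ⟩
      r * 3 /1                   ≡⟨ *-comm r (3 /1) ⟩
      3 /1 * r                   ∎))
    where open ≤-Reasoning

  recip≤1 : ∀ m → + 1 ℚ./ suc m ≤ 1ℚ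
  recip≤1 m = begin
    + 1 ℚ./ suc m                 ≡⟨ *-identityˡ _ ⟨
    1ℚ * (+ 1 ℚ./ suc m)          ≤⟨ *-monoʳ (recip-nonneg m) (/1-mono {1} {suc m} (ℕ.s≤s ℕ.z≤n)) ⟩
    (suc m) /1 * (+ 1 ℚ./ suc m)  ≡⟨ recip m ⟩
    1ℚ                            ∎
    where open ≤-Reasoning

  recip-small : ∀ c e → 0ℚ < e → ∃ λ M → ∀ m → M ℕ.≤ m → c * (+ 1 ℚ./ suc m) ≤ e
  recip-small c e 0<e = let M , h = archimedean c e 0<e in M , bound M h
    where
    open ≤-Reasoning
    bound : ∀ M → c ≤ M /1 * e → ∀ m → M ℕ.≤ m → c * (+ 1 ℚ./ suc m) ≤ e
    bound M h m M≤m = begin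
      c * (+ 1 ℚ./ suc m)              ≤⟨ *-monoʳ (recip-nonneg m) h ⟩
      M /1 * e * (+ 1 ℚ./ suc m)       ≤⟨ *-monoʳ (recip-nonneg m) (*-monoʳ (<⇒≤ 0<e)
                                            (/1-mono (ℕₚ.m≤n⇒m≤1+n M≤m))) ⟩
      (suc m) /1 * e * (+ 1 ℚ./ suc m) ≡⟨ lem ((suc m) /1) e (+ 1 ℚ./ suc m) ⟩
      e * ((suc m) /1 * (+ 1 ℚ./ suc m)) ≡⟨ cong (e *_) (recip m) ⟩
      e * 1ℚ                           ≡⟨ *-identityʳ e ⟩
      e                                ∎
      where
      lem : ∀ a e r → a * e * r ≡ e * (a * r)
      lem = solve-∀ ring

  recip-pos : ∀ m → 0ℚ < + 1 ℚ./ suc m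
  recip-pos m = positive⁻¹ _ {{normalize-pos 1 (suc m)}}

  half-gap : ∀ {p q} → q < p → ∃ λ e → 0ℚ < e × q + e < p
  half-gap {p} {q} q<p = (p - q) * ½ , ½-pos 0<p-q ,
    subst₂ _<_ refl (lem q p) (+-monoʳ-< q (subst ((p - q) * ½ <_) (½+½ (p - q))
      (subst (_< (p - q) * ½ + (p - q) * ½) (+-identityʳ _) (+-monoʳ-< ((p - q) * ½) (½-pos 0<p-q)))))
    where
    lem : ∀ q p → q + (p - q) ≡ p
    lem = solve-∀ ring
    0<p-q : 0ℚ < p - q
    0<p-q = subst (_< p - q) (+-inverseʳ q) (+-monoˡ-< (- q) q<p)

open RationalBounds
open import Defs

-- Order and arithmetic of the reals

module RealOrder where
  open ℝ using (seq; cauchy)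
  open RationalIdentities using (ring)
  open RationalLemmas
  open CauchyLemmas using (bounded; shrink)

  infix 4 _⊑_ _≋_
  infixr 3 _∧_

  -- _≤_ and _≈_ wrapped in records, so that their arguments can be inferred.
  record _⊑_ (x y : ℝ) : Set where
    constructor wrap
    field unwrap : x ≤ y
  open _⊑_ public

  record _≋_ (x y : ℝ) : Set where
    constructor _∧_
    field
      below : x ⊑ y
      above : y ⊑ x
  open _≋_ public

  Eventually : (ℕ → Set) → Set
  Eventually P = ∃ λ N → ∀ n → N ℕ.≤ n → P n

  ev-map : ∀ {P Q : ℕ → Set} → Eventually P → (∀ n → P n → Q n) → Eventually Q
  ev-map (N , h) f = N , λ n N≤n → f n (h n N≤n)

  ev-map₂ : ∀ {P Q R : ℕ → Set} → Eventually P → Eventually Q → (∀ n → P n → Q n → R n) → Eventually R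
  ev-map₂ (M , g) (N , h) f = M ℕ.⊔ N , λ n le →
    f n (g n (ℕₚ.m⊔n≤o⇒m≤o M N le)) (h n (ℕₚ.m⊔n≤o⇒n≤o M N le))

  ev-shift : ∀ {P : ℕ → Set} → Eventually (λ n → P (suc n)) → Eventually P
  ev-shift {P} (N , h) = suc N , λ { (suc n) (ℕ.s≤s N≤n) → h n N≤n }

  ev-suc : ∀ {P : ℕ → Set} → Eventually P → Eventually (λ n → P (suc n))
  ev-suc (N , h) = N , λ n N≤n → h (suc n) (ℕₚ.m≤n⇒m≤1+n N≤n)

  ⊑-eventually : ∀ {x y} → Eventually (λ n → seq x n ℚ.≤ seq y n) → x ⊑ y
  ⊑-eventually {x} {y} h = wrap λ e 0<e → ev-map h λ n le →
    ℚₚ.≤-trans le (subst (ℚ._≤ seq y n ℚ.+ e) (ℚₚ.+-identityʳ _) (ℚₚ.+-monoʳ-≤ (seq y n) (ℚₚ.<⇒≤ 0<e)))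

  ⊑-pointwise : ∀ {x y} → (∀ n → seq x n ℚ.≤ seq y n) → x ⊑ y
  ⊑-pointwise h = ⊑-eventually (0 , λ n _ → h n)

  ≋-pointwise : ∀ {x y} → (∀ n → seq x n ≡ seq y n) → x ≋ y
  ≋-pointwise h = ⊑-pointwise (λ n → ℚₚ.≤-reflexive (h n)) ∧ ⊑-pointwise (λ n → ℚₚ.≤-reflexive (sym (h n)))

  ⊑-refl : ∀ {x} → x ⊑ x
  ⊑-refl = ⊑-pointwise (λ _ → ℚₚ.≤-refl)

  ⊑-trans : ∀ {x y z} → x ⊑ y → y ⊑ z → x ⊑ z
  ⊑-trans {x} {y} {z} (wrap f) (wrap g) = wrap λ e 0<e →
    ev-map₂ (f (e ℚ.* ½) (½-pos 0<e)) (g (e ℚ.* ½) (½-pos 0<e)) λ n p q →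
      ℚₚ.≤-trans p (ℚₚ.≤-trans (ℚₚ.+-monoˡ-≤ (e ℚ.* ½) q)
        (ℚₚ.≤-reflexive (trans (ℚₚ.+-assoc (seq z n) _ _) (cong (λ w → seq z n ℚ.+ w) (½+½ e)))))

  ≋-refl : ∀ {x} → x ≋ x
  ≋-refl = ⊑-refl ∧ ⊑-refl

  ≋-sym : ∀ {x y} → x ≋ y → y ≋ x
  ≋-sym (p ∧ q) = q ∧ p

  ≋-trans : ∀ {x y z} → x ≋ y → y ≋ z → x ≋ z
  ≋-trans (p ∧ q) (r ∧ s) = ⊑-trans p r ∧ ⊑-trans s q

  ℝ-preorder : Preorder 0ℓ 0ℓ 0ℓ
  ℝ-preorder = record
    { Carrier = ℝ ; _≈_ = _≋_ ; _≲_ = _⊑_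
    ; isPreorder = record
      { isEquivalence = record { refl = ≋-refl ; sym = ≋-sym ; trans = ≋-trans }
      ; reflexive = below ; trans = ⊑-trans } }

  module ℝ-Reasoning = PreorderReasoning ℝ-preorder

  from≈ : ∀ {x y} → x ≈ y → x ≋ y
  from≈ (p , q) = wrap p ∧ wrap q

  to≈ : ∀ {x y} → x ≋ y → x ≈ y
  to≈ (wrap p ∧ wrap q) = p , q

  close⇒≋ : ∀ {x y} → (∀ e → 0ℚ ℚ.< e → Eventually (λ n → ℚ.∣ seq x n ℚ.- seq y n ∣ ℚ.≤ e)) → x ≋ y
  close⇒≋ {x} {y} h = wrap (λ e 0<e → ev-map (h e 0<e) λ n → ∣-∣≤⇒≤ {seq x n} {seq y n} {e})
            ∧ wrap (λ e 0<e → ev-map (h e 0<e) λ n → ∣-∣≤⇒≤′ {seq x n} {seq y n} {e})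

  ≋⇒close : ∀ {x y} → x ≋ y → ∀ e → 0ℚ ℚ.< e → Eventually (λ n → ℚ.∣ seq x n ℚ.- seq y n ∣ ℚ.≤ e)
  ≋⇒close {x} {y} (wrap p ∧ wrap q) e 0<e = ev-map₂ (p e 0<e) (q e 0<e) λ n → ∣-∣≤ {seq x n} {seq y n} {e}

  common-bound : ∀ x y → ∃ λ B → Eventually (λ n → ℚ.∣ seq x n ∣ ℚ.≤ B /1 × ℚ.∣ seq y n ∣ ℚ.≤ B /1)
  common-bound x y =
    let a , p = bounded {seq x} (cauchy x)
        b , q = bounded {seq y} (cauchy y)
    in a ℕ.⊔ b , ev-map₂ p q λ n u v →
         ℚₚ.≤-trans u (/1-mono (ℕₚ.m≤m⊔n a b)) , ℚₚ.≤-trans v (/1-mono (ℕₚ.m≤n⊔m a b))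

  infixl 6 _⊕_
  infixl 7 _⊗_
  infix 8 ⊝_

  -- Abstract, since comparing unfolded reals means comparing their Cauchy moduli.
  abstract
    _⊕_ _⊗_ : ℝ → ℝ → ℝ
    _⊕_ = _+_
    _⊗_ = _*_

    ⊝_ E : ℝ → ℝ
    ⊝_ = -_
    E = exp

    ι : ℚ → ℝ
    ι = fromℚ

    ⊕≡+ : _⊕_ ≡ _+_
    ⊕≡+ = refl
    ⊗≡* : _⊗_ ≡ _*_
    ⊗≡* = refl
    ⊝≡- : ⊝_ ≡ -_
    ⊝≡- = refl
    E≡exp : E ≡ exp
    E≡exp = refl
    ι≡fromℚ : ι ≡ fromℚ
    ι≡fromℚ = refl

    ⊕-mono : ∀ {x x′ y y′} → x ⊑ x′ → y ⊑ y′ → x ⊕ y ⊑ x′ ⊕ y′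
    ⊕-mono {x} {x′} {y} {y′} (wrap f) (wrap g) = wrap λ e 0<e →
      ev-map₂ (f (e ℚ.* ½) (½-pos 0<e)) (g (e ℚ.* ½) (½-pos 0<e)) λ n p q →
        ℚₚ.≤-trans (ℚₚ.+-mono-≤ p q) (ℚₚ.≤-reflexive (trans (lem (seq x′ n) (seq y′ n) (e ℚ.* ½))
          (cong (λ w → seq x′ n ℚ.+ seq y′ n ℚ.+ w) (½+½ e))))
      where
      lem : ∀ a b h → (a ℚ.+ h) ℚ.+ (b ℚ.+ h) ≡ (a ℚ.+ b) ℚ.+ (h ℚ.+ h)
      lem = solve-∀ ring

    ⊗-congʳ : ∀ {x x′} y → x ≋ x′ → x ⊗ y ≋ x′ ⊗ y
    ⊗-congʳ {x} {x′} y x≋ = close⇒≋ {x ⊗ y} {x′ ⊗ y} λ e 0<e →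
      let b , bnd = bounded {seq y} (cauchy y)
          d , 0<d , bd≤e = shrink b e 0<e
      in ev-map₂ bnd (≋⇒close x≋ d 0<d) λ n ∣y∣≤b ∣-∣≤d → begin
        ℚ.∣ seq x n ℚ.* seq y n ℚ.- seq x′ n ℚ.* seq y n ∣  ≡⟨ cong ℚ.∣_∣ (lem (seq x n) (seq x′ n) (seq y n)) ⟩
        ℚ.∣ seq y n ℚ.* (seq x n ℚ.- seq x′ n) ∣            ≡⟨ ℚₚ.∣p*q∣≡∣p∣*∣q∣ (seq y n) _ ⟩
        ℚ.∣ seq y n ∣ ℚ.* ℚ.∣ seq x n ℚ.- seq x′ n ∣
          ≤⟨ *-mono (/1-nonneg b) (ℚₚ.0≤∣p∣ (seq x n ℚ.- seq x′ n)) ∣y∣≤b ∣-∣≤d ⟩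
        b /1 ℚ.* d                                          ≤⟨ bd≤e ⟩
        e                                                   ∎
      where
      open ℚₚ.≤-Reasoning
      lem : ∀ a b y → a ℚ.* y ℚ.- b ℚ.* y ≡ y ℚ.* (a ℚ.- b)
      lem = solve-∀ ring

    nonneg-⊗ : ∀ {x y} → ι 0ℚ ⊑ x → ι 0ℚ ⊑ y → ι 0ℚ ⊑ x ⊗ y
    nonneg-⊗ {x} {y} (wrap f) (wrap g) = wrap λ e 0<e →
      let B , bnd = common-bound x y
          d , 0<d , Bd≤e = shrink B e 0<e
      in ev-map₂ bnd (ev-map₂ (f d 0<d) (g d 0<d) λ n p q → p , q) λ n (u , v) (p , q) →
        ℚₚ.≤-trans (almost-nonneg-* (ℚₚ.<⇒≤ 0<d) u v p q) (ℚₚ.+-monoʳ-≤ (seq x n ℚ.* seq y n) Bd≤e)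

    square-nonneg-⊗ : ∀ x → ι 0ℚ ⊑ x ⊗ x
    square-nonneg-⊗ x = ⊑-pointwise {ι 0ℚ} {x ⊗ x} λ n → square-nonneg (seq x n)

    ⊕-comm : ∀ x y → x ⊕ y ≋ y ⊕ x
    ⊕-comm x y = ≋-pointwise {x ⊕ y} {y ⊕ x} λ n → ℚₚ.+-comm (seq x n) (seq y n)

    ⊕-assoc : ∀ x y z → x ⊕ y ⊕ z ≋ x ⊕ (y ⊕ z)
    ⊕-assoc x y z = ≋-pointwise {x ⊕ y ⊕ z} {x ⊕ (y ⊕ z)} λ n → ℚₚ.+-assoc (seq x n) (seq y n) (seq z n)

    ⊕-identityˡ : ∀ x → ι 0ℚ ⊕ x ≋ x
    ⊕-identityˡ x = ≋-pointwise {ι 0ℚ ⊕ x} {x} λ n → ℚₚ.+-identityˡ (seq x n)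

    ⊕-inverseʳ : ∀ x → x ⊕ ⊝ x ≋ ι 0ℚ
    ⊕-inverseʳ x = ≋-pointwise {x ⊕ ⊝ x} {ι 0ℚ} λ n → ℚₚ.+-inverseʳ (seq x n)

    ⊗-comm : ∀ x y → x ⊗ y ≋ y ⊗ x
    ⊗-comm x y = ≋-pointwise {x ⊗ y} {y ⊗ x} λ n → ℚₚ.*-comm (seq x n) (seq y n)

    ⊗-assoc : ∀ x y z → x ⊗ y ⊗ z ≋ x ⊗ (y ⊗ z)
    ⊗-assoc x y z = ≋-pointwise {x ⊗ y ⊗ z} {x ⊗ (y ⊗ z)} λ n → ℚₚ.*-assoc (seq x n) (seq y n) (seq z n)

    ⊗-identityˡ : ∀ x → ι 1ℚ ⊗ x ≋ x
    ⊗-identityˡ x = ≋-pointwise {ι 1ℚ ⊗ x} {x} λ n → ℚₚ.*-identityˡ (seq x n)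

    ⊗-distribˡ-⊕ : ∀ x y z → x ⊗ (y ⊕ z) ≋ x ⊗ y ⊕ x ⊗ z
    ⊗-distribˡ-⊕ x y z = ≋-pointwise {x ⊗ (y ⊕ z)} {x ⊗ y ⊕ x ⊗ z} λ n →
      ℚₚ.*-distribˡ-+ (seq x n) (seq y n) (seq z n)

    ι-⊕ : ∀ p q → ι (p ℚ.+ q) ≋ ι p ⊕ ι q
    ι-⊕ p q = ≋-pointwise {ι (p ℚ.+ q)} {ι p ⊕ ι q} λ _ → refl

    ι-⊗ : ∀ p q → ι (p ℚ.* q) ≋ ι p ⊗ ι q
    ι-⊗ p q = ≋-pointwise {ι (p ℚ.* q)} {ι p ⊗ ι q} λ _ → refl

    ι-mono : ∀ {p q} → p ℚ.≤ q → ι p ⊑ ι q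
    ι-mono {p} {q} p≤q = ⊑-pointwise {ι p} {ι q} λ _ → p≤q

    ι-cancel : ∀ {p q} → ι p ⊑ ι q → p ℚ.≤ q
    ι-cancel {p} {q} (wrap f) = ℚₚ.≮⇒≥ λ q<p →
      let e , 0<e , q+e<p = half-gap q<p
          N , h = f e 0<e
      in ℚₚ.<-irrefl refl (ℚₚ.<-≤-trans q+e<p (h N ℕₚ.≤-refl))

    gap-⊕ : ∀ {x y} → x < y → ∃ λ e → 0ℚ ℚ.< e × x ⊕ ι e ⊑ y
    gap-⊕ {x} {y} (e , 0<e , h) = e , 0<e , ⊑-eventually {x ⊕ ι e} {y} h

    upper-bound : ∀ x → ∃ λ b → x ⊑ ι (b /1)
    upper-bound x = let b , h = bounded {seq x} (cauchy x) in
      b , ⊑-eventually {x} {ι (b /1)} (ev-map h λ n le → ℚₚ.≤-trans (p≤∣p∣ (seq x n)) le)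

    ⊑-from-ε : ∀ {x y} → (∀ e → 0ℚ ℚ.< e → x ⊑ y ⊕ ι e) → x ⊑ y
    ⊑-from-ε {x} {y} h = wrap λ e 0<e →
      ev-map (_⊑_.unwrap (h (e ℚ.* ½) (½-pos 0<e)) (e ℚ.* ½) (½-pos 0<e)) λ n le →
        ℚₚ.≤-trans le (ℚₚ.≤-reflexive (trans (ℚₚ.+-assoc (seq y n) _ _) (cong (λ w → seq y n ℚ.+ w) (½+½ e))))

    -- Used in both orders, the one-sided hypothesis bounds |q m - q n| by the larger of r m and r
    -- n, so `q` itself is a Cauchy sequence for the limit.
    limit : (q r : ℕ → ℚ) → (∀ m → 0ℚ ℚ.≤ r m) →
      (∀ e → 0ℚ ℚ.< e → ∃ λ M → ∀ m → M ℕ.≤ m → r m ℚ.≤ e) →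
      (∀ m n → q m ℚ.≤ q n ℚ.+ r n) → ∃ λ l → ∀ m → ι (q m) ⊑ l × l ⊑ ι (q m) ⊕ ι (r m)
    limit q r 0≤r r→0 h = l , λ m →
        wrap (λ e 0<e → let M , s = r→0 e 0<e in
               M , λ n M≤n → ℚₚ.≤-trans (h m n) (ℚₚ.+-monoʳ-≤ (q n) (s n M≤n)))
      , ⊑-pointwise {l} {ι (q m) ⊕ ι (r m)} (λ n → h n m)
      where
      l : ℝ
      l = mkℝ q λ e 0<e → let M , s = r→0 e 0<e in
        M , λ m n M≤m M≤n → ∣-∣≤
          (ℚₚ.≤-trans (h m n) (ℚₚ.+-monoʳ-≤ (q n) (s n M≤n)))
          (ℚₚ.≤-trans (h n m) (ℚₚ.+-monoʳ-≤ (q m) (s m M≤m)))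

    E-cong : ∀ {x y} → x ≋ y → E x ≋ E y
    E-cong {x} {y} x≋y = close⇒≋ {E x} {E y} λ e 0<e →
      let B , bnd = common-bound x y
          c , hc = ExpLemmas.sum-bound B
          d , 0<d , cd≤e = shrink c e 0<e
      -- The Lipschitz estimate is stated for partial sums at successors, hence the shift of the
      -- index.
      in ev-shift (ev-map₂ (ev-suc bnd) (ev-map₂ (ev-suc (≋⇒close x≋y d 0<d)) (B ℕ.+ B , λ n → id′) λ n p q → p , q)
           λ n (u , v) (p , 2B≤n) → bound {B} {seq x (suc n)} {seq y (suc n)} c d e hc 0<d cd≤e u v p n 2B≤n)
      where
      open ℚₚ.≤-Reasoning
      id′ : ∀ {A : Set} → A → A
      id′ a = a
      bound : ∀ {B a b} c d e → (∀ n → B ℕ.+ B ℕ.≤ n → expSum (B /1) n ℚ.+ expTerm (B /1) n ℚ.≤ c /1) →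
        0ℚ ℚ.< d → c /1 ℚ.* d ℚ.≤ e → ℚ.∣ a ∣ ℚ.≤ B /1 → ℚ.∣ b ∣ ℚ.≤ B /1 → ℚ.∣ a ℚ.- b ∣ ℚ.≤ d →
        ∀ n → B ℕ.+ B ℕ.≤ n → ℚ.∣ expSum a (suc n) ℚ.- expSum b (suc n) ∣ ℚ.≤ e
      bound {B} {a} {b} c d e hc 0<d cd≤e u v p n 2B≤n = begin
        ℚ.∣ expSum a (suc n) ℚ.- expSum b (suc n) ∣ ≤⟨ ExpLemmas.sum-lipschitz u v n ⟩
        ℚ.∣ a ℚ.- b ∣ ℚ.* expSum (B /1) n
          ≤⟨ *-mono (ℚₚ.<⇒≤ 0<d) (ExpLemmas.sum-nonneg (/1-nonneg B) n) p
               (ℚₚ.≤-trans (subst (ℚ._≤ expSum (B /1) n ℚ.+ expTerm (B /1) n) (ℚₚ.+-identityʳ _)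
                  (ℚₚ.+-monoʳ-≤ (expSum (B /1) n) (ExpLemmas.term-nonneg (/1-nonneg B) n))) (hc n 2B≤n)) ⟩
        d ℚ.* c /1                                ≡⟨ ℚₚ.*-comm d (c /1) ⟩
        c /1 ℚ.* d                                ≤⟨ cd≤e ⟩
        e                                           ∎

    E-⊕ : ∀ x y → E (x ⊕ y) ≋ E x ⊗ E y
    E-⊕ x y = ≋-sym (close⇒≋ {E x ⊗ E y} {E (x ⊕ y)} λ e 0<e →
      let B , bnd = common-bound x y
          N , h = tail-small (B ℕ.+ B) e 0<e
      in ev-map₂ bnd (N , h) λ n (u , v) t → bound {seq x n} {seq y n} B e u v n (t n))
      where
      open ℚₚ.≤-Reasoning
      bound : ∀ {a b} B e → ℚ.∣ a ∣ ℚ.≤ B /1 → ℚ.∣ b ∣ ℚ.≤ B /1 →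
        ∀ n → expSum ((B ℕ.+ B) /1) (n ℕ.+ n) ℚ.- expSum ((B ℕ.+ B) /1) n ℚ.≤ e →
        ℚ.∣ expSum a n ℚ.* expSum b n ℚ.- expSum (a ℚ.+ b) n ∣ ℚ.≤ e
      bound {a} {b} B e u v n t = begin
        ℚ.∣ expSum a n ℚ.* expSum b n ℚ.- expSum (a ℚ.+ b) n ∣  ≤⟨ sum-+-bound u v n ⟩
        expSum (B /1 ℚ.+ B /1) (n ℕ.+ n) ℚ.- expSum (B /1 ℚ.+ B /1) n
          ≡⟨ cong (λ c → expSum c (n ℕ.+ n) ℚ.- expSum c n) (/1-+ B B) ⟨
        expSum ((B ℕ.+ B) /1) (n ℕ.+ n) ℚ.- expSum ((B ℕ.+ B) /1) n  ≤⟨ t ⟩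
        e ∎

    1⊕⊑E : ∀ {z} → ι 0ℚ ⊑ z → ι 1ℚ ⊕ z ⊑ E z
    1⊕⊑E {z} (wrap f) = wrap λ e 0<e →
      let M , s = recip-small (3 /1) e 0<e
          d = + 1 ℚ./ suc M
      in ev-shift (ev-map (ev-suc (f d (recip-pos M))) λ n 0≤ →
           ℚₚ.≤-trans (sum≥1+-approx n (recip-nonneg M) (recip≤1 M) 0≤)
             (ℚₚ.+-monoʳ-≤ (expSum (seq z (suc n)) (suc n)) (s M ℕₚ.≤-refl)))

    E-ι-upper : ∀ r → 0ℚ ℚ.≤ r → r ℚ.≤ 1ℚ → E (ι r) ⊑ ι (1ℚ ℚ.+ 3 /1 ℚ.* r)
    E-ι-upper r 0≤r r≤1 = ⊑-eventually {E (ι r)} {ι (1ℚ ℚ.+ 3 /1 ℚ.* r)}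
      (ev-shift (0 , λ n _ → sum≤1+3 n 0≤r r≤1))

    E-0 : E (ι 0ℚ) ≋ ι 1ℚ
    E-0 = ≋-pointwise {E (ι 0ℚ)} {ι 1ℚ} exp-0

  module _ (lem : ExcludedMiddle 0ℓ) where
    -- Failure of the order gives an e such that x exceeds y + e at arbitrarily large indices.
    -- Choosing d with 3 d ≤ e, one such index beyond both Cauchy moduli keeps y + d below x from
    -- the moduli on.
    ⋢⇒> : ∀ {x y} → ¬ (x ⊑ y) → y < x
    ⋢⇒> {x} {y} h =
      let e , p = ¬∀⇒∃¬ lem (λ f → h (wrap f))
          0<e , q = ¬→ p
          d , 0<d , 3d≤e = shrink 3 e 0<e
          M , f = cauchy x d 0<d
          N , g = cauchy y d 0<d
          n , K≤n , r = often q (M ℕ.⊔ N)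
      in d , 0<d , M ℕ.⊔ N , λ k K≤k →
           gap {seq x n} {seq x k} {seq y n} {seq y k} 3d≤e
             (∣-∣≤⇒≤ {seq x n} {seq x k} {d} (f n k (ℕₚ.m⊔n≤o⇒m≤o M N K≤n) (ℕₚ.m⊔n≤o⇒m≤o M N K≤k)))
             (∣-∣≤⇒≤′ {seq y n} {seq y k} {d} (g n k (ℕₚ.m⊔n≤o⇒n≤o M N K≤n) (ℕₚ.m⊔n≤o⇒n≤o M N K≤k)))
             (ℚₚ.<⇒≤ (ℚₚ.≰⇒> r))
      where
      ¬→ : ∀ {A B : Set} → ¬ (A → B) → A × ¬ B
      ¬→ h = decidable-stable lem (λ ¬a → h λ a → ⊥-elim (¬a a)) , λ b → h λ _ → b
      often : ∀ {P : ℕ → Set} → ¬ Eventually P → ∀ K → ∃ λ n → K ℕ.≤ n × ¬ P n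
      often h K = let n , p = ¬∀⇒∃¬ lem (λ f → h (K , f)) in n , ¬→ p
      gap : ∀ {xn xk yn yk d e} → 3 /1 ℚ.* d ℚ.≤ e → xn ℚ.≤ xk ℚ.+ d → yk ℚ.≤ yn ℚ.+ d →
            yn ℚ.+ e ℚ.≤ xn → yk ℚ.+ d ℚ.≤ xk
      gap {xn} {xk} {yn} {yk} {d} {e} 3d≤e p q r = begin
        yk ℚ.+ d                       ≤⟨ ℚₚ.+-monoˡ-≤ d q ⟩
        yn ℚ.+ d ℚ.+ d                 ≡⟨ lem₁ yn d ⟩
        yn ℚ.+ three d ℚ.- d           ≡⟨ cong (λ w → yn ℚ.+ w ℚ.- d) (three≡ d) ⟩
        yn ℚ.+ 3 /1 ℚ.* d ℚ.- d        ≤⟨ ℚₚ.+-monoˡ-≤ (ℚ.- d) (ℚₚ.+-monoʳ-≤ yn 3d≤e) ⟩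
        yn ℚ.+ e ℚ.- d                 ≤⟨ ℚₚ.+-monoˡ-≤ (ℚ.- d) (ℚₚ.≤-trans r p) ⟩
        xk ℚ.+ d ℚ.- d                 ≡⟨ lem₂ xk d ⟩
        xk                             ∎
        where
        open ℚₚ.≤-Reasoning
        three : ℚ → ℚ
        three d = d ℚ.+ d ℚ.+ d
        lem₁ : ∀ y d → y ℚ.+ d ℚ.+ d ≡ y ℚ.+ (d ℚ.+ d ℚ.+ d) ℚ.- d
        lem₁ = solve-∀ ring
        lem₂ : ∀ y d → y ℚ.+ d ℚ.- d ≡ y
        lem₂ = solve-∀ ring
        three≡ : ∀ d → d ℚ.+ d ℚ.+ d ≡ 3 /1 ℚ.* d
        three≡ d = sym (trans (cong (ℚ._* d) (trans (/1-+ 2 1) (cong (ℚ._+ 1 /1) (/1-+ 1 1))))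
          (dist d))
          where
          dist : ∀ d → (1ℚ ℚ.+ 1ℚ ℚ.+ 1ℚ) ℚ.* d ≡ d ℚ.+ d ℚ.+ d
          dist = solve-∀ ring

open RealOrder

-- The ring of reals, monotonicity of exp, logarithms and inverses

module RealExp where
  open RationalLemmas using (/1-mono; /1-nonneg; /1-suc; recip; recip-nonneg; ceiling)

  ⊕-cong : ∀ {x x′ y y′} → x ≋ x′ → y ≋ y′ → x ⊕ y ≋ x′ ⊕ y′
  ⊕-cong (a ∧ b) (c ∧ d) = ⊕-mono a c ∧ ⊕-mono b d

  ⊗-congˡ : ∀ {x x′} y → x ≋ x′ → y ⊗ x ≋ y ⊗ x′
  ⊗-congˡ {x} {x′} y p = ≋-trans (⊗-comm y x) (≋-trans (⊗-congʳ y p) (⊗-comm x′ y))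

  ⊗-cong : ∀ {x x′ y y′} → x ≋ x′ → y ≋ y′ → x ⊗ y ≋ x′ ⊗ y′
  ⊗-cong {x} {x′} {y} {y′} p q = ≋-trans (⊗-congʳ y p) (⊗-congˡ x′ q)

  ⊗-distribʳ-⊕ : ∀ z x y → (x ⊕ y) ⊗ z ≋ x ⊗ z ⊕ y ⊗ z
  ⊗-distribʳ-⊕ z x y = ≋-trans (⊗-comm (x ⊕ y) z)
    (≋-trans (⊗-distribˡ-⊕ z x y) (⊕-cong (⊗-comm z x) (⊗-comm z y)))

  ⊕-cancelˡ : ∀ {x y z} → x ⊕ y ≋ x ⊕ z → y ≋ z
  ⊕-cancelˡ {x} {y} {z} p = ≋-trans (≋-sym (strip y)) (≋-trans (⊕-cong (≋-refl {⊝ x}) p) (strip z))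
    where
    strip : ∀ w → ⊝ x ⊕ (x ⊕ w) ≋ w
    strip w = ≋-trans (≋-sym (⊕-assoc (⊝ x) x w))
      (≋-trans (⊕-cong (≋-trans (⊕-comm (⊝ x) x) (⊕-inverseʳ x)) ≋-refl) (⊕-identityˡ w))

  ⊝-cong : ∀ {x y} → x ≋ y → ⊝ x ≋ ⊝ y
  ⊝-cong {x} {y} p = ⊕-cancelˡ {x} (≋-trans (⊕-inverseʳ x)
    (≋-trans (≋-sym (⊕-inverseʳ y)) (⊕-cong (≋-sym p) ≋-refl)))

  ℝ-commutativeRing : CommutativeRing 0ℓ 0ℓ
  ℝ-commutativeRing = record
    { Carrier = ℝ ; _≈_ = _≋_ ; _+_ = _⊕_ ; _*_ = _⊗_ ; -_ = ⊝_ ; 0# = ι 0ℚ ; 1# = ι 1ℚ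
    ; isCommutativeRing = record
      { isRing = record
        { +-isAbelianGroup = record
          { isGroup = record
            { isMonoid = record
              { isSemigroup = record
                { isMagma = record
                  { isEquivalence = record { refl = ≋-refl ; sym = ≋-sym ; trans = ≋-trans }
                  ; ∙-cong = ⊕-cong }
                ; assoc = ⊕-assoc }
              ; identity = ⊕-identityˡ , λ x → ≋-trans (⊕-comm x (ι 0ℚ)) (⊕-identityˡ x) }
            ; inverse = (λ x → ≋-trans (⊕-comm (⊝ x) x) (⊕-inverseʳ x)) , ⊕-inverseʳ
            ; ⁻¹-cong = ⊝-cong }
          ; comm = ⊕-comm }
        ; *-cong = ⊗-cong
        ; *-assoc = ⊗-assoc
        ; *-identity = ⊗-identityˡ , λ x → ≋-trans (⊗-comm x (ι 1ℚ)) (⊗-identityˡ x)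
        ; distrib = ⊗-distribˡ-⊕ , ⊗-distribʳ-⊕ }
      ; *-comm = ⊗-comm } }

  ι-⊝ : ∀ p → ι (ℚ.- p) ≋ ⊝ ι p
  ι-⊝ p = ⊕-cancelˡ {ι p} (≋-trans (≋-sym (ι-⊕ p (ℚ.- p)))
    (≋-trans (subst (λ w → ι w ≋ ι 0ℚ) (sym (ℚₚ.+-inverseʳ p)) ≋-refl) (≋-sym (⊕-inverseʳ (ι p)))))

  ι-homomorphism : ℚ.+-*-rawRing -Raw-AlmostCommutative⟶ fromCommutativeRing ℝ-commutativeRing
  ι-homomorphism = record
    { ⟦_⟧ = ι ; +-homo = ι-⊕ ; *-homo = ι-⊗ ; -‿homo = ι-⊝ ; 0-homo = ≋-refl ; 1-homo = ≋-refl }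

  ι-≡ : ∀ {p q} → p ≡ q → ι p ≋ ι q
  ι-≡ refl = ≋-refl

  ι-≟ : ∀ p q → Maybe.Maybe (ι p ≋ ι q)
  ι-≟ p q = Maybe.map ι-≡ (dec⇒maybe (p ℚₚ.≟ q))

  module ℝ-Solver = RingSolver ℚ.+-*-rawRing (fromCommutativeRing ℝ-commutativeRing) ι-homomorphism
    ι-≟
  open ℝ-Solver using (solve; _:=_; _:+_; _:*_; :-_; con)

  infix 9 #_

  abstract
    #_ : ℕ → ℝ
    # n = ι (n /1)

    #≡ι : ∀ n → # n ≡ ι (n /1)
    #≡ι n = refl

    #0≡ : # 0 ≡ ι 0ℚ
    #0≡ = refl

    #1≡ : # 1 ≡ ι 1ℚ
    #1≡ = refl

    #-mono : ∀ {m n} → m ℕ.≤ n → # m ⊑ # n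
    #-mono m≤n = ι-mono (/1-mono m≤n)

    #-cancel : ∀ {m n} → # m ⊑ # n → m ℕ.≤ n
    #-cancel {m} {n} h = ℕₚ.≮⇒≥ λ n<m → ℚₚ.<-irrefl refl (begin-strict
      n /1            ≡⟨ ℚₚ.+-identityʳ (n /1) ⟨
      n /1 ℚ.+ 0ℚ     <⟨ ℚₚ.+-monoʳ-< (n /1) (ℚₚ.positive⁻¹ 1ℚ) ⟩
      n /1 ℚ.+ 1ℚ     ≡⟨ /1-suc n ⟨
      suc n /1        ≤⟨ /1-mono n<m ⟩
      m /1            ≤⟨ ι-cancel h ⟩
      n /1            ∎)
      where open ℚₚ.≤-Reasoning

    #-+ : ∀ m n → # (m ℕ.+ n) ≋ # m ⊕ # n
    #-+ m n = subst (λ w → ι w ≋ # m ⊕ # n) (sym (/1-+ m n)) (ι-⊕ (m /1) (n /1))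

    #-* : ∀ m n → # (m ℕ.* n) ≋ # m ⊗ # n
    #-* m n = subst (λ w → ι w ≋ # m ⊗ # n) (sym (/1-* m n)) (ι-⊗ (m /1) (n /1))

    -- 1 + 3 from `E-ι-upper`. This crude bound for e is the base 4 in the final inequality between
    -- natural numbers.
    E-1 : E (# 1) ⊑ # 4
    E-1 = ⊑-trans (E-ι-upper 1ℚ (/1-nonneg 1) ℚₚ.≤-refl)
      (ι-mono (ℚₚ.≤-reflexive (trans (cong (1ℚ ℚ.+_) (ℚₚ.*-identityʳ (3 /1))) (sym (/1-+ 1 3)))))

    E-#0 : E (# 0) ≋ # 1
    E-#0 = E-0

    ⊕-identity# : ∀ x → # 0 ⊕ x ≋ x
    ⊕-identity# = ⊕-identityˡ

    ⊗-identity# : ∀ x → # 1 ⊗ x ≋ x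
    ⊗-identity# = ⊗-identityˡ

    ⊕-inverse# : ∀ x → x ⊕ ⊝ x ≋ # 0
    ⊕-inverse# = ⊕-inverseʳ

    0⊑⊗ : ∀ {x y} → # 0 ⊑ x → # 0 ⊑ y → # 0 ⊑ x ⊗ y
    0⊑⊗ = nonneg-⊗

    0⊑square : ∀ x → # 0 ⊑ x ⊗ x
    0⊑square = square-nonneg-⊗

    1⊕⊑E# : ∀ {z} → # 0 ⊑ z → # 1 ⊕ z ⊑ E z
    1⊕⊑E# = 1⊕⊑E

    upper-bound# : ∀ x → ∃ λ b → x ⊑ # b
    upper-bound# = upper-bound

    ι-nonneg : ∀ {q} → 0ℚ ℚ.≤ q → # 0 ⊑ ι q
    ι-nonneg = ι-mono

    ι-pos : ∀ {q} → ι q ⊑ # 0 → q ℚ.≤ 0ℚ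
    ι-pos = ι-cancel

  0⊑# : ∀ n → # 0 ⊑ # n
  0⊑# n = #-mono ℕ.z≤n

  difference-nonneg : ∀ {x y} → x ⊑ y → # 0 ⊑ y ⊕ ⊝ x
  difference-nonneg {x} {y} x⊑y = ⊑-trans (above (⊕-inverse# x)) (⊕-mono x⊑y ⊑-refl)

  difference-⊕ : ∀ x y → (y ⊕ ⊝ x) ⊕ x ≋ y
  difference-⊕ x y = begin-equality
    (y ⊕ ⊝ x) ⊕ x   ≈⟨ ⊕-assoc y (⊝ x) x ⟩
    y ⊕ (⊝ x ⊕ x)   ≈⟨ ⊕-cong ≋-refl (≋-trans (⊕-comm (⊝ x) x) (⊕-inverse# x)) ⟩
    y ⊕ # 0         ≈⟨ ⊕-comm y (# 0) ⟩
    # 0 ⊕ y         ≈⟨ ⊕-identity# y ⟩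
    y               ∎
    where open ℝ-Reasoning

  ⊗-monoʳ : ∀ {x x′} y → # 0 ⊑ y → x ⊑ x′ → x ⊗ y ⊑ x′ ⊗ y
  ⊗-monoʳ {x} {x′} y 0⊑y x⊑x′ = begin
    x ⊗ y                           ≈⟨ ⊕-identity# (x ⊗ y) ⟨
    # 0 ⊕ x ⊗ y                     ≲⟨ ⊕-mono (0⊑⊗ (difference-nonneg x⊑x′) 0⊑y) ⊑-refl ⟩
    (x′ ⊕ ⊝ x) ⊗ y ⊕ x ⊗ y          ≈⟨ ⊗-distribʳ-⊕ y (x′ ⊕ ⊝ x) x ⟨
    ((x′ ⊕ ⊝ x) ⊕ x) ⊗ y            ≈⟨ ⊗-congʳ y (difference-⊕ x x′) ⟩
    x′ ⊗ y                          ∎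
    where open ℝ-Reasoning

  ⊗-monoˡ : ∀ {x x′} y → # 0 ⊑ y → x ⊑ x′ → y ⊗ x ⊑ y ⊗ x′
  ⊗-monoˡ {x} {x′} y 0⊑y p = ⊑-trans (below (⊗-comm y x)) (⊑-trans (⊗-monoʳ y 0⊑y p) (below (⊗-comm x′ y)))

  ⊗-mono : ∀ {x x′ y y′} → # 0 ⊑ x′ → # 0 ⊑ y → x ⊑ x′ → y ⊑ y′ → x ⊗ y ⊑ x′ ⊗ y′
  ⊗-mono {x} {x′} {y} {y′} 0⊑x′ 0⊑y p q = ⊑-trans (⊗-monoʳ y 0⊑y p) (⊗-monoˡ x′ 0⊑x′ q)

  ⊗-identity#ʳ : ∀ x → x ⊗ # 1 ≋ x
  ⊗-identity#ʳ x = ≋-trans (⊗-comm x (# 1)) (⊗-identity# x)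

  -- Partial sums at negative arguments can be negative, so the sign is read off from E x as the
  -- square of E (x / 2).
  0⊑E : ∀ x → # 0 ⊑ E x
  0⊑E x = begin
    # 0                       ≲⟨ 0⊑square (E (ι ½ ⊗ x)) ⟩
    E (ι ½ ⊗ x) ⊗ E (ι ½ ⊗ x) ≈⟨ E-⊕ (ι ½ ⊗ x) (ι ½ ⊗ x) ⟨
    E (ι ½ ⊗ x ⊕ ι ½ ⊗ x)     ≈⟨ E-cong halves ⟩
    E x                       ∎
    where
    open ℝ-Reasoning
    halves : ι ½ ⊗ x ⊕ ι ½ ⊗ x ≋ x
    halves = begin-equality
      ι ½ ⊗ x ⊕ ι ½ ⊗ x     ≈⟨ ⊗-distribʳ-⊕ x (ι ½) (ι ½) ⟨
      (ι ½ ⊕ ι ½) ⊗ x       ≈⟨ ⊗-congʳ x (ι-⊕ ½ ½) ⟨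
      ι (½ ℚ.+ ½) ⊗ x       ≡⟨ cong (_⊗ x) (sym #1≡) ⟩
      # 1 ⊗ x               ≈⟨ ⊗-identity# x ⟩
      x                     ∎

  1⊑E : ∀ {z} → # 0 ⊑ z → # 1 ⊑ E z
  1⊑E {z} 0⊑z = begin
    # 1          ≈⟨ ⊕-identity# (# 1) ⟨
    # 0 ⊕ # 1    ≈⟨ ⊕-comm (# 0) (# 1) ⟩
    # 1 ⊕ # 0    ≲⟨ ⊕-mono ⊑-refl 0⊑z ⟩
    # 1 ⊕ z      ≲⟨ 1⊕⊑E# 0⊑z ⟩
    E z          ∎
    where open ℝ-Reasoning

  E-mono : ∀ {x y} → x ⊑ y → E x ⊑ E y
  E-mono {x} {y} x⊑y = begin
    E x                     ≈⟨ ⊗-identity# (E x) ⟨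
    # 1 ⊗ E x               ≲⟨ ⊗-monoʳ (E x) (0⊑E x) (1⊑E (difference-nonneg x⊑y)) ⟩
    E (y ⊕ ⊝ x) ⊗ E x       ≈⟨ E-⊕ (y ⊕ ⊝ x) x ⟨
    E ((y ⊕ ⊝ x) ⊕ x)       ≈⟨ E-cong (difference-⊕ x y) ⟩
    E y                     ∎
    where open ℝ-Reasoning

  E-inverse : ∀ x → E x ⊗ E (⊝ x) ≋ # 1
  E-inverse x = ≋-trans (≋-sym (E-⊕ x (⊝ x))) (≋-trans (E-cong (⊕-inverse# x)) E-#0)

  E-#-upper : ∀ k → E (# k) ⊑ # (4 ℕ.^ k)
  E-#-upper zero = below E-#0
  E-#-upper (suc k) = begin
    E (# (1 ℕ.+ k))       ≈⟨ E-cong (#-+ 1 k) ⟩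
    E (# 1 ⊕ # k)         ≈⟨ E-⊕ (# 1) (# k) ⟩
    E (# 1) ⊗ E (# k)     ≲⟨ ⊗-mono (0⊑# 4) (0⊑E (# k)) E-1 (E-#-upper k) ⟩
    # 4 ⊗ # (4 ℕ.^ k)     ≈⟨ #-* 4 (4 ℕ.^ k) ⟨
    # (4 ℕ.* 4 ℕ.^ k)     ∎
    where open ℝ-Reasoning

  E-#⊗ : ∀ k l → ∀ N → E l ≋ # N → E (# k ⊗ l) ≋ # (N ℕ.^ k)
  E-#⊗ zero l N _ = ≋-trans (E-cong (begin-equality
      # 0 ⊗ l                       ≡⟨ cong (_⊗ l) #0≡ ⟩
      ι 0ℚ ⊗ l                      ≈⟨ solve 1 (λ l → con 0ℚ :* l := con 0ℚ) ≋-refl l ⟩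
      ι 0ℚ                          ≡⟨ #0≡ ⟨
      # 0                           ∎)) E-#0
    where open ℝ-Reasoning
  E-#⊗ (suc k) l N E≋ = begin-equality
    E (# (1 ℕ.+ k) ⊗ l)       ≈⟨ E-cong (⊗-congʳ l (#-+ 1 k)) ⟩
    E ((# 1 ⊕ # k) ⊗ l)       ≈⟨ E-cong (⊗-distribʳ-⊕ l (# 1) (# k)) ⟩
    E (# 1 ⊗ l ⊕ # k ⊗ l)     ≈⟨ E-⊕ (# 1 ⊗ l) (# k ⊗ l) ⟩
    E (# 1 ⊗ l) ⊗ E (# k ⊗ l) ≈⟨ ⊗-cong (≋-trans (E-cong (⊗-identity# l)) E≋) (E-#⊗ k l N E≋) ⟩
    # N ⊗ # (N ℕ.^ k)         ≈⟨ #-* N (N ℕ.^ k) ⟨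
    # (N ℕ.* N ℕ.^ k)         ∎
    where open ℝ-Reasoning

  -- The factors tend to 1 and `v` has an upper bound, so the excess falls below any e.
  squeeze : ∀ {u v} → (∀ m → u ⊑ v ⊗ ι (1ℚ ℚ.+ 3 /1 ℚ.* (+ 1 ℚ./ suc m))) → u ⊑ v
  squeeze {u} {v} h = ⊑-from-ε λ e 0<e →
    let b , v⊑b = upper-bound# v
        M , s = recip-small (b /1 ℚ.* 3 /1) e 0<e
    in step e b M v⊑b (s M ℕₚ.≤-refl)
    where
    open ℝ-Reasoning
    step : ∀ e b M → v ⊑ # b → (b /1 ℚ.* 3 /1) ℚ.* (+ 1 ℚ./ suc M) ℚ.≤ e → u ⊑ v ⊕ ι e
    step e b M v⊑b s = begin
      u                          ≲⟨ h M ⟩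
      v ⊗ ι (1ℚ ℚ.+ t)           ≈⟨ ⊗-congˡ v (ι-⊕ 1ℚ t) ⟩
      v ⊗ (ι 1ℚ ⊕ ι t)           ≈⟨ ⊗-distribˡ-⊕ v (ι 1ℚ) (ι t) ⟩
      v ⊗ ι 1ℚ ⊕ v ⊗ ι t         ≈⟨ ⊕-cong (≋-trans (⊗-comm v (ι 1ℚ)) (⊗-identityˡ v)) ≋-refl ⟩
      v ⊕ v ⊗ ι t                ≲⟨ ⊕-mono ⊑-refl (⊗-monoʳ (ι t) 0⊑t v⊑b) ⟩
      v ⊕ # b ⊗ ι t              ≡⟨ cong (λ w → v ⊕ w ⊗ ι t) (#≡ι b) ⟩
      v ⊕ ι (b /1) ⊗ ι t         ≈⟨ ⊕-cong ≋-refl (ι-⊗ (b /1) t) ⟨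
      v ⊕ ι (b /1 ℚ.* t)         ≲⟨ ⊕-mono ⊑-refl (ι-mono (ℚₚ.≤-trans (ℚₚ.≤-reflexive
                                      (sym (ℚₚ.*-assoc (b /1) (3 /1) (+ 1 ℚ./ suc M)))) s)) ⟩
      v ⊕ ι e                    ∎
      where
      t : ℚ
      t = 3 /1 ℚ.* (+ 1 ℚ./ suc M)
      0⊑t : # 0 ⊑ ι t
      0⊑t = ι-nonneg (RationalLemmas.*-nonneg (/1-nonneg 3) (recip-nonneg M))

  module Logarithm (lem : ExcludedMiddle 0ℓ) where
    ⋢⇒⊒ : ∀ {x y} → ¬ (x ⊑ y) → y ⊑ x
    ⋢⇒⊒ {x} {y} h =
      let e , 0<e , p = gap-⊕ {y} {x} (⋢⇒> lem h) in
      ⊑-trans (above (≋-trans (⊕-comm y (# 0)) (⊕-identity# y)))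
        (⊑-trans (⊕-mono (⊑-refl {y}) (ι-nonneg (ℚₚ.<⇒≤ 0<e))) p)

    -- If y + e ≤ x for some e > 0, then E y · E e ≤ E x ≤ E y, and multiplying by E (-y) gives 1 +
    -- e ≤ E e ≤ 1.
    E-cancel : ∀ {x y} → E x ⊑ E y → x ⊑ y
    E-cancel {x} {y} h = decidable-stable lem λ x⋢y →
      let e , 0<e , p = gap-⊕ {y} {x} (⋢⇒> lem x⋢y) in
      ℚₚ.<-irrefl refl (ℚₚ.<-≤-trans 0<e (ι-pos (shrink-to-0 (begin
        # 1 ⊕ ι e                    ≲⟨ 1⊕⊑E# (ι-nonneg (ℚₚ.<⇒≤ 0<e)) ⟩
        E (ι e)                      ≈⟨ ⊗-identity# (E (ι e)) ⟨
        # 1 ⊗ E (ι e)                ≈⟨ ⊗-congʳ (E (ι e)) (E-inverse y) ⟨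
        (E y ⊗ E (⊝ y)) ⊗ E (ι e)    ≈⟨ rearrange (E y) (E (⊝ y)) (E (ι e)) ⟩
        (E y ⊗ E (ι e)) ⊗ E (⊝ y)    ≈⟨ ⊗-congʳ (E (⊝ y)) (E-⊕ y (ι e)) ⟨
        E (y ⊕ ι e) ⊗ E (⊝ y)        ≲⟨ ⊗-monoʳ (E (⊝ y)) (0⊑E (⊝ y)) (⊑-trans (E-mono p) h) ⟩
        E y ⊗ E (⊝ y)                ≈⟨ E-inverse y ⟩
        # 1                          ∎))))
      where
      open ℝ-Reasoning
      rearrange : ∀ a b c → a ⊗ b ⊗ c ≋ a ⊗ c ⊗ b
      rearrange = solve 3 (λ a b c → a :* b :* c := a :* c :* b) ≋-refl
      shrink-to-0 : ∀ {z} → # 1 ⊕ z ⊑ # 1 → z ⊑ # 0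
      shrink-to-0 {z} q = begin
        z                       ≈⟨ difference-⊕ (# 1) z ⟨
        (z ⊕ ⊝ # 1) ⊕ # 1       ≈⟨ ≋-trans (⊕-assoc z (⊝ # 1) (# 1)) (≋-trans (⊕-comm z _)
                                     (⊕-assoc (⊝ # 1) (# 1) z)) ⟩
        ⊝ # 1 ⊕ (# 1 ⊕ z)       ≲⟨ ⊕-mono ⊑-refl q ⟩
        ⊝ # 1 ⊕ # 1             ≈⟨ ≋-trans (⊕-comm (⊝ # 1) (# 1)) (⊕-inverse# (# 1)) ⟩
        # 0                     ∎

    -- l is the limit of q m = k/(m+1), where k is largest with exp(k/(m+1)) ≤ x.
    log-exists : ∀ x → # 1 ⊑ x → ∃ λ l → E l ≋ x
    log-exists x 1⊑x = l , (squeeze El⊑ ∧ squeeze x⊑El)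
      where
      open ℝ-Reasoning
      r : ℕ → ℚ
      r m = + 1 ℚ./ suc m
      -- The least k with P m k satisfies E (k / (m + 1)) ≤ x ≤ E ((k + 1) / (m + 1)); for k = 0 the
      -- left inequality is 1 ≤ x.
      P : ℕ → ℕ → Set
      P m k = x ⊑ E (ι (suc k /1 ℚ.* r m))
      exists : ∀ m → ∃ (P m)
      exists m = let b , x⊑b = upper-bound# x in b ℕ.* suc m , (begin
        x                  ≲⟨ x⊑b ⟩
        # b                ≡⟨ #≡ι b ⟩
        ι (b /1)           ≲⟨ ι-mono (bound b) ⟩
        ι (Q b)            ≈⟨ ⊕-identity# (ι (Q b)) ⟨
        # 0 ⊕ ι (Q b)      ≲⟨ ⊕-mono (0⊑# 1) ⊑-refl ⟩
        # 1 ⊕ ι (Q b)      ≲⟨ 1⊕⊑E# (ι-nonneg (ℚₚ.≤-trans (/1-nonneg b) (bound b))) ⟩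
        E (ι (Q b))        ∎)
        where
        Q : ℕ → ℚ
        Q b = suc (b ℕ.* suc m) /1 ℚ.* r m
        bound : ∀ b → b /1 ℚ.≤ Q b
        bound b = ℚₚ.≤-trans (ℚₚ.≤-reflexive (sym (trans (cong (ℚ._* r m) (/1-* b (suc m)))
            (trans (ℚₚ.*-assoc (b /1) (suc m /1) (r m)) (trans (cong (b /1 ℚ.*_) (recip m)) (ℚₚ.*-identityʳ (b /1)))))))
          (RationalLemmas.*-monoʳ (recip-nonneg m) (/1-mono (ℕₚ.n≤1+n (b ℕ.* suc m))))
      k : ℕ → ℕ
      k m = proj₁ (least lem (P m) (exists m))
      q : ℕ → ℚ
      q m = k m /1 ℚ.* r m
      lower : ∀ m j → (∀ i → i ℕ.< j → ¬ P m i) → E (ι (j /1 ℚ.* r m)) ⊑ x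
      lower m zero _ = ⊑-trans (below (E-cong (subst (λ w → ι w ≋ # 0) (sym (ℚₚ.*-zeroˡ (r m)))
        (subst (_≋ # 0) #0≡ ≋-refl)))) (⊑-trans (below E-#0) 1⊑x)
      lower m (suc j) h = ⋢⇒⊒ (h j ℕₚ.≤-refl)
      Eq⊑x : ∀ m → E (ι (q m)) ⊑ x
      Eq⊑x m = lower m (k m) (proj₂ (proj₂ (least lem (P m) (exists m))))
      x⊑Eq+r : ∀ m → x ⊑ E (ι (q m ℚ.+ r m))
      x⊑Eq+r m = subst (λ w → x ⊑ E (ι w)) (trans (cong (ℚ._* r m) (/1-suc (k m)))
        (trans (ℚₚ.*-distribʳ-+ (r m) (k m /1) 1ℚ) (cong (λ w → k m /1 ℚ.* r m ℚ.+ w) (ℚₚ.*-identityˡ (r m)))))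
        (proj₁ (proj₂ (least lem (P m) (exists m))))
      r→0 : ∀ e → 0ℚ ℚ.< e → ∃ λ M → ∀ m → M ℕ.≤ m → r m ℚ.≤ e
      r→0 e 0<e = let M , s = recip-small 1ℚ e 0<e in
        M , λ m M≤m → ℚₚ.≤-trans (ℚₚ.≤-reflexive (sym (ℚₚ.*-identityˡ (r m)))) (s m M≤m)
      lim : ∃ λ l → ∀ m → ι (q m) ⊑ l × l ⊑ ι (q m) ⊕ ι (r m)
      -- E (q m) ≤ x ≤ E (q n + r n) for all m and n, and exp reflects the order.
      lim = limit q r recip-nonneg r→0 λ m n → ι-cancel (E-cancel (⊑-trans (Eq⊑x m) (x⊑Eq+r n)))
      l : ℝ
      l = proj₁ lim
      El⊑ : ∀ m → E l ⊑ x ⊗ ι (1ℚ ℚ.+ 3 /1 ℚ.* r m)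
      El⊑ m = begin
        E l                           ≲⟨ E-mono (proj₂ (proj₂ lim m)) ⟩
        E (ι (q m) ⊕ ι (r m))         ≈⟨ E-⊕ (ι (q m)) (ι (r m)) ⟩
        E (ι (q m)) ⊗ E (ι (r m))     ≲⟨ ⊗-mono (⊑-trans (0⊑# 1) 1⊑x) (0⊑E _) (Eq⊑x m)
                                           (E-ι-upper (r m) (recip-nonneg m) (recip≤1 m)) ⟩
        x ⊗ ι (1ℚ ℚ.+ 3 /1 ℚ.* r m)   ∎
      x⊑El : ∀ m → x ⊑ E l ⊗ ι (1ℚ ℚ.+ 3 /1 ℚ.* r m)
      x⊑El m = begin
        x                             ≲⟨ x⊑Eq+r m ⟩
        E (ι (q m ℚ.+ r m))           ≈⟨ E-cong (ι-⊕ (q m) (r m)) ⟩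
        E (ι (q m) ⊕ ι (r m))         ≲⟨ E-mono (⊕-mono (proj₁ (proj₂ lim m)) ⊑-refl) ⟩
        E (l ⊕ ι (r m))               ≈⟨ E-⊕ l (ι (r m)) ⟩
        E l ⊗ E (ι (r m))             ≲⟨ ⊗-monoˡ (E l) (0⊑E l) (E-ι-upper (r m) (recip-nonneg m) (recip≤1 m)) ⟩
        E l ⊗ ι (1ℚ ℚ.+ 3 /1 ℚ.* r m) ∎

    -- `log-exists` starts at 1, so `x` is first scaled by a natural number k with k e ≥ 1; the
    -- inverse is k exp(-log(k x)).
    inverse-exists : ∀ x e → 0ℚ ℚ.< e → ι e ⊑ x → ∃ λ y → x ⊗ y ≋ # 1
    inverse-exists x e 0<e e⊑x =
      let k , 1≤ke = RationalLemmas.archimedean 1ℚ e 0<e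
          l , El≋ = log-exists (# k ⊗ x) (1⊑kx k 1≤ke)
      in # k ⊗ E (⊝ l) , ≋-trans (rearrange x (# k) (E (⊝ l)))
           (≋-trans (⊗-congʳ (E (⊝ l)) (≋-sym El≋)) (E-inverse l))
      where
      open ℝ-Reasoning
      rearrange : ∀ a b c → a ⊗ (b ⊗ c) ≋ b ⊗ a ⊗ c
      rearrange = solve 3 (λ a b c → a :* (b :* c) := b :* a :* c) ≋-refl
      1⊑kx : ∀ k → 1ℚ ℚ.≤ k /1 ℚ.* e → # 1 ⊑ # k ⊗ x
      1⊑kx k 1≤ke = begin
        # 1                ≡⟨ #1≡ ⟩
        ι 1ℚ               ≲⟨ ι-mono 1≤ke ⟩
        ι (k /1 ℚ.* e)     ≈⟨ ι-⊗ (k /1) e ⟩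
        ι (k /1) ⊗ ι e     ≡⟨ cong (_⊗ ι e) (#≡ι k) ⟨
        # k ⊗ ι e          ≲⟨ ⊗-monoˡ (# k) (0⊑# k) e⊑x ⟩
        # k ⊗ x            ∎

open RealExp
open ℝ-Solver using (solve; _:=_; _:+_; _:*_; :-_; con)

-- From real exponents to one inequality between natural numbers

module RealInequality (lem : ExcludedMiddle 0ℓ) where
  open RationalLemmas using (/1-mono; /1-nonneg; /1-suc; recip; recip-nonneg)
  open Logarithm lem
  open ℝ-Reasoning

  floor : ∀ z → # 0 ⊑ z → ∃ λ X → # X ⊑ z × z ⊑ # (suc X) × ∀ j → # j ⊑ z → j ℕ.≤ X
  floor z 0⊑z = let b , z⊑b = upper-bound# z in
    build (least lem (λ k → ¬ (# k ⊑ z)) (suc b , λ h → ℕₚ.<-irrefl refl (#-cancel (⊑-trans h z⊑b))))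
    where
    build : (∃ λ k → ¬ (# k ⊑ z) × ∀ m → m ℕ.< k → ¬ ¬ (# m ⊑ z)) →
            ∃ λ X → # X ⊑ z × z ⊑ # (suc X) × ∀ j → # j ⊑ z → j ℕ.≤ X
    build (zero , h , _) = ⊥-elim (h 0⊑z)
    build (suc X , h , below-k) = X , decidable-stable lem (below-k X ℕₚ.≤-refl) , ⋢⇒⊒ h
      , λ j #j⊑z → ℕₚ.≮⇒≥ λ X<j → h (⊑-trans (#-mono X<j) #j⊑z)

  ceil : ∀ z → ∃ λ L → z ⊑ # L × (∀ j → z ⊑ # j → L ℕ.≤ j) × ∀ l → L ≡ suc l → # l ⊑ z
  ceil z = build (least lem (λ k → z ⊑ # k) (upper-bound# z))
    where
    build : (∃ λ k → z ⊑ # k × ∀ m → m ℕ.< k → ¬ (z ⊑ # m)) →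
            ∃ λ L → z ⊑ # L × (∀ j → z ⊑ # j → L ℕ.≤ j) × ∀ l → L ≡ suc l → # l ⊑ z
    build (L , z⊑L , minimal) = L , z⊑L , (λ j z⊑j → ℕₚ.≮⇒≥ λ j<L → minimal j j<L z⊑j)
      , λ { l refl → ⋢⇒⊒ (minimal l ℕₚ.≤-refl) }

  ⊗-cancelʳ : ∀ m {x y} → x ⊗ # (suc m) ⊑ y ⊗ # (suc m) → x ⊑ y
  ⊗-cancelʳ m {x} {y} h = begin
    x                                      ≈⟨ scale x ⟨
    x ⊗ # (suc m) ⊗ ι (+ 1 ℚ./ suc m)      ≲⟨ ⊗-monoʳ _ (ι-nonneg (recip-nonneg m)) h ⟩
    y ⊗ # (suc m) ⊗ ι (+ 1 ℚ./ suc m)      ≈⟨ scale y ⟩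
    y                                      ∎
    where
    scale : ∀ w → w ⊗ # (suc m) ⊗ ι (+ 1 ℚ./ suc m) ≋ w
    scale w = begin-equality
      w ⊗ # (suc m) ⊗ ι (+ 1 ℚ./ suc m)        ≡⟨ cong (λ v → w ⊗ v ⊗ ι (+ 1 ℚ./ suc m)) (#≡ι (suc m)) ⟩
      w ⊗ ι (suc m /1) ⊗ ι (+ 1 ℚ./ suc m)     ≈⟨ ⊗-assoc w _ _ ⟩
      w ⊗ (ι (suc m /1) ⊗ ι (+ 1 ℚ./ suc m))   ≈⟨ ⊗-congˡ w (ι-⊗ (suc m /1) (+ 1 ℚ./ suc m)) ⟨
      w ⊗ ι (suc m /1 ℚ.* (+ 1 ℚ./ suc m))     ≡⟨ cong (λ v → w ⊗ ι v) (recip m) ⟩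
      w ⊗ ι 1ℚ                                 ≈⟨ solve 1 (λ w → w :* con 1ℚ := w) ≋-refl w ⟩
      w                                        ∎

  0⊑⊕ : ∀ {x y} → # 0 ⊑ x → # 0 ⊑ y → # 0 ⊑ x ⊕ y
  0⊑⊕ p q = ⊑-trans (above (⊕-identity# (# 0))) (⊕-mono p q)

  0⊑log : ∀ {l x} → E l ≋ x → # 1 ⊑ x → # 0 ⊑ l
  0⊑log El≋x 1⊑x = E-cancel (⊑-trans (below E-#0) (⊑-trans 1⊑x (above El≋x)))

  nonneg-inverse : ∀ {x h} → # 0 ⊑ x → x ⊗ h ≋ # 1 → # 0 ⊑ h
  nonneg-inverse {x} {h} 0⊑x xh≋1 = begin
    # 0             ≲⟨ 0⊑⊗ 0⊑x (0⊑square h) ⟩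
    x ⊗ (h ⊗ h)     ≈⟨ ⊗-assoc x h h ⟨
    x ⊗ h ⊗ h       ≈⟨ ⊗-congʳ h xh≋1 ⟩
    # 1 ⊗ h         ≈⟨ ⊗-identity# h ⟩
    h               ∎

  module Exponents (θ c ε ℓ y g : ℝ)
      (½⊑θ : ι ½ ⊑ θ) (θ⊑1 : θ ⊑ # 1) (2θ-1⊑c : ι (2 /1) ⊗ θ ⊕ ⊝ ι 1ℚ ⊑ c) (c⊑θ : c ⊑ θ)
      (0⊑ε : # 0 ⊑ ε) (0⊑ℓ : # 0 ⊑ ℓ) (Eℓ≋y : E ℓ ≋ y) (0⊑g : # 0 ⊑ g)
      (16g⊑ : ι (16 /1) ⊗ g ⊑ E (ι (2 /1) ⊗ ε ⊗ ℓ)) where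
    -- The powers y^δ, y^θ, y^c and y^(2ε), with ℓ for log y; `g` will be log N.
    δ D Eθ Ec G : ℝ
    δ = (ι (2 /1) ⊗ θ ⊕ ⊝ ι 1ℚ ⊕ ⊝ c) ⊗ ι ½ ⊕ ε
    D = E (δ ⊗ ℓ)
    Eθ = E (θ ⊗ ℓ)
    Ec = E (c ⊗ ℓ)
    G = E (ι (2 /1) ⊗ ε ⊗ ℓ)

    0⊑θ : # 0 ⊑ θ
    0⊑θ = ⊑-trans (ι-nonneg (ℚₚ.<⇒≤ (ℚₚ.positive⁻¹ ½))) ½⊑θ

    0⊑θ-½ : # 0 ⊑ θ ⊕ ⊝ ι ½
    0⊑θ-½ = difference-nonneg ½⊑θ

    0⊑c : # 0 ⊑ c
    0⊑c = begin
      # 0                              ≲⟨ 0⊑⊗ (ι-nonneg (/1-nonneg 2)) 0⊑θ-½ ⟩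
      ι (2 /1) ⊗ (θ ⊕ ⊝ ι ½)           ≈⟨ solve 1 (λ t → con (2 /1) :* (t :+ :- con ½) := con (2 /1) :* t :+ :- con 1ℚ) ≋-refl θ ⟩
      ι (2 /1) ⊗ θ ⊕ ⊝ ι 1ℚ            ≲⟨ 2θ-1⊑c ⟩
      c                                ∎

    1⊑Ec : # 1 ⊑ Ec
    1⊑Ec = 1⊑E (0⊑⊗ 0⊑c 0⊑ℓ)

    Ec⊑Eθ : Ec ⊑ Eθ
    Ec⊑Eθ = E-mono (⊗-monoʳ ℓ 0⊑ℓ c⊑θ)

    Eθ⊑y : Eθ ⊑ y
    Eθ⊑y = ⊑-trans (E-mono (⊑-trans (⊗-monoʳ ℓ 0⊑ℓ θ⊑1) (below (⊗-identity# ℓ)))) (below Eℓ≋y)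

    -- δ + c = θ - 1/2 + c/2 + ε is a sum of nonnegative terms, as c ≥ 2θ - 1 ≥ 0. This yields at
    -- least four points in the window.
    1⊑DEc : # 1 ⊑ D ⊗ Ec
    1⊑DEc = begin
      # 1                                          ≲⟨ 1⊑E (0⊑⊗ (0⊑⊕ (0⊑⊕ 0⊑θ-½ (0⊑⊗ 0⊑c (ι-nonneg (ℚₚ.<⇒≤ (ℚₚ.positive⁻¹ ½))))) 0⊑ε) 0⊑ℓ) ⟩
      E ((θ ⊕ ⊝ ι ½ ⊕ c ⊗ ι ½ ⊕ ε) ⊗ ℓ)            ≈⟨ E-cong (solve 4 (λ t c e l →
          (t :+ :- con ½ :+ c :* con ½ :+ e) :* l :=
          ((con (2 /1) :* t :+ :- con 1ℚ :+ :- c) :* con ½ :+ e) :* l :+ c :* l) ≋-refl θ c ε ℓ) ⟩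
      E (δ ⊗ ℓ ⊕ c ⊗ ℓ)                            ≈⟨ E-⊕ (δ ⊗ ℓ) (c ⊗ ℓ) ⟩
      D ⊗ Ec                                       ∎

    -- 2δ + c + 1 = 2θ + 2ε, the balance that determines the density exponent δ.
    DDEcy≋ : D ⊗ D ⊗ Ec ⊗ y ≋ Eθ ⊗ Eθ ⊗ G
    DDEcy≋ = begin-equality
      D ⊗ D ⊗ Ec ⊗ y                 ≈⟨ ⊗-congˡ (D ⊗ D ⊗ Ec) Eℓ≋y ⟨
      D ⊗ D ⊗ Ec ⊗ E ℓ               ≈⟨ ⊗-congʳ (E ℓ) (⊗-congʳ Ec (E-⊕ (δ ⊗ ℓ) (δ ⊗ ℓ))) ⟨
      E (δ ⊗ ℓ ⊕ δ ⊗ ℓ) ⊗ Ec ⊗ E ℓ   ≈⟨ ⊗-congʳ (E ℓ) (E-⊕ (δ ⊗ ℓ ⊕ δ ⊗ ℓ) (c ⊗ ℓ)) ⟨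
      E (δ ⊗ ℓ ⊕ δ ⊗ ℓ ⊕ c ⊗ ℓ) ⊗ E ℓ ≈⟨ E-⊕ (δ ⊗ ℓ ⊕ δ ⊗ ℓ ⊕ c ⊗ ℓ) ℓ ⟨
      E (δ ⊗ ℓ ⊕ δ ⊗ ℓ ⊕ c ⊗ ℓ ⊕ ℓ)  ≈⟨ E-cong (solve 4 (λ t c e l →
          let d = (con (2 /1) :* t :+ :- con 1ℚ :+ :- c) :* con ½ :+ e in
          d :* l :+ d :* l :+ c :* l :+ l := t :* l :+ t :* l :+ con (2 /1) :* e :* l) ≋-refl θ c ε ℓ) ⟩
      E (θ ⊗ ℓ ⊕ θ ⊗ ℓ ⊕ ι (2 /1) ⊗ ε ⊗ ℓ) ≈⟨ E-⊕ (θ ⊗ ℓ ⊕ θ ⊗ ℓ) (ι (2 /1) ⊗ ε ⊗ ℓ) ⟩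
      E (θ ⊗ ℓ ⊕ θ ⊗ ℓ) ⊗ G          ≈⟨ ⊗-congʳ G (E-⊕ (θ ⊗ ℓ) (θ ⊗ ℓ)) ⟩
      Eθ ⊗ Eθ ⊗ G                    ∎

    -- p^θ ≤ (2y)^θ ≤ 2 y^θ because θ ≤ 1; hence the 2 in X = ⌊2 y^θ⌋.
    prime-power-bound : ∀ l2 lp p → E l2 ≋ # 2 → E lp ≋ # p → # p ⊑ # 2 ⊗ y → E (θ ⊗ lp) ⊑ # 2 ⊗ Eθ
    prime-power-bound l2 lp p E2 Ep p⊑2y = begin
      E (θ ⊗ lp)             ≲⟨ E-mono (⊗-monoˡ θ 0⊑θ lp⊑) ⟩
      E (θ ⊗ (l2 ⊕ ℓ))       ≈⟨ E-cong (⊗-distribˡ-⊕ θ l2 ℓ) ⟩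
      E (θ ⊗ l2 ⊕ θ ⊗ ℓ)     ≲⟨ E-mono (⊕-mono (⊑-trans (⊗-monoʳ l2 0⊑l2 θ⊑1) (below (⊗-identity# l2))) ⊑-refl) ⟩
      E (l2 ⊕ θ ⊗ ℓ)         ≈⟨ E-⊕ l2 (θ ⊗ ℓ) ⟩
      E l2 ⊗ Eθ              ≈⟨ ⊗-congʳ Eθ E2 ⟩
      # 2 ⊗ Eθ               ∎
      where
      0⊑l2 : # 0 ⊑ l2
      0⊑l2 = 0⊑log E2 (#-mono (ℕ.s≤s ℕ.z≤n))
      lp⊑ : lp ⊑ l2 ⊕ ℓ
      lp⊑ = E-cancel (begin
        E lp          ≈⟨ Ep ⟩
        # p           ≲⟨ p⊑2y ⟩
        # 2 ⊗ y       ≈⟨ ⊗-cong E2 Eℓ≋y ⟨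
        E l2 ⊗ E ℓ    ≈⟨ E-⊕ l2 ℓ ⟨
        E (l2 ⊕ ℓ)    ∎)

    four≤M : ∀ M L → # 4 ⊗ D ⊗ # L ⊑ # M → Ec ⊑ # L → 4 ℕ.≤ M
    four≤M M L hM hL = #-cancel (begin
      # 4                  ≈⟨ ⊗-identity#ʳ (# 4) ⟨
      # 4 ⊗ # 1            ≲⟨ ⊗-monoˡ (# 4) (0⊑# 4) 1⊑DEc ⟩
      # 4 ⊗ (D ⊗ Ec)       ≈⟨ ⊗-assoc (# 4) D Ec ⟨
      # 4 ⊗ D ⊗ Ec         ≲⟨ ⊗-monoˡ _ (0⊑⊗ (0⊑# 4) (0⊑E _)) hL ⟩
      # 4 ⊗ D ⊗ # L        ≲⟨ hM ⟩
      # M                  ∎)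

    -- `L` places hold at most `L` points, so a density cannot exceed 1. It lets `main-inequality`
    -- drop one factor 4 D.
    4D⊑1 : ∀ m L → # 4 ⊗ D ⊗ # L ⊑ # (suc m) → suc m ℕ.≤ L → # 4 ⊗ D ⊑ # 1
    4D⊑1 m L hM M≤L = ⊗-cancelʳ m (begin
      # 4 ⊗ D ⊗ # (suc m)   ≲⟨ ⊗-monoˡ _ (0⊑⊗ (0⊑# 4) (0⊑E _)) (#-mono M≤L) ⟩
      # 4 ⊗ D ⊗ # L         ≲⟨ hM ⟩
      # (suc m)             ≈⟨ ⊗-identity# _ ⟨
      # 1 ⊗ # (suc m)       ∎)

    0⊑y : # 0 ⊑ y
    0⊑y = ⊑-trans (0⊑E ℓ) (below Eℓ≋y)

    -- (M - 1) y ≥ (3/4) M y ≥ 3 D Ec y ≥ 12 D² Ec y = 12 Eθ² G ≥ 3 X² · 16 g, using 4 D ≤ 1.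
    main-inequality : ∀ m L X → 3 ℕ.≤ m → # 4 ⊗ D ⊗ # L ⊑ # (suc m) → suc m ℕ.≤ L → Ec ⊑ # L →
      # X ⊑ # 2 ⊗ Eθ → # (192 ℕ.* (X ℕ.* X)) ⊗ g ⊑ # (4 ℕ.* m) ⊗ y
    main-inequality m L X 3≤m hM M≤L hL hX = begin
      # (192 ℕ.* (X ℕ.* X)) ⊗ g                ≈⟨ ⊗-congʳ g (≋-trans (#-* 192 (X ℕ.* X)) (⊗-congˡ (# 192) (#-* X X))) ⟩
      # 192 ⊗ (# X ⊗ # X) ⊗ g
        ≲⟨ ⊗-monoʳ g 0⊑g (⊗-monoˡ (# 192) (0⊑# 192) (⊗-mono (0⊑⊗ (0⊑# 2) (0⊑E _)) (0⊑# X) hX hX)) ⟩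
      # 192 ⊗ (# 2 ⊗ Eθ ⊗ (# 2 ⊗ Eθ)) ⊗ g
        ≡⟨ cong₂ (λ a b → a ⊗ (b ⊗ Eθ ⊗ (b ⊗ Eθ)) ⊗ g) (#≡ι 192) (#≡ι 2) ⟩
      ι (192 /1) ⊗ (ι (2 /1) ⊗ Eθ ⊗ (ι (2 /1) ⊗ Eθ)) ⊗ g
        -- 192 · 2² = 48 · 16: the 16 belongs to the lower bound for `y`, and 48 = 4 · 3 · 4 is
        -- split below.
        ≈⟨ solve 2 (λ t g → con (192 /1) :* (con (2 /1) :* t :* (con (2 /1) :* t)) :* g :=
                            con (48 /1) :* (t :* t) :* (con (16 /1) :* g)) ≋-refl Eθ g ⟩
      ι (48 /1) ⊗ (Eθ ⊗ Eθ) ⊗ (ι (16 /1) ⊗ g)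
        ≲⟨ ⊗-monoˡ _ (0⊑⊗ (ι-nonneg (/1-nonneg 48)) (0⊑square Eθ)) 16g⊑ ⟩
      ι (48 /1) ⊗ (Eθ ⊗ Eθ) ⊗ G                ≈⟨ ⊗-assoc (ι (48 /1)) (Eθ ⊗ Eθ) G ⟩
      ι (48 /1) ⊗ (Eθ ⊗ Eθ ⊗ G)                ≈⟨ ⊗-congˡ (ι (48 /1)) DDEcy≋ ⟨
      ι (48 /1) ⊗ (D ⊗ D ⊗ Ec ⊗ y)
        ≈⟨ solve 3 (λ d c y → con (48 /1) :* (d :* d :* c :* y) :=
                              con (4 /1) :* d :* (con (3 /1) :* (con (4 /1) :* d :* c) :* y)) ≋-refl D Ec y ⟩
      ι (4 /1) ⊗ D ⊗ (ι (3 /1) ⊗ (ι (4 /1) ⊗ D ⊗ Ec) ⊗ y)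
        ≡⟨ cong₂ (λ a b → a ⊗ D ⊗ (b ⊗ (a ⊗ D ⊗ Ec) ⊗ y)) (#≡ι 4) (#≡ι 3) ⟨
      # 4 ⊗ D ⊗ (# 3 ⊗ (# 4 ⊗ D ⊗ Ec) ⊗ y)
        ≲⟨ ⊗-mono (0⊑# 1) (0⊑⊗ (0⊑⊗ (0⊑# 3) (0⊑⊗ 0⊑4D (0⊑E _))) 0⊑y) (4D⊑1 m L hM M≤L)
             (⊗-monoʳ y 0⊑y (⊗-monoˡ (# 3) (0⊑# 3) (⊑-trans (⊗-monoˡ _ 0⊑4D hL) hM))) ⟩
      # 1 ⊗ (# 3 ⊗ # (suc m) ⊗ y)              ≈⟨ ⊗-identity# _ ⟩
      # 3 ⊗ # (suc m) ⊗ y                      ≈⟨ ⊗-congʳ y (#-* 3 (suc m)) ⟨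
      # (3 ℕ.* suc m) ⊗ y                      ≲⟨ ⊗-monoʳ y 0⊑y (#-mono 3M≤4m) ⟩
      # (4 ℕ.* m) ⊗ y                          ∎
      where
      0⊑4D : # 0 ⊑ # 4 ⊗ D
      0⊑4D = 0⊑⊗ (0⊑# 4) (0⊑E _)
      3M≤4m : 3 ℕ.* suc m ℕ.≤ 4 ℕ.* m
      3M≤4m = ℕₚ.≤-trans (ℕₚ.≤-reflexive (ℕₚ.*-suc 3 m)) (ℕₚ.+-monoˡ-≤ (3 ℕ.* m) 3≤m)

    -- Exponentiation turns log N into the base `N`; on the right `y` is rounded up to n + 1 and e
    -- to 4.
    power-inequality : ∀ m L X n N → 3 ℕ.≤ m → # 4 ⊗ D ⊗ # L ⊑ # (suc m) → suc m ℕ.≤ L → Ec ⊑ # L →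
      # X ⊑ # 2 ⊗ Eθ → y ⊑ # (suc n) → E g ≋ # N →
      N ℕ.^ (192 ℕ.* (X ℕ.* X)) ℕ.≤ 4 ℕ.^ (4 ℕ.* m ℕ.* suc n)
    power-inequality m L X n N 3≤m hM M≤L hL hX y⊑ Eg = #-cancel (begin
      # (N ℕ.^ (192 ℕ.* (X ℕ.* X)))       ≈⟨ E-#⊗ (192 ℕ.* (X ℕ.* X)) g N Eg ⟨
      E (# (192 ℕ.* (X ℕ.* X)) ⊗ g)       ≲⟨ E-mono (main-inequality m L X 3≤m hM M≤L hL hX) ⟩
      E (# (4 ℕ.* m) ⊗ y)                 ≲⟨ E-mono (⊗-monoˡ _ (0⊑# _) y⊑) ⟩
      E (# (4 ℕ.* m) ⊗ # (suc n))         ≈⟨ E-cong (#-* (4 ℕ.* m) (suc n)) ⟨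
      E (# (4 ℕ.* m ℕ.* suc n))           ≲⟨ E-#-upper (4 ℕ.* m ℕ.* suc n) ⟩
      # (4 ℕ.^ (4 ℕ.* m ℕ.* suc n))       ∎)

-- Translation of the hypotheses and assembly

module Interface (lem : ExcludedMiddle 0ℓ) where
  open Classical lem
  open Logarithm lem
  open RealInequality lem
  open ℝ-Reasoning

  +≡ : ∀ x y → x + y ≡ x ⊕ y
  +≡ x y = cong (λ f → f x y) (sym ⊕≡+)

  *≡ : ∀ x y → x * y ≡ x ⊗ y
  *≡ x y = cong (λ f → f x y) (sym ⊗≡*)

  -≡ : ∀ x y → x - y ≡ x ⊕ ⊝ y
  -≡ x y = trans (+≡ x (- y)) (cong (λ f → x ⊕ f y) (sym ⊝≡-))

  exp≡ : ∀ x → exp x ≡ E x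
  exp≡ x = cong (λ f → f x) (sym E≡exp)

  fromℕ≡ : ∀ n → fromℕ n ≡ ι (n /1)
  fromℕ≡ n = cong (λ f → f (n /1)) (sym ι≡fromℚ)

  fromℕ≡# : ∀ n → fromℕ n ≡ # n
  fromℕ≡# n = trans (fromℕ≡ n) (sym (#≡ι n))

  ^≡ : ∀ x s → x ^ s ≡ E (s ⊗ log x)
  ^≡ x s = trans (exp≡ (s * log x)) (cong E (*≡ s (log x)))

  to⊑ : ∀ {x y x′ y′} → x ≡ x′ → y ≡ y′ → x ≤ y → x′ ⊑ y′
  to⊑ refl refl = wrap

  from⊑ : ∀ {x y x′ y′} → x ≡ x′ → y ≡ y′ → x′ ⊑ y′ → x ≤ y
  from⊑ refl refl (wrap h) = h

  log-spec : ∀ x → # 1 ⊑ x → E (log x) ≋ x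
  log-spec x 1⊑x = let l , El≋x = log-exists x 1⊑x in
    subst (_≋ x) (exp≡ (log x)) (from≈ (pick-spec lem (λ l → exp l ≈ x) (fromℕ 0)
      (l , to≈ (subst (_≋ x) (sym (exp≡ l)) El≋x))))

  inverse-spec : ∀ x e → 0ℚ ℚ.< e → ι e ⊑ x → x ⊗ (x ⁻¹) ≋ # 1
  inverse-spec x e 0<e e⊑x = let z , xz≋1 = inverse-exists x e 0<e e⊑x in
    subst₂ _≋_ (*≡ x (x ⁻¹)) (fromℕ≡# 1) (from≈ (pick-spec lem (λ y → x * y ≈ fromℕ 1) (fromℕ 0)
      (z , to≈ (subst₂ _≋_ (sym (*≡ x z)) (sym (fromℕ≡# 1)) xz≋1))))

  <⇒⊑ : ∀ {x y} → x < y → x ⊑ y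
  <⇒⊑ {x} {y} x<y = let e , 0<e , h = gap-⊕ {x} {y} x<y in begin
    x          ≈⟨ ⊕-identity# x ⟨
    # 0 ⊕ x    ≈⟨ ⊕-comm (# 0) x ⟩
    x ⊕ # 0    ≲⟨ ⊕-mono ⊑-refl (ι-nonneg (ℚₚ.<⇒≤ 0<e)) ⟩
    x ⊕ ι e    ≲⟨ h ⟩
    y          ∎

  0<⇒ι⊑ : ∀ {x} → fromℕ 0 < x → ∃ λ e → 0ℚ ℚ.< e × ι e ⊑ x
  0<⇒ι⊑ {x} 0<x = let e , 0<e , h = gap-⊕ {fromℕ 0} {x} 0<x in
    e , 0<e , ⊑-trans (above (⊕-identity# (ι e))) (subst (λ w → w ⊕ ι e ⊑ x) (fromℕ≡# 0) h)

  two : ℝ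
  two = ι (2 /1)

  2⁻¹≋½ : fromℕ 2 ⁻¹ ≋ ι ½
  2⁻¹≋½ = begin-equality
    fromℕ 2 ⁻¹                   ≈⟨ solve 1 (λ h → h := con ½ :* (con (2 /1) :* h)) ≋-refl (fromℕ 2 ⁻¹) ⟩
    ι ½ ⊗ (two ⊗ (fromℕ 2 ⁻¹))   ≡⟨ cong (λ w → ι ½ ⊗ (w ⊗ (fromℕ 2 ⁻¹))) (fromℕ≡ 2) ⟨
    ι ½ ⊗ (fromℕ 2 ⊗ (fromℕ 2 ⁻¹)) ≈⟨ ⊗-congˡ (ι ½) (inverse-spec (fromℕ 2) 1ℚ (ℚₚ.positive⁻¹ 1ℚ)
                                       (subst (ι 1ℚ ⊑_) (sym (fromℕ≡ 2)) (ι-mono (RationalLemmas./1-mono {1} {2} (ℕ.s≤s ℕ.z≤n))))) ⟩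
    ι ½ ⊗ # 1                    ≈⟨ ⊗-identity#ʳ (ι ½) ⟩
    ι ½                          ∎

  ⊑-multiple : ∀ {x} k → 1 ℕ.≤ k → # 0 ⊑ x → x ⊑ ι (k /1) ⊗ x
  ⊑-multiple {x} k 1≤k 0⊑x = begin
    x              ≈⟨ ⊗-identity# x ⟨
    # 1 ⊗ x        ≲⟨ ⊗-monoʳ x 0⊑x (#-mono 1≤k) ⟩
    # k ⊗ x        ≡⟨ cong (_⊗ x) (#≡ι k) ⟩
    ι (k /1) ⊗ x   ∎

  power-form : ∀ x t c h ε t′ D → t ≡ t′ → E (((t′ ⊕ ⊝ c) ⊗ h ⊕ ε) ⊗ log x) ≋ D → x ^ ((t - c) * h + ε) ≋ D
  power-form x t c h ε _ D refl = subst (_≋ D) (sym (trans (^≡ x ((t - c) * h + ε)) (cong (λ w → E (w ⊗ log x)) form)))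
    where
    form : (t - c) * h + ε ≡ (t ⊕ ⊝ c) ⊗ h ⊕ ε
    form = trans (+≡ ((t - c) * h) ε) (cong (_⊕ ε) (trans (*≡ (t - c) h) (cong (_⊗ h) (-≡ t c))))

  density-form : ∀ P D q r → P ≋ D → fromℕ 8 * P * fromℕ q ≤ fromℕ r → # 8 ⊗ D ⊗ # q ⊑ # r
  density-form P D q r P≋D h = ⊑-trans (below (⊗-congʳ (# q) (⊗-congˡ (# 8) (≋-sym P≋D))))
    (to⊑ form (fromℕ≡# r) h)
    where
    form : fromℕ 8 * P * fromℕ q ≡ # 8 ⊗ P ⊗ # q
    form = trans (*≡ (fromℕ 8 * P) (fromℕ q)) (cong₂ _⊗_
      (trans (*≡ (fromℕ 8) P) (cong (_⊗ P) (fromℕ≡# 8))) (fromℕ≡# q))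

  log-large : ∀ g N m₀ → E g ≋ # N → 4 ℕ.^ (4 ℕ.^ m₀) ℕ.≤ N → # (4 ℕ.^ m₀) ⊑ g
  log-large g N m₀ Eg N-large = E-cancel (begin
    E (# (4 ℕ.^ m₀))              ≲⟨ E-#-upper (4 ℕ.^ m₀) ⟩
    # (4 ℕ.^ (4 ℕ.^ m₀))          ≲⟨ #-mono N-large ⟩
    # N                           ≈⟨ Eg ⟨
    E g                           ∎)

  -- log N ≥ 4 ^ m₀ gives log(16 log N) ≥ m₀ ≥ 2ε K, so the logarithm h l of the lower bound for `y`
  -- is at least `K`, and exp(h l) ≥ 1 + h l.
  y-large : ∀ 2ε h g l K m₀ y → # 0 ⊑ h → 2ε ⊗ h ≋ # 1 → 2ε ⊗ # K ⊑ # m₀ → # (4 ℕ.^ m₀) ⊑ g →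
    E l ≋ ι (16 /1) ⊗ g → E (h ⊗ l) ⊑ y → # K ⊑ y
  y-large 2ε h g l K m₀ y 0⊑h inv K-bound g-large El≋ Ehl⊑y = begin
    # K             ≈⟨ ⊕-identity# (# K) ⟨
    # 0 ⊕ # K       ≲⟨ ⊕-mono (0⊑# 1) K⊑hl ⟩
    # 1 ⊕ h ⊗ l     ≲⟨ 1⊕⊑E# (⊑-trans (0⊑# K) K⊑hl) ⟩
    E (h ⊗ l)       ≲⟨ Ehl⊑y ⟩
    y               ∎
    where
    m₀⊑l : # m₀ ⊑ l
    m₀⊑l = E-cancel (begin
      E (# m₀)           ≲⟨ E-#-upper m₀ ⟩
      # (4 ℕ.^ m₀)       ≲⟨ g-large ⟩
      g                  ≲⟨ ⊑-multiple 16 (ℕ.s≤s ℕ.z≤n) (⊑-trans (0⊑# _) g-large) ⟩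
      ι (16 /1) ⊗ g      ≈⟨ El≋ ⟨
      E l                ∎)
    K⊑hl : # K ⊑ h ⊗ l
    K⊑hl = begin
      # K                ≈⟨ ⊗-identity# (# K) ⟨
      # 1 ⊗ # K          ≈⟨ ⊗-congʳ (# K) inv ⟨
      2ε ⊗ h ⊗ # K       ≈⟨ solve 3 (λ a h k → a :* h :* k := h :* (a :* k)) ≋-refl 2ε h (# K) ⟩
      h ⊗ (2ε ⊗ # K)     ≲⟨ ⊗-monoˡ h 0⊑h (⊑-trans K-bound m₀⊑l) ⟩
      h ⊗ l              ∎

  -- The lower bound for `y` raised to the power 2ε, carried out on logarithms: h l ≤ ℓ is
  -- multiplied by 2ε.
  16log⊑ : ∀ 2ε h g l y ℓ → # 0 ⊑ 2ε → 2ε ⊗ h ≋ # 1 → E l ≋ ι (16 /1) ⊗ g → E (h ⊗ l) ⊑ y → E ℓ ≋ y →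
    ι (16 /1) ⊗ g ⊑ E (2ε ⊗ ℓ)
  16log⊑ 2ε h g l y ℓ 0⊑2ε inv El≋ Ehl⊑y Eℓ≋y = begin
    ι (16 /1) ⊗ g       ≈⟨ El≋ ⟨
    E l                 ≈⟨ E-cong (⊗-identity# l) ⟨
    E (# 1 ⊗ l)         ≈⟨ E-cong (⊗-congʳ l inv) ⟨
    E (2ε ⊗ h ⊗ l)      ≈⟨ E-cong (⊗-assoc 2ε h l) ⟩
    E (2ε ⊗ (h ⊗ l))    ≲⟨ E-mono (⊗-monoˡ 2ε 0⊑2ε (E-cancel (⊑-trans Ehl⊑y (above Eℓ≋y)))) ⟩
    E (2ε ⊗ ℓ)          ∎

  ℤ-multiple : ∀ j d → RawMonoidDefinitions._×_ (AbelianGroup.rawMonoid ℤ-group) j d ≡ + j ℤ.* d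
  ℤ-multiple zero d = sym (ℤₚ.*-zeroˡ d)
  ℤ-multiple (suc j) d = trans (cong (λ w → d ℤ.+ w) (ℤ-multiple j d)) (sym (ℤₚ.suc-* (+ j) d))

  ℤ/-multiple : ∀ p j d → RawMonoidDefinitions._×_ (AbelianGroup.rawMonoid (ℤ/ p)) j d ≡ + j ℤ.* d
  ℤ/-multiple p zero d = sym (ℤₚ.*-zeroˡ d)
  ℤ/-multiple p (suc j) d = trans (cong (λ w → d ℤ.+ w) (ℤ/-multiple p j d)) (sym (ℤₚ.suc-* (+ j) d))

  ℤ/-progression : ∀ p P → IsArithmeticProgression (ℤ/ p) P → ∃ λ r → ∃ λ δ → ∃ λ K →
    (∀ z → P z ⇔ (∃ λ j → j ℕ.≤ K × (+ p) ℤ∣.∣ z ℤ.- (r ℤ.+ + j ℤ.* δ))) × card (ℤ/ p) P ≡ suc K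
  ℤ/-progression p P ap = build (reduced-progression lem (ℤ/ p) P ap)
    where
    build : Reduced lem (ℤ/ p) P → ∃ λ r → ∃ λ δ → ∃ λ K →
      (∀ z → P z ⇔ (∃ λ j → j ℕ.≤ K × (+ p) ℤ∣.∣ z ℤ.- (r ℤ.+ + j ℤ.* δ))) × card (ℤ/ p) P ≡ suc K
    build (r , δ , K , P⇔ , _ , card≡) = r , δ , K , (λ z → mk⇔
        (λ Pz → let j , j≤K , d = Equivalence.to (P⇔ z) Pz in
           j , j≤K , subst (λ w → (+ p) ℤ∣.∣ z ℤ.- (r ℤ.+ w)) (ℤ/-multiple p j δ) d)
        (λ (j , j≤K , d) → Equivalence.from (P⇔ z)
           (j , j≤K , subst (λ w → (+ p) ℤ∣.∣ z ℤ.- (r ℤ.+ w)) (sym (ℤ/-multiple p j δ)) d))) , card≡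

  ℤ-Progression : Pred ℤ 0ℓ → Set
  ℤ-Progression P = ∃₂ λ a d → ∃ λ k → (∀ x → P x ⇔ (∃ λ j → j ℕ.≤ k × x ≡ a ℤ.+ + j ℤ.* d)) ×
    (∀ i j → i ℕ.< j → j ℕ.≤ k → a ℤ.+ + i ℤ.* d ≢ a ℤ.+ + j ℤ.* d) × card ℤ-group P ≡ suc k

  ℤ-progression : ∀ P → IsArithmeticProgression ℤ-group P → ℤ-Progression P
  ℤ-progression P ap = build (reduced-progression lem ℤ-group P ap)
    where
    build : Reduced lem ℤ-group P → ℤ-Progression P
    build (a , d , k , P⇔ , distinct , card≡) = a , d , k , (λ x → mk⇔
        (λ Px → let j , j≤k , eq = Equivalence.to (P⇔ x) Px in
           j , j≤k , trans eq (cong (λ w → a ℤ.+ w) (ℤ-multiple j d)))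
        (λ (j , j≤k , eq) → Equivalence.from (P⇔ x)
           (j , j≤k , trans eq (cong (λ w → a ℤ.+ w) (sym (ℤ-multiple j d)))))) ,
      (λ i j i<j j≤k eq → distinct i j i<j j≤k (trans (cong (λ w → a ℤ.+ w) (ℤ-multiple i d))
           (trans eq (cong (λ w → a ℤ.+ w) (sym (ℤ-multiple j d)))))) , card≡

  -- One more than the 504 · 504 demanded of n = ⌊y⌋, because `n` is reached through y ≤ n + 1.
  threshold : ℕ
  threshold = suc (504 ℕ.* 504)

  module Assembly (ε : ℝ) (e : ℚ) (0<e : 0ℚ ℚ.< e) (e⊑ε : ι e ⊑ ε)
      (m₀ : ℕ) (K-bound : two ⊗ ε ⊗ # threshold ⊑ # m₀)
      (θ c : ℝ) (½≤θ : fromℕ 2 ⁻¹ ≤ θ) (θ<1 : θ < fromℕ 1) (2θ-1≤c : fromℕ 2 * θ - fromℕ 1 ≤ c) (c≤θ : c ≤ θ)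
      (N : ℕ) (N-large : 4 ℕ.^ (4 ℕ.^ m₀) ℕ.< N) (y : ℝ)
      (y-lower : (fromℕ 16 * log (fromℕ N)) ^ ((fromℕ 2 * ε) ⁻¹) ≤ y) (y≤N : y ≤ fromℕ N)
      (R : ℕ → Pred ℤ 0ℓ)
      (R-progression : ∀ p → Prime p → y ≤ fromℕ p → fromℕ p ≤ fromℕ 2 * y →
        IsArithmeticProgression (ℤ/ p) (R p) × fromℕ (card (ℤ/ p) (R p)) ≤ fromℕ p ^ θ)
      where

    0⊑ε : # 0 ⊑ ε
    0⊑ε = ⊑-trans (ι-nonneg (ℚₚ.<⇒≤ 0<e)) e⊑ε
    2ε h g l ℓ : ℝ
    2ε = two ⊗ ε
    h = (fromℕ 2 * ε) ⁻¹
    g = log (fromℕ N)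
    l = log (fromℕ 16 * g)
    ℓ = log y
    2ε≡ : fromℕ 2 * ε ≡ 2ε
    2ε≡ = trans (*≡ (fromℕ 2) ε) (cong (_⊗ ε) (fromℕ≡ 2))
    0⊑2ε : # 0 ⊑ 2ε
    0⊑2ε = 0⊑⊗ (ι-nonneg (RationalLemmas./1-nonneg 2)) 0⊑ε
    2εh≋1 : 2ε ⊗ h ≋ # 1
    2εh≋1 = subst (λ w → w ⊗ h ≋ # 1) 2ε≡ (inverse-spec (fromℕ 2 * ε) e 0<e
      (subst (ι e ⊑_) (sym 2ε≡) (⊑-trans e⊑ε (⊑-multiple 2 (ℕ.s≤s ℕ.z≤n) 0⊑ε))))
    0⊑h : # 0 ⊑ h
    0⊑h = nonneg-inverse 0⊑2ε 2εh≋1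
    Eg≋N : E g ≋ # N
    Eg≋N = subst (E g ≋_) (fromℕ≡# N) (log-spec (fromℕ N) (subst (# 1 ⊑_) (sym (fromℕ≡# N))
      (#-mono (ℕₚ.≤-trans (ℕ.s≤s ℕ.z≤n) N-large))))
    g-large : # (4 ℕ.^ m₀) ⊑ g
    g-large = log-large g N m₀ Eg≋N (ℕₚ.<⇒≤ N-large)
    0⊑g : # 0 ⊑ g
    0⊑g = ⊑-trans (0⊑# _) g-large
    16g≡ : fromℕ 16 * g ≡ ι (16 /1) ⊗ g
    16g≡ = trans (*≡ (fromℕ 16) g) (cong (_⊗ g) (fromℕ≡ 16))
    El≋16g : E l ≋ ι (16 /1) ⊗ g
    El≋16g = subst (E l ≋_) 16g≡ (log-spec (fromℕ 16 * g) (subst (# 1 ⊑_) (sym 16g≡) (begin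
      # 1                 ≲⟨ #-mono (ℕₚ.m^n>0 4 m₀) ⟩
      # (4 ℕ.^ m₀)        ≲⟨ g-large ⟩
      g                   ≲⟨ ⊑-multiple 16 (ℕ.s≤s ℕ.z≤n) 0⊑g ⟩
      ι (16 /1) ⊗ g       ∎)))
    Ehl⊑y : E (h ⊗ l) ⊑ y
    Ehl⊑y = to⊑ (^≡ (fromℕ 16 * g) h) refl y-lower
    threshold⊑y : # threshold ⊑ y
    threshold⊑y = y-large 2ε h g l threshold m₀ y 0⊑h 2εh≋1 K-bound g-large El≋16g Ehl⊑y
    1⊑y : # 1 ⊑ y
    1⊑y = ⊑-trans (#-mono (ℕ.s≤s ℕ.z≤n)) threshold⊑y
    Eℓ≋y : E ℓ ≋ y
    Eℓ≋y = log-spec y 1⊑y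
    y⊑N : y ⊑ # N
    y⊑N = to⊑ refl (fromℕ≡# N) y≤N

    ½⊑θ : ι ½ ⊑ θ
    ½⊑θ = ⊑-trans (above 2⁻¹≋½) (wrap ½≤θ)
    θ⊑1 : θ ⊑ # 1
    θ⊑1 = subst (θ ⊑_) (fromℕ≡# 1) (<⇒⊑ θ<1)
    2θ-1≡ : fromℕ 2 * θ - fromℕ 1 ≡ two ⊗ θ ⊕ ⊝ ι 1ℚ
    2θ-1≡ = trans (-≡ (fromℕ 2 * θ) (fromℕ 1)) (cong₂ (λ a b → a ⊕ ⊝ b)
      (trans (*≡ (fromℕ 2) θ) (cong (_⊗ θ) (fromℕ≡ 2))) (trans (fromℕ≡# 1) #1≡))

    open Exponents θ c ε ℓ y g ½⊑θ θ⊑1 (to⊑ 2θ-1≡ refl 2θ-1≤c) (wrap c≤θ) 0⊑ε (0⊑log Eℓ≋y 1⊑y) Eℓ≋y 0⊑g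
      (16log⊑ 2ε h g l y ℓ 0⊑2ε 2εh≋1 El≋16g Ehl⊑y Eℓ≋y)

    n X : ℕ
    n = proj₁ (floor y 0⊑y)
    X = proj₁ (floor (# 2 ⊗ Eθ) (0⊑⊗ (0⊑# 2) (0⊑E (θ ⊗ ℓ))))
    n⊑y : # n ⊑ y
    n⊑y = proj₁ (proj₂ (floor y 0⊑y))
    y⊑1+n : y ⊑ # (suc n)
    y⊑1+n = proj₁ (proj₂ (proj₂ (floor y 0⊑y)))
    X⊑ : # X ⊑ # 2 ⊗ Eθ
    X⊑ = proj₁ (proj₂ (floor (# 2 ⊗ Eθ) (0⊑⊗ (0⊑# 2) (0⊑E (θ ⊗ ℓ)))))
    X-max : ∀ j → # j ⊑ # 2 ⊗ Eθ → j ℕ.≤ X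
    X-max = proj₂ (proj₂ (proj₂ (floor (# 2 ⊗ Eθ) (0⊑⊗ (0⊑# 2) (0⊑E (θ ⊗ ℓ))))))
    n₀≤n : 504 ℕ.* 504 ℕ.≤ n
    n₀≤n = ℕ.s≤s⁻¹ (#-cancel (⊑-trans threshold⊑y y⊑1+n))
    n≤N : n ℕ.≤ N
    n≤N = #-cancel (⊑-trans n⊑y y⊑N)
    X≤2N : X ℕ.≤ 2 ℕ.* N
    X≤2N = #-cancel (begin
      # X             ≲⟨ X⊑ ⟩
      # 2 ⊗ Eθ        ≲⟨ ⊗-monoˡ (# 2) (0⊑# 2) (⊑-trans Eθ⊑y y⊑N) ⟩
      # 2 ⊗ # N       ≈⟨ #-* 2 N ⟨
      # (2 ℕ.* N)     ∎)

    Good : ℕ → Set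
    Good p = Prime p × y ≤ fromℕ p × fromℕ p ≤ fromℕ 2 * y
    2y≡ : fromℕ 2 * y ≡ # 2 ⊗ y
    2y≡ = trans (*≡ (fromℕ 2) y) (cong (_⊗ y) (fromℕ≡# 2))
    n≤good : ∀ p → Good p → n ℕ.≤ p
    n≤good p (_ , y≤p , _) = #-cancel (⊑-trans n⊑y (to⊑ refl (fromℕ≡# p) y≤p))
    dyadic⇒good : ∀ p → Prime p → n ℕ.< p → p ℕ.≤ n ℕ.+ n → Good p
    dyadic⇒good p pp n<p p≤2n = pp , from⊑ refl (fromℕ≡# p) (⊑-trans y⊑1+n (#-mono n<p)) ,
      from⊑ (fromℕ≡# p) 2y≡ (begin
        # p             ≲⟨ #-mono (ℕₚ.≤-trans p≤2n (ℕₚ.≤-reflexive (cong (n ℕ.+_) (sym (ℕₚ.+-identityʳ n))))) ⟩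
        # (2 ℕ.* n)     ≈⟨ #-* 2 n ⟩
        # 2 ⊗ # n       ≲⟨ ⊗-monoˡ (# 2) (0⊑# 2) n⊑y ⟩
        # 2 ⊗ y         ∎)

    log-# : ∀ k → 1 ℕ.≤ k → E (log (fromℕ k)) ≋ # k
    log-# k 1≤k = subst (E (log (fromℕ k)) ≋_) (fromℕ≡# k)
      (log-spec (fromℕ k) (subst (# 1 ⊑_) (sym (fromℕ≡# k)) (#-mono 1≤k)))

    1≤p : ∀ p → Good p → 1 ℕ.≤ p
    1≤p p gp = ℕₚ.≤-trans (ℕₚ.≤-trans (ℕₚ.≤ᵇ⇒≤ 1 (504 ℕ.* 504) tt) n₀≤n) (n≤good p gp)

    size≤X : ∀ p → Good p → ∀ q → fromℕ q ≤ fromℕ p ^ θ → q ℕ.≤ X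
    size≤X p gp@(_ , _ , p≤2y) q q≤ = X-max q (begin
      # q                             ≲⟨ to⊑ (fromℕ≡# q) (^≡ (fromℕ p) θ) q≤ ⟩
      E (θ ⊗ log (fromℕ p))           ≲⟨ prime-power-bound (log (fromℕ 2)) (log (fromℕ p)) p (log-# 2 (ℕ.s≤s ℕ.z≤n))
                                           (log-# p (1≤p p gp)) (to⊑ (fromℕ≡# p) 2y≡ p≤2y) ⟩
      # 2 ⊗ Eθ                        ∎)

    representation : ∀ p → Good p → ∃ λ r → ∃ λ δ → ∃ λ K → K ℕ.≤ X ×
      ∀ z → R p z ⇔ (∃ λ j → j ℕ.≤ K × (+ p) ℤ∣.∣ z ℤ.- (r ℤ.+ + j ℤ.* δ))
    representation p gp@(pp , y≤p , p≤2y) =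
      let ap , card≤ = R-progression p pp y≤p p≤2y
          r , δ′ , K , R⇔ , card≡ = ℤ/-progression p (R p) ap
      -- The representation is free of repetitions, so K + 1 is the cardinality of R p.
      in r , δ′ , K , ℕₚ.≤-trans (ℕₚ.n≤1+n K) (subst (ℕ._≤ X) card≡ (size≤X p gp (card (ℤ/ p) (R p)) card≤)) , R⇔

    A : Pred ℤ 0ℓ
    A = Sifted N y R

    half : ℝ
    half = fromℕ 2 ⁻¹

    half≋½ : half ≋ ι ½
    half≋½ = 2⁻¹≋½

    P : ℝ
    P = y ^ ((fromℕ 2 * θ - fromℕ 1 - c) * half + ε)

    E-exponent≋ : E (((two ⊗ θ ⊕ ⊝ ι 1ℚ ⊕ ⊝ c) ⊗ half ⊕ ε) ⊗ ℓ) ≋ D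
    E-exponent≋ = E-cong (⊗-congʳ ℓ (⊕-cong (⊗-congˡ (two ⊗ θ ⊕ ⊝ ι 1ℚ ⊕ ⊝ c) half≋½) (≋-refl {ε})))

    P≋D : P ≋ D
    P≋D = power-form y (fromℕ 2 * θ - fromℕ 1) c half ε (two ⊗ θ ⊕ ⊝ ι 1ℚ) D 2θ-1≡ E-exponent≋

    module _ (Q : Pred ℤ 0ℓ) (Q-progression : IsArithmeticProgression ℤ-group Q)
        (Q-large : y ^ c ≤ fromℕ (card ℤ-group Q))
        (dense : fromℕ 8 * y ^ ((fromℕ 2 * θ - fromℕ 1 - c) * fromℕ 2 ⁻¹ + ε) * fromℕ (card ℤ-group Q)
          ≤ fromℕ (card ℤ-group (A ∩ Q))) where

      #Q #AQ : ℕ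
      #Q = card ℤ-group Q
      #AQ = card ℤ-group (A ∩ Q)

      dense⊑ : # 8 ⊗ D ⊗ # #Q ⊑ # #AQ
      dense⊑ = density-form P D #Q #AQ P≋D dense

      conclude : IsArithmeticProgression ℤ-group A
      conclude = with-Q (ℤ-progression Q Q-progression)
        where
        with-Q : ℤ-Progression Q → IsArithmeticProgression ℤ-group A
        with-Q (a , d , k , Q⇔ , distinct , card≡) = with-length (ceil Ec)
          where
          with-length : (∃ λ L₀ → Ec ⊑ # L₀ × (∀ j → Ec ⊑ # j → L₀ ℕ.≤ j) × ∀ l → L₀ ≡ suc l → # l ⊑ Ec) →
            IsArithmeticProgression ℤ-group A
          -- y^c ≥ 1 excludes an empty window. Otherwise its length L + 1 is ⌈y^c⌉, which fits into
          -- `Q` because |Q| ≥ y^c.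
          with-length (zero , Ec⊑0 , _) = ⊥-elim (ℕₚ.<⇒≱ (ℕ.s≤s ℕ.z≤n) (#-cancel (⊑-trans 1⊑Ec Ec⊑0)))
          with-length (suc L , Ec⊑L₀ , L₀-min , L⊑) =
            with-window (dense-window lem A Q a d k Q⇔ distinct (suc L) L₀≤1+k)
            where
            L₀≤1+k : suc L ℕ.≤ suc k
            L₀≤1+k = L₀-min (suc k) (subst (λ w → Ec ⊑ # w) card≡ (to⊑ (^≡ y c) (fromℕ≡# #Q) Q-large))
            with-window : Window lem A Q d k (suc L) → IsArithmeticProgression ℤ-group A
            with-window (M , a′ , x , x-inj , x<L₀ , Ax , count) = with-M M x x-inj x<L₀ Ax 4≤M hM
              where
              hM : # 4 ⊗ D ⊗ # (suc L) ⊑ # M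
              -- The number cancelled is 2 |Q| = 2 (k + 1), passed through its predecessor.
              hM = ⊗-cancelʳ (k ℕ.+ suc (k ℕ.+ 0)) (begin
                # 4 ⊗ D ⊗ # (suc L) ⊗ # (2 ℕ.* suc k)       ≈⟨ ⊗-congˡ _ (#-* 2 (suc k)) ⟩
                # 4 ⊗ D ⊗ # (suc L) ⊗ (# 2 ⊗ # (suc k))
                  ≈⟨ solve 5 (λ a b D L k → a :* D :* L :* (b :* k) := a :* b :* D :* k :* L) ≋-refl (# 4) (# 2) D (# (suc L)) (# (suc k)) ⟩
                # 4 ⊗ # 2 ⊗ D ⊗ # (suc k) ⊗ # (suc L)
                  ≈⟨ ⊗-congʳ _ (⊗-congʳ _ (⊗-congʳ D (#-* 4 2))) ⟨
                # 8 ⊗ D ⊗ # (suc k) ⊗ # (suc L)             ≡⟨ cong (λ w → # 8 ⊗ D ⊗ # w ⊗ # (suc L)) card≡ ⟨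
                # 8 ⊗ D ⊗ # (#Q) ⊗ # (suc L)    ≲⟨ ⊗-monoʳ _ (0⊑# _) dense⊑ ⟩
                # (#AQ) ⊗ # (suc L)        ≈⟨ #-* _ (suc L) ⟨
                # (#AQ ℕ.* suc L)          ≲⟨ #-mono count ⟩
                # (M ℕ.* (2 ℕ.* suc k))                     ≈⟨ #-* M _ ⟩
                # M ⊗ # (2 ℕ.* suc k)                       ∎)
              4≤M : 4 ℕ.≤ M
              4≤M = four≤M M (suc L) hM Ec⊑L₀
              with-M : ∀ M (x : Fin M → ℕ) → (∀ u v → x u ≡ x v → u ≡ v) → (∀ u → x u ℕ.< suc L) →
                (∀ u → A (a′ ℤ.+ + x u ℤ.* d)) → 4 ℕ.≤ M → # 4 ⊗ D ⊗ # (suc L) ⊑ # M → IsArithmeticProgression ℤ-group A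
              with-M (suc m) x x-inj x<L₀ Ax (ℕ.s≤s 3≤m) hM = to-progression (Core.sifted-progression a′ d d≢0 x x-inj
                  (λ u → ℕ.s≤s⁻¹ (x<L₀ u)) (λ u → let 0≤ , ≤N , h = Ax u in 0≤ , ≤N , λ p (pp , y≤p , p≤2y) → h p pp y≤p p≤2y))
                where
                M≤L₀ : suc m ℕ.≤ suc L
                M≤L₀ = injection-bound (suc L) x x-inj x<L₀
                -- Here c ≤ θ enters: the last position L = ⌈y^c⌉ - 1 is at most y^c ≤ y^θ.
                L≤X : L ℕ.≤ X
                L≤X = X-max L (begin
                  # L            ≲⟨ L⊑ L refl ⟩
                  Ec             ≲⟨ Ec⊑Eθ ⟩
                  Eθ             ≈⟨ ⊗-identity# Eθ ⟨
                  # 1 ⊗ Eθ       ≲⟨ ⊗-monoʳ Eθ (0⊑E _) (#-mono (ℕ.s≤s ℕ.z≤n)) ⟩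
                  # 2 ⊗ Eθ       ∎)
                -- With step 0 the first two terms of `Q` would coincide, although the
                -- representation is free of repetitions and the window has at least four points.
                d≢0 : d ≢ + 0
                d≢0 refl = distinct 0 1 (ℕ.s≤s ℕ.z≤n) 1≤k refl
                  where
                  1≤k : 1 ℕ.≤ k
                  1≤k = ℕₚ.≤-trans (ℕₚ.≤-trans (ℕ.s≤s ℕ.z≤n) 3≤m) (ℕₚ.≤-trans (ℕ.s≤s⁻¹ M≤L₀) (ℕ.s≤s⁻¹ L₀≤1+k))
                module Core = Progression lem N n X m L Good R (λ p gp → proj₁ gp) n≤good dyadic⇒good n₀≤n n≤N 3≤m
                  (ℕ.s≤s⁻¹ M≤L₀) L≤X X≤2N (power-inequality m (suc L) X n N 3≤m hM M≤L₀ Ec⊑L₀ X⊑ y⊑1+n Eg≋N) representation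
                to-progression : (∃₂ λ b q → ∃ λ k → ∀ z → Core.A z ⇔ (∃ λ j → j ℕ.≤ k × z ≡ b ℤ.+ + j ℤ.* q)) →
                  IsArithmeticProgression ℤ-group A
                to-progression (b , q , k , A⇔) = b , q , k , λ z → mk⇔
                  (λ (0≤z , z≤N , h) → let j , j≤k , eq = Equivalence.to (A⇔ z) (0≤z , z≤N , λ p (pp , y≤p , p≤2y) → h p pp y≤p p≤2y) in
                    j , j≤k , trans eq (cong (λ w → b ℤ.+ w) (sym (ℤ-multiple j q))))
                  (λ (j , j≤k , eq) → let 0≤z , z≤N , h = Equivalence.from (A⇔ z) (j , j≤k , trans eq (cong (λ w → b ℤ.+ w) (ℤ-multiple j q))) in
                    0≤z , z≤N , λ p pp y≤p p≤2y → h p (pp , y≤p , p≤2y))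

theorem1p4 : (lem : ExcludedMiddle 0ℓ) →
    let open Classical lem in
    ∀ (ε : ℝ) → fromℕ 0 < ε →
    ∃ λ (N₀ : ℕ) →
    ∀ (θ c : ℝ) →
    fromℕ 2 ⁻¹ ≤ θ → θ < fromℕ 1 →
    fromℕ 2 * θ - fromℕ 1 ≤ c → c ≤ θ →
    ∀ (N : ℕ) → N₀ ℕ.< N →
    ∀ (y : ℝ) →
    (fromℕ 16 * log (fromℕ N)) ^ ((fromℕ 2 * ε) ⁻¹) ≤ y → y ≤ fromℕ N →
    ∀ (R : ℕ → Pred ℤ 0ℓ) →
    (∀ p → Prime p → y ≤ fromℕ p → fromℕ p ≤ fromℕ 2 * y →
    IsArithmeticProgression (ℤ/ p) (R p) × fromℕ (card (ℤ/ p) (R p)) ≤ fromℕ p ^ θ) →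
    (∃ λ (Q : Pred ℤ 0ℓ) →
    IsArithmeticProgression ℤ-group Q ×
    y ^ c ≤ fromℕ (card ℤ-group Q) ×
    fromℕ 8 * y ^ ((fromℕ 2 * θ - fromℕ 1 - c) * fromℕ 2 ⁻¹ + ε) * fromℕ (card ℤ-group Q)
    ≤ fromℕ (card ℤ-group (Sifted N y R ∩ Q))) →
    IsArithmeticProgression ℤ-group (Sifted N y R)
theorem1p4 lem ε 0<ε =
  let open Interface lem
      e , 0<e , e⊑ε = 0<⇒ι⊑ 0<ε
      m₀ , bound = upper-bound# (two ⊗ ε ⊗ # threshold)
  -- The two exponentials undo the two logarithms in log(16 log N); `m₀` bounds 2ε · `threshold` and
  -- depends on ε alone.
  in 4 ℕ.^ (4 ℕ.^ m₀) , λ θ c h₁ h₂ h₃ h₄ N N₀<N y h₅ h₆ R h₇ (Q , Q-ap , Q-large , dense) →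
    Assembly.conclude ε e 0<e e⊑ε m₀ bound θ c h₁ h₂ h₃ h₄ N N₀<N y h₅ h₆ R h₇ Q Q-ap Q-large dense
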